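{- For each real $\lambda\geq 1$ there exists $c=c(\lambda)>0$ such that every graph with average degree $d$ and maximum degree at most $\lambda d$ contains an $r$-regular subgraph for every positive integer $r\leq cd$.
   Context: All graphs are finite and simple with non-empty vertex sets. An $r$-regular subgraph is a subgraph (with non-empty vertex set) in which every vertex has degree exactly $r$. -}

module Defs where

open import Data.Nat using (ℕ; zero; suc; _+_; _⊔_)
open import Data.Bool using (Bool; true; false; if_then_else_)
open import Data.Fin using (Fin)
open import Data.List using (List; map; foldr; allFin)
open import Data.Nat.ListAction using (sum)
open import Data.Integer using (+_)
open import Data.Rational using (ℚ; _/_)
open import Data.Product using (∃-syntax)
open import Relation.Binary.PropositionalEquality using (_≡_)

record Graph (n : ℕ) : Set where
  field
    adj    : Fin n → Fin n → Bool
    sym    : ∀ u v → adj u v ≡ adj v u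
    irrefl : ∀ v → adj v v ≡ false
open Graph public

degreeIn : {n : ℕ} → (Fin n → Fin n → Bool) → Fin n → ℕ
degreeIn {n} E v = sum (map (λ u → if E v u then 1 else 0) (allFin n))

degree : {n : ℕ} → Graph n → Fin n → ℕ
degree G = degreeIn (adj G)

degreeSum : {n : ℕ} → Graph n → ℕ
degreeSum {n} G = sum (map (degree G) (allFin n))

maxDegree : {n : ℕ} → Graph n → ℕ
maxDegree {n} G = foldr _⊔_ 0 (map (degree G) (allFin n))

avgDegree : {n : ℕ} → Graph (suc n) → ℚ
avgDegree {n} G = (+ degreeSum G) / suc n

toℚ : ℕ → ℚ
toℚ m = (+ m) / 1

record RegularSubgraph {n : ℕ} (G : Graph n) (r : ℕ) : Set where
  field
    vs       : Fin n → Bool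
    es       : Fin n → Fin n → Bool
    es-sym   : ∀ u v → es u v ≡ es v u
    es⊆adj   : ∀ u v → es u v ≡ true → adj G u v ≡ true
    es-vs    : ∀ u v → es u v ≡ true → vs u ≡ true
    nonempty : ∃[ v ] (vs v ≡ true)
    regular  : ∀ v → vs v ≡ true → degreeIn es v ≡ r

{-# OPTIONS --safe #-}
-- Pass to a bipartite subgraph with half of the edges and then to one of minimum degree at least
-- M / β, where M = λ d bounds all degrees and β = 8 λ. Keep each vertex v of weighted degree D v
-- with probability D v / M and multiply the weights of its edges by M / D v: every weighted degree
-- then has mean M, and the variance is governed by the total deficiency ∑ (M − D v) before the step.
-- So a root mean square deficiency s becomes O(√s), and iterating makes it O(1), at the cost
-- of giving up a proportion O(1 / M) of the vertices, whose weights would have grown too much.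
-- Scaling M down to 2 q − 1, where q is a power of 2 with r ≤ q < 2 r, the average deficiency is
-- less than 1; since the graph is bipartite, the weights can be rounded to a subgraph with maximum
-- degree at most 2 q − 1 and more than (q − 1) n edges. By the theorem of Olson and of
-- Alon, Friedland and Kalai, it has a nonempty subgraph with all degrees divisible by q,
-- hence a q-regular one, and this contains an r-regular one because it is bipartite.
module Submission where

-- Every round multiplies weights, and the variance bound is proportional to the largest weight, so
-- the boosts must have a bounded product over all rounds. For this the root mean square deficiency
-- is carried as a product `ρ * t`. A vertex whose weighted degree falls below (1 - t) M is declared
-- dead and no longer boosted; the boosts of the others are at most 1 / (1 - t). Although O(√s)
-- would be available, a round is only asked to turn s into s / 4, halving both factors: the product
-- of the boosts then stays bounded, and by Chebyshev's inequality the numbers of new dead vertices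
-- are at most the terms ρ² N / M² of a geometric series. Dead vertices keep their weights until the
-- end, since deleting them earlier would open new gaps at their neighbours; the final deletion
-- costs a bounded amount per vertex on average. Sampling is derandomized: an outcome is chosen
-- whose cost, the squared errors plus a price for each lost vertex, is at most the mean cost.
-- Integral max-flow min-cut serves twice, for rounding the weights and for passing from q to r. In
-- Olson's theorem, iterated finite differences over 𝔽₂ take the place of the group ring.

module Finite where

  import Algebra.Properties.Semiring.Sum
  open import Data.Bool using (Bool; true; false; not; _∧_; _∨_; _xor_)
  import Data.Bool.Properties as Boolₚ
  open import Data.Empty using (⊥; ⊥-elim)
  open import Data.Fin using (Fin; zero; suc; _↑ˡ_; _↑ʳ_; combine; remQuot)
  open import Data.Fin.Properties using (_≟_; any?; remQuot-combine; combine-remQuot)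
  open import Data.Nat hiding (_≟_)
  open import Data.Nat.Divisibility
  open import Data.Nat.Properties hiding (_≟_)
  open import Data.Nat.Tactic.RingSolver using (solve-∀)
  open import Data.Product using (∃-syntax; _×_; _,_; proj₁; proj₂; uncurry)
  open import Data.Sum using (_⊎_; inj₁; inj₂)
  open import Function using (_∘_)
  open import Relation.Binary.PropositionalEquality
  open import Relation.Nullary using (Dec; does; yes; no; _×-dec_)
  open import Relation.Nullary.Decidable using (map′; True; toWitness)

  -- Finite sums of natural numbers, and minimization over subsets

  module ℕ∑ = Algebra.Properties.Semiring.Sum +-*-semiring

  opaque
    sum : ∀ {n} → (Fin n → ℕ) → ℕ
    sum = ℕ∑.sum

  𝟙 : Bool → ℕ
  𝟙 true  = 1
  𝟙 false = 0

  δ : ∀ {n} → Fin n → Fin n → Bool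
  δ i j = does (i ≟ j)

  δ⇒≡ : ∀ {n} (i j : Fin n) → δ i j ≡ true → i ≡ j
  δ⇒≡ i j eq with i ≟ j
  ... | yes i≡j = i≡j
  δ⇒≡ i j () | no _

  opaque
    unfolding sum

    sum-mono : ∀ {n} {f g : Fin n → ℕ} → (∀ i → f i ≤ g i) → sum f ≤ sum g
    sum-mono {zero}  f≤g = z≤n
    sum-mono {suc n} f≤g = +-mono-≤ (f≤g zero) (sum-mono {n} (f≤g ∘ suc))

    sum-cong : ∀ {n} {f g : Fin n → ℕ} → (∀ i → f i ≡ g i) → sum f ≡ sum g
    sum-cong = ℕ∑.sum-cong-≗

    sum-0 : ∀ {n} {f : Fin n → ℕ} → (∀ i → f i ≡ 0) → sum f ≡ 0
    sum-0 {n} f≡0 = trans (sum-cong f≡0) (ℕ∑.sum-replicate-zero n)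

    term≤sum : ∀ {n} (f : Fin n → ℕ) i → f i ≤ sum f
    term≤sum f zero    = m≤m+n _ _
    term≤sum f (suc i) = ≤-trans (term≤sum (f ∘ suc) i) (m≤n+m _ _)

    sum-δ : ∀ {n} (f : Fin n → ℕ) i → sum (λ j → 𝟙 (δ j i) * f j) ≡ f i
    sum-δ {suc n} f zero = begin
      f zero + 0 + sum (λ j → 𝟙 (δ (suc j) (zero {n})) * f (suc j))
        ≡⟨ cong (f zero + 0 +_) (sum-0 {n} (λ _ → refl)) ⟩
      f zero + 0 + 0  ≡⟨ +-identityʳ _ ⟩
      f zero + 0      ≡⟨ +-identityʳ _ ⟩
      f zero          ∎ where open ≡-Reasoning
    sum-δ (f) (suc i) = sum-δ (f ∘ suc) i

    sum-↑ : ∀ m {n} (f : Fin (m + n) → ℕ) →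
            sum f ≡ sum (λ i → f (i ↑ˡ n)) + sum (λ j → f (m ↑ʳ j))
    sum-↑ zero    f = refl
    sum-↑ (suc m) f = trans (cong (f zero +_) (sum-↑ m (f ∘ suc))) (sym (+-assoc (f zero) _ _))

    sum-combine : ∀ m {n} (f : Fin (m * n) → ℕ) → sum f ≡ sum {m} (λ i → sum {n} (λ j → f (combine i j)))
    sum-combine zero        f = refl
    sum-combine (suc m) {n} f = trans (sum-↑ n {m * n} f) (cong (sum (λ j → f (j ↑ˡ m * n)) +_) (sum-combine m {n} (λ j → f (n ↑ʳ j))))

    sum-suc : ∀ {n} (f : Fin (suc n) → ℕ) → sum f ≡ f zero + sum (f ∘ suc)
    sum-suc f = refl

    sum-+ : ∀ {n} (f g : Fin n → ℕ) → sum (λ i → f i + g i) ≡ sum f + sum g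
    sum-+ = ℕ∑.∑-distrib-+

    sum-* : ∀ {n} c (f : Fin n → ℕ) → c * sum f ≡ sum (λ i → c * f i)
    sum-* c f = ℕ∑.*-distribˡ-sum c f

    sum-swap : ∀ {m n} (f : Fin m → Fin n → ℕ) →
               sum (λ i → sum (λ j → f i j)) ≡ sum (λ j → sum (λ i → f i j))
    sum-swap = ℕ∑.∑-comm

    sum-zero : (f : Fin 0 → ℕ) → sum f ≡ 0
    sum-zero f = refl

  ∑∑-mono : ∀ {m n} {f g : Fin m → Fin n → ℕ} → (∀ i j → f i j ≤ g i j) →
            sum (λ i → sum (f i)) ≤ sum (λ i → sum (g i))
  ∑∑-mono f≤g = sum-mono (λ i → sum-mono (f≤g i))

  ∑∑-distrib-+ : ∀ {m n} (f g : Fin m → Fin n → ℕ) →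
    sum (λ i → sum (λ j → f i j + g i j)) ≡ sum (λ i → sum (f i)) + sum (λ i → sum (g i))
  ∑∑-distrib-+ f g = trans (sum-cong (λ i → sum-+ (f i) (g i))) (sum-+ (λ i → sum (f i)) (λ i → sum (g i)))

  ∑∑-δ : ∀ {m n} (f : Fin m → Fin n → ℕ) a b →
         sum (λ i → sum (λ j → 𝟙 (δ i a) * (𝟙 (δ j b) * f i j))) ≡ f a b
  ∑∑-δ f a b = begin
    sum (λ i → sum (λ j → 𝟙 (δ i a) * (𝟙 (δ j b) * f i j)))
      ≡⟨ sum-cong (λ i → sym (sum-* (𝟙 (δ i a)) (λ j → 𝟙 (δ j b) * f i j))) ⟩
    sum (λ i → 𝟙 (δ i a) * sum (λ j → 𝟙 (δ j b) * f i j))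
      ≡⟨ sum-δ (λ i → sum (λ j → 𝟙 (δ j b) * f i j)) a ⟩
    sum (λ j → 𝟙 (δ j b) * f a j)
      ≡⟨ sum-δ (f a) b ⟩
    f a b ∎ where open ≡-Reasoning

  opaque
    -- The congruence hypothesis stands in for function extensionality: a subset rebuilt by `_∷ᶠ_`
    -- agrees with the given one only pointwise.
    argmin : ∀ n (f : (Fin n → Bool) → ℕ) → (∀ {X Y} → (∀ i → X i ≡ Y i) → f X ≡ f Y) →
             ∃[ X ] (∀ Y → f X ≤ f Y)
    argmin zero    f f-cong = (λ ()) , λ Y → ≤-reflexive (f-cong (λ ()))
    argmin (suc n) f f-cong = choose (argmin n (λ X → f (true ∷ᶠ X)) (λ eq → f-cong (ext eq)))
                                     (argmin n (λ X → f (false ∷ᶠ X)) (λ eq → f-cong (ext eq)))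
      where
      _∷ᶠ_ : Bool → (Fin n → Bool) → Fin (suc n) → Bool
      (b ∷ᶠ X) zero    = b
      (b ∷ᶠ X) (suc i) = X i
      ext : ∀ {b X Y} → (∀ i → X i ≡ Y i) → ∀ i → (b ∷ᶠ X) i ≡ (b ∷ᶠ Y) i
      ext eq zero    = refl
      ext eq (suc i) = eq i
      split : ∀ Y m → (∀ X → m ≤ f (true ∷ᶠ X)) → (∀ X → m ≤ f (false ∷ᶠ X)) → m ≤ f Y
      split Y m t s with Y zero in eq
      ... | true  = ≤-trans (t (Y ∘ suc)) (≤-reflexive (f-cong λ { zero → sym eq ; (suc _) → refl }))
      ... | false = ≤-trans (s (Y ∘ suc)) (≤-reflexive (f-cong λ { zero → sym eq ; (suc _) → refl }))
      choose : ∃[ X ] (∀ Y → f (true ∷ᶠ X) ≤ f (true ∷ᶠ Y)) →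
               ∃[ X ] (∀ Y → f (false ∷ᶠ X) ≤ f (false ∷ᶠ Y)) → ∃[ X ] (∀ Y → f X ≤ f Y)
      choose (X , X-min) (X′ , X′-min) with ≤-total (f (true ∷ᶠ X)) (f (false ∷ᶠ X′))
      ... | inj₁ le = true ∷ᶠ X , λ Y → split Y _ X-min (λ Z → ≤-trans le (X′-min Z))
      ... | inj₂ ge = false ∷ᶠ X′ , λ Y → split Y _ (λ Z → ≤-trans ge (X-min Z)) X′-min

  ∀? : {P : Bool → Set} → (∀ b → Dec (P b)) → Dec (∀ b → P b)
  ∀? P? = map′ (λ { (p , q) → λ { true → p ; false → q } }) (λ f → f true , f false) (P? true ×-dec P? false)

  by-cases : {A : Set} (A? : Dec A) {_ : True A?} → A
  by-cases A? {t} = toWitness t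

  -- Cuts and integral flows in bipartite networks with unit edges

  private
    -- For one arc `e`, the `x` tell whether its tail lies in the two sets and the `y` whether its
    -- head does. The third term on the left detects arcs from the first set minus the second to the
    -- second minus the first.
    point-submodular : ∀ e x₁ y₁ x₂ y₂ →
      𝟙 (e ∧ (x₁ ∧ x₂) ∧ not (y₁ ∧ y₂)) + 𝟙 (e ∧ (x₁ ∨ x₂) ∧ not (y₁ ∨ y₂))
        + 𝟙 (e ∧ (x₁ ∧ not x₂) ∧ (not y₁ ∧ y₂))
      ≤ 𝟙 (e ∧ x₁ ∧ not y₁) + 𝟙 (e ∧ x₂ ∧ not y₂)
    point-submodular = by-cases (∀? λ e → ∀? λ x₁ → ∀? λ y₁ → ∀? λ x₂ → ∀? λ y₂ → _ ≤? _)

    point-modular : ∀ x₁ x₂ → 𝟙 (x₁ ∧ x₂) + 𝟙 (x₁ ∨ x₂) ≤ 𝟙 x₁ + 𝟙 x₂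
    point-modular = by-cases (∀? λ x₁ → ∀? λ x₂ → _ ≤? _)

    point-modular-not : ∀ x₁ x₂ → 𝟙 (not (x₁ ∧ x₂)) + 𝟙 (not (x₁ ∨ x₂)) ≤ 𝟙 (not x₁) + 𝟙 (not x₂)
    point-modular-not = by-cases (∀? λ x₁ → ∀? λ x₂ → _ ≤? _)

  module _ {n : ℕ} where

    edges : (Fin n → Fin n → Bool) → ℕ
    edges e = sum (λ u → sum (λ v → 𝟙 (e u v)))

    outsideCapacity insideCapacity : (Fin n → ℕ) → (Fin n → Bool) → ℕ
    outsideCapacity c Z = sum (λ v → c v * 𝟙 (not (Z v)))
    insideCapacity  c Z = sum (λ v → c v * 𝟙 (Z v))

    leaving : (Fin n → Fin n → Bool) → (Fin n → Bool) → ℕ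
    leaving e Z = edges (λ u v → e u v ∧ Z u ∧ not (Z v))

    -- The capacity of the cut Z of the network with an arc of capacity cr v into v from the source,
    -- one of capacity cc v from v to the sink, and one of capacity 1 from u to v for each edge.
    cut : (Fin n → Fin n → Bool) → (Fin n → ℕ) → (Fin n → ℕ) → (Fin n → Bool) → ℕ
    cut e cr cc Z = outsideCapacity cr Z + insideCapacity cc Z + leaving e Z

    cut-cong : ∀ e cr cc {X Y} → (∀ v → X v ≡ Y v) → cut e cr cc X ≡ cut e cr cc Y
    cut-cong e cr cc X≗Y = cong₂ _+_
      (cong₂ _+_ (sum-cong (λ v → cong (λ z → cr v * 𝟙 (not z)) (X≗Y v)))
                 (sum-cong (λ v → cong (λ z → cc v * 𝟙 z) (X≗Y v))))
      (sum-cong (λ u → sum-cong (λ v → cong₂ (λ x y → 𝟙 (e u v ∧ x ∧ not y)) (X≗Y u) (X≗Y v))))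

    private
      weighted-mono : ∀ c {a b x y} → a + b ≤ x + y → c * a + c * b ≤ c * x + c * y
      weighted-mono c {a} {b} {x} {y} le = begin
        c * a + c * b ≡⟨ *-distribˡ-+ c a b ⟨
        c * (a + b)   ≤⟨ *-monoʳ-≤ c le ⟩
        c * (x + y)   ≡⟨ *-distribˡ-+ c x y ⟩
        c * x + c * y ∎ where open ≤-Reasoning

      sum-+-mono : (f g h k : Fin n → ℕ) → (∀ v → f v + g v ≤ h v + k v) → sum f + sum g ≤ sum h + sum k
      sum-+-mono f g h k le = begin
        sum f + sum g             ≡⟨ sum-+ f g ⟨
        sum (λ v → f v + g v)     ≤⟨ sum-mono le ⟩
        sum (λ v → h v + k v)     ≡⟨ sum-+ h k ⟩
        sum h + sum k             ∎ where open ≤-Reasoning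

    edge≤edges : ∀ e u v → 𝟙 (e u v) ≤ edges e
    edge≤edges e u v = ≤-trans (term≤sum (λ v → 𝟙 (e u v)) v) (term≤sum (λ u → sum (λ v → 𝟙 (e u v))) u)

    -- The arc from `a` to `b` leaves `X`, but neither the union, which contains `b`, nor the
    -- intersection, which misses `a`. This makes submodularity strict.
    submodular : ∀ e cr cc (X Y : Fin n → Bool) a b →
      e a b ≡ true → X a ≡ true → Y a ≡ false → X b ≡ false → Y b ≡ true →
      cut e cr cc (λ v → X v ∧ Y v) + cut e cr cc (λ v → X v ∨ Y v) + 1 ≤ cut e cr cc X + cut e cr cc Y
    submodular e cr cc X Y a b eab Xa Ya Xb Yb = begin
      (O∩ + I∩ + L∩) + (O∪ + I∪ + L∪) + 1       ≤⟨ +-monoʳ-≤ ((O∩ + I∩ + L∩) + (O∪ + I∪ + L∪)) 1≤D ⟩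
      (O∩ + I∩ + L∩) + (O∪ + I∪ + L∪) + edges D ≡⟨ rearr O∩ I∩ L∩ O∪ I∪ L∪ (edges D) ⟩
      (O∩ + O∪) + (I∩ + I∪) + (L∩ + L∪ + edges D)
        ≤⟨ +-mono-≤ (+-mono-≤ o i) l ⟩
      (OX + OY) + (IX + IY) + (LX + LY)          ≡⟨ rearr′ OX IX LX OY IY LY ⟩
      (OX + IX + LX) + (OY + IY + LY)            ∎
      where
      open ≤-Reasoning
      ∩ ∪ : Fin n → Bool
      ∩ v = X v ∧ Y v
      ∪ v = X v ∨ Y v
      D : Fin n → Fin n → Bool
      D u v = e u v ∧ (X u ∧ not (Y u)) ∧ (not (X v) ∧ Y v)
      O∩ = outsideCapacity cr ∩
      O∪ = outsideCapacity cr ∪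
      OX = outsideCapacity cr X
      OY = outsideCapacity cr Y
      I∩ = insideCapacity cc ∩
      I∪ = insideCapacity cc ∪
      IX = insideCapacity cc X
      IY = insideCapacity cc Y
      L∩ = leaving e ∩
      L∪ = leaving e ∪
      LX = leaving e X
      LY = leaving e Y
      Dab : D a b ≡ true
      Dab rewrite eab | Xa | Ya | Xb | Yb = refl
      1≤D : 1 ≤ edges D
      1≤D = subst (λ d → 𝟙 d ≤ edges D) Dab (edge≤edges D a b)
      rearr : ∀ a b c d e f g → (a + b + c) + (d + e + f) + g ≡ (a + d) + (b + e) + (c + f + g)
      rearr = solve-∀
      rearr′ : ∀ a b c d e f → (a + d) + (b + e) + (c + f) ≡ (a + b + c) + (d + e + f)
      rearr′ = solve-∀
      o : O∩ + O∪ ≤ OX + OY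
      o = sum-+-mono _ _ _ _ (λ v → weighted-mono (cr v) (point-modular-not (X v) (Y v)))
      i : I∩ + I∪ ≤ IX + IY
      i = sum-+-mono _ _ _ _ (λ v → weighted-mono (cc v) (point-modular (X v) (Y v)))
      ∩e ∪e Xe Ye De : Fin n → Fin n → ℕ
      ∩e u v = 𝟙 (e u v ∧ ∩ u ∧ not (∩ v))
      ∪e u v = 𝟙 (e u v ∧ ∪ u ∧ not (∪ v))
      Xe u v = 𝟙 (e u v ∧ X u ∧ not (X v))
      Ye u v = 𝟙 (e u v ∧ Y u ∧ not (Y v))
      De u v = 𝟙 (D u v)
      l : L∩ + L∪ + edges D ≤ LX + LY
      l = begin
        L∩ + L∪ + edges D
          ≡⟨ cong (_+ edges D) (sym (∑∑-distrib-+ ∩e ∪e)) ⟩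
        sum (λ u → sum (λ v → ∩e u v + ∪e u v)) + edges D
          ≡⟨ ∑∑-distrib-+ (λ u v → ∩e u v + ∪e u v) De ⟨
        sum (λ u → sum (λ v → ∩e u v + ∪e u v + De u v))
          ≤⟨ ∑∑-mono (λ u v → point-submodular (e u v) (X u) (X v) (Y u) (Y v)) ⟩
        sum (λ u → sum (λ v → Xe u v + Ye u v))
          ≡⟨ ∑∑-distrib-+ Xe Ye ⟩
        LX + LY ∎

    point : Fin n → Fin n → Fin n → Fin n → Bool
    point a b u v = δ u a ∧ δ v b

    point-sum : ∀ (f : Fin n → Fin n → Bool) a b → edges (λ u v → point a b u v ∧ f u v) ≡ 𝟙 (f a b)
    point-sum f a b = trans
      (sum-cong (λ u → sum-cong (λ v → 𝟙-∧∧ (δ u a) (δ v b) (f u v))))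
      (∑∑-δ (λ u v → 𝟙 (f u v)) a b)
      where
      𝟙-∧∧ : ∀ p q r → 𝟙 ((p ∧ q) ∧ r) ≡ 𝟙 p * (𝟙 q * 𝟙 r)
      𝟙-∧∧ = by-cases (∀? λ p → ∀? λ q → ∀? λ r → _ Data.Nat.≟ _)

    _─_ : (Fin n → Fin n → Bool) → Fin n × Fin n → Fin n → Fin n → Bool
    (e ─ (a , b)) u v = e u v ∧ not (point a b u v)

    _⊖_ : (Fin n → ℕ) → Fin n → Fin n → ℕ
    (c ⊖ a) v = c v ∸ 𝟙 (δ v a)

    private
      leaving-─ : ∀ e a b Z → leaving e Z ≤ leaving (e ─ (a , b)) Z + 𝟙 (Z a ∧ not (Z b))
      leaving-─ e a b Z = begin
        leaving e Z
          ≤⟨ ∑∑-mono (λ u v → pointwise (e u v) (point a b u v) (Z u ∧ not (Z v))) ⟩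
        sum (λ u → sum (λ v → rest u v + 𝟙 (point a b u v ∧ Z u ∧ not (Z v))))
          ≡⟨ ∑∑-distrib-+ rest _ ⟩
        leaving (e ─ (a , b)) Z + edges (λ u v → point a b u v ∧ Z u ∧ not (Z v))
          ≡⟨ cong (leaving (e ─ (a , b)) Z +_) (point-sum (λ u v → Z u ∧ not (Z v)) a b) ⟩
        leaving (e ─ (a , b)) Z + 𝟙 (Z a ∧ not (Z b)) ∎
        where
        open ≤-Reasoning
        rest : Fin n → Fin n → ℕ
        rest u v = 𝟙 ((e ─ (a , b)) u v ∧ Z u ∧ not (Z v))
        pointwise : ∀ e p z → 𝟙 (e ∧ z) ≤ 𝟙 ((e ∧ not p) ∧ z) + 𝟙 (p ∧ z)
        pointwise = by-cases (∀? λ e → ∀? λ p → ∀? λ z → _ ≤? _)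

      edges-─ : ∀ e a b → e a b ≡ true → edges (e ─ (a , b)) < edges e
      edges-─ e a b eab = begin
        suc (edges (e ─ (a , b)))              ≡⟨ +-comm 1 _ ⟩
        edges (e ─ (a , b)) + 1                ≡⟨ cong (λ t → edges (e ─ (a , b)) + 𝟙 t) eab ⟨
        edges (e ─ (a , b)) + 𝟙 (e a b)        ≡⟨ cong (edges (e ─ (a , b)) +_) (point-sum e a b) ⟨
        edges (e ─ (a , b)) + edges (λ u v → point a b u v ∧ e u v)
          ≡⟨ ∑∑-distrib-+ _ _ ⟨
        sum (λ u → sum (λ v → 𝟙 ((e ─ (a , b)) u v) + 𝟙 (point a b u v ∧ e u v)))
          ≤⟨ ∑∑-mono (λ u v → pointwise (e u v) (point a b u v)) ⟩
        edges e ∎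
        where
        open ≤-Reasoning
        pointwise : ∀ e p → 𝟙 (e ∧ not p) + 𝟙 (p ∧ e) ≤ 𝟙 e
        pointwise = by-cases (∀? λ e → ∀? λ p → _ ≤? _)

      weighted-⊖ : ∀ c a (g : Fin n → Bool) →
        sum (λ v → c v * 𝟙 (g v)) ≤ sum (λ v → (c ⊖ a) v * 𝟙 (g v)) + 𝟙 (g a)
      weighted-⊖ c a g = begin
        sum (λ v → c v * 𝟙 (g v))
          ≤⟨ sum-mono (λ v → pointwise (c v) (𝟙 (δ v a)) (𝟙 (g v))) ⟩
        sum (λ v → (c ⊖ a) v * 𝟙 (g v) + 𝟙 (δ v a) * 𝟙 (g v))
          ≡⟨ sum-+ (λ v → (c ⊖ a) v * 𝟙 (g v)) _ ⟩
        sum (λ v → (c ⊖ a) v * 𝟙 (g v)) + sum (λ v → 𝟙 (δ v a) * 𝟙 (g v))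
          ≡⟨ cong (sum (λ v → (c ⊖ a) v * 𝟙 (g v)) +_) (sum-δ (λ v → 𝟙 (g v)) a) ⟩
        sum (λ v → (c ⊖ a) v * 𝟙 (g v)) + 𝟙 (g a) ∎
        where
        open ≤-Reasoning
        pointwise : ∀ c d x → c * x ≤ (c ∸ d) * x + d * x
        pointwise c d x = begin
          c * x               ≤⟨ *-monoˡ-≤ x (m≤n+m∸n c d) ⟩
          (d + (c ∸ d)) * x   ≡⟨ *-distribʳ-+ x d (c ∸ d) ⟩
          d * x + (c ∸ d) * x ≡⟨ +-comm (d * x) _ ⟩
          (c ∸ d) * x + d * x ∎

      cut-─ : ∀ e cr cc a b Z → cut e cr cc Z ≤ cut (e ─ (a , b)) cr cc Z + 𝟙 (Z a ∧ not (Z b))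
      cut-─ e cr cc a b Z = ≤-trans (+-monoʳ-≤ (outsideCapacity cr Z + insideCapacity cc Z) (leaving-─ e a b Z))
                                    (≤-reflexive (sym (+-assoc (outsideCapacity cr Z + insideCapacity cc Z) _ _)))

      -- The bracket is 2 when `a` lies outside `Z` and `b` inside, and 1 in the three other cases.
      -- So putting an edge into the flow costs a cut more than one unit only if the cut separates
      -- its ends the wrong way round.
      cut-⊖ : ∀ e cr cc a b Z → cut e cr cc Z ≤
        cut (e ─ (a , b)) (cr ⊖ a) (cc ⊖ b) Z + (𝟙 (not (Z a)) + 𝟙 (Z b) + 𝟙 (Z a ∧ not (Z b)))
      cut-⊖ e cr cc a b Z = ≤-trans
        (+-mono-≤ (+-mono-≤ (weighted-⊖ cr a (λ v → not (Z v))) (weighted-⊖ cc b Z)) (leaving-─ e a b Z))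
        (≤-reflexive (rearr (outsideCapacity (cr ⊖ a) Z) _ (insideCapacity (cc ⊖ b) Z) _ (leaving (e ─ (a , b)) Z) _))
        where
        rearr : ∀ o x i y l z → o + x + (i + y) + (l + z) ≡ o + i + l + (x + y + z)
        rearr = solve-∀

      -- Moving `a` to the sink side is free: its source arc has capacity 0 and no edge enters it.
      -- All edges out of `a` then stop leaving, among them the one that is deleted on the right.
      cut-drop : ∀ e cr cc a b Z → (∀ u v → e u v ≡ true → δ v a ≡ false) → cr a ≡ 0 →
        cut e cr cc (λ v → Z v ∧ not (δ v a)) ≤ cut (e ─ (a , b)) cr cc Z
      cut-drop e cr cc a b Z source cra = +-mono-≤ (+-mono-≤ (sum-mono out) (sum-mono inn)) (∑∑-mono leave)
        where
        out : ∀ v → cr v * 𝟙 (not (Z v ∧ not (δ v a))) ≤ cr v * 𝟙 (not (Z v))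
        out v with δ v a in eq
        ... | true  rewrite δ⇒≡ v a eq | cra = z≤n
        ... | false = *-monoʳ-≤ (cr v) (p (Z v))
          where
          p : ∀ z → 𝟙 (not (z ∧ true)) ≤ 𝟙 (not z)
          p = by-cases (∀? λ z → _ ≤? _)
        inn : ∀ v → cc v * 𝟙 (Z v ∧ not (δ v a)) ≤ cc v * 𝟙 (Z v)
        inn v = *-monoʳ-≤ (cc v) (p (Z v) (δ v a))
          where
          p : ∀ z d → 𝟙 (z ∧ not d) ≤ 𝟙 z
          p = by-cases (∀? λ z → ∀? λ d → _ ≤? _)
        leave : ∀ u v → 𝟙 (e u v ∧ (Z u ∧ not (δ u a)) ∧ not (Z v ∧ not (δ v a)))
                      ≤ 𝟙 ((e ─ (a , b)) u v ∧ Z u ∧ not (Z v))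
        leave u v with e u v in eq
        ... | false = z≤n
        ... | true rewrite source u v eq = p (Z u) (Z v) (δ u a) (δ v b)
          where
          p : ∀ x y d d′ → 𝟙 ((x ∧ not d) ∧ not (y ∧ true)) ≤ 𝟙 (not (d ∧ d′) ∧ x ∧ not y)
          p = by-cases (∀? λ x → ∀? λ y → ∀? λ d → ∀? λ d′ → _ ≤? _)

      cut-add : ∀ e cr cc a b Z → (∀ u v → e u v ≡ true → δ u b ≡ false) → cc b ≡ 0 →
        cut e cr cc (λ v → Z v ∨ δ v b) ≤ cut (e ─ (a , b)) cr cc Z
      cut-add e cr cc a b Z sink ccb = +-mono-≤ (+-mono-≤ (sum-mono out) (sum-mono inn)) (∑∑-mono leave)
        where
        out : ∀ v → cr v * 𝟙 (not (Z v ∨ δ v b)) ≤ cr v * 𝟙 (not (Z v))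
        out v = *-monoʳ-≤ (cr v) (p (Z v) (δ v b))
          where
          p : ∀ z d → 𝟙 (not (z ∨ d)) ≤ 𝟙 (not z)
          p = by-cases (∀? λ z → ∀? λ d → _ ≤? _)
        inn : ∀ v → cc v * 𝟙 (Z v ∨ δ v b) ≤ cc v * 𝟙 (Z v)
        inn v with δ v b in eq
        ... | true  rewrite δ⇒≡ v b eq | ccb = z≤n
        ... | false = *-monoʳ-≤ (cc v) (p (Z v))
          where
          p : ∀ z → 𝟙 (z ∨ false) ≤ 𝟙 z
          p = by-cases (∀? λ z → _ ≤? _)
        leave : ∀ u v → 𝟙 (e u v ∧ (Z u ∨ δ u b) ∧ not (Z v ∨ δ v b))
                      ≤ 𝟙 ((e ─ (a , b)) u v ∧ Z u ∧ not (Z v))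
        leave u v with e u v in eq
        ... | false = z≤n
        ... | true rewrite sink u v eq = p (Z u) (Z v) (δ u a) (δ v b)
          where
          p : ∀ x y d d′ → 𝟙 ((x ∨ false) ∧ not (y ∨ d′)) ≤ 𝟙 (not (d ∧ d′) ∧ x ∧ not y)
          p = by-cases (∀? λ x → ∀? λ y → ∀? λ d → ∀? λ d′ → _ ≤? _)

    Flow : (Fin n → Fin n → Bool) → (Fin n → ℕ) → (Fin n → ℕ) → ℕ → Set
    Flow e cr cc k = ∃[ y ] (∀ u v → y u v ≡ true → e u v ≡ true)
      × (∀ u → sum (λ v → 𝟙 (y u v)) ≤ cr u)
      × (∀ v → sum (λ u → 𝟙 (y u v)) ≤ cc v)
      × k ≤ edges y

    private
      -- The two lower bounds on capacities make the truncated subtraction of `_⊖_` exact, so that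
      -- the edge from `a` to `b` can be put back without exceeding them.
      force : ∀ e cr cc k a b → e a b ≡ true → 1 ≤ cr a → 1 ≤ cc b →
        Flow (e ─ (a , b)) (cr ⊖ a) (cc ⊖ b) (k ∸ 1) → Flow e cr cc k
      force e cr cc k a b eab 1≤cr 1≤cc (y , y⊆e , row , col , size) =
        y⁺ , y⁺⊆e , row⁺ , col⁺ , size⁺
        where
        open ≤-Reasoning
        y⁺ : Fin n → Fin n → Bool
        y⁺ u v = y u v ∨ point a b u v
        y⁺⊆e : ∀ u v → y⁺ u v ≡ true → e u v ≡ true
        y⁺⊆e u v eq with y u v in yuv | point a b u v in puv
        ... | true  | _    = ∧-true (y⊆e u v yuv)
          where
          ∧-true : ∀ {p q} → p ∧ q ≡ true → p ≡ true
          ∧-true {true} _ = refl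
        ... | false | true with δ u a in ua | δ v b in vb
        ...   | true | true rewrite δ⇒≡ u a ua | δ⇒≡ v b vb = eab
        𝟙-∨ : ∀ p q r → 𝟙 (p ∨ (q ∧ r)) ≤ 𝟙 p + 𝟙 q * 𝟙 r
        𝟙-∨ = by-cases (∀? λ p → ∀? λ q → ∀? λ r → _ ≤? _)
        restore : ∀ (c : Fin n → ℕ) a → 1 ≤ c a → ∀ v → (c ⊖ a) v + 𝟙 (δ v a) ≤ c v
        restore c a 1≤c v with δ v a in eq
        ... | false = ≤-reflexive (+-identityʳ (c v))
        ... | true rewrite δ⇒≡ v a eq = ≤-reflexive (m∸n+n≡m 1≤c)
        row⁺ : ∀ u → sum (λ v → 𝟙 (y⁺ u v)) ≤ cr u
        row⁺ u = begin
          sum (λ v → 𝟙 (y⁺ u v))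
            ≤⟨ sum-mono (λ v → 𝟙-∨′ (y u v) (δ u a) (δ v b)) ⟩
          sum (λ v → 𝟙 (y u v) + 𝟙 (δ v b) * 𝟙 (δ u a))
            ≡⟨ sum-+ (λ v → 𝟙 (y u v)) _ ⟩
          sum (λ v → 𝟙 (y u v)) + sum (λ v → 𝟙 (δ v b) * 𝟙 (δ u a))
            ≡⟨ cong (sum (λ v → 𝟙 (y u v)) +_) (sum-δ (λ _ → 𝟙 (δ u a)) b) ⟩
          sum (λ v → 𝟙 (y u v)) + 𝟙 (δ u a) ≤⟨ +-monoˡ-≤ (𝟙 (δ u a)) (row u) ⟩
          (cr ⊖ a) u + 𝟙 (δ u a)            ≤⟨ restore cr a 1≤cr u ⟩
          cr u ∎
          where
          𝟙-∨′ : ∀ p q r → 𝟙 (p ∨ (q ∧ r)) ≤ 𝟙 p + 𝟙 r * 𝟙 q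
          𝟙-∨′ = by-cases (∀? λ p → ∀? λ q → ∀? λ r → _ ≤? _)
        col⁺ : ∀ v → sum (λ u → 𝟙 (y⁺ u v)) ≤ cc v
        col⁺ v = begin
          sum (λ u → 𝟙 (y⁺ u v))
            ≤⟨ sum-mono (λ u → 𝟙-∨ (y u v) (δ u a) (δ v b)) ⟩
          sum (λ u → 𝟙 (y u v) + 𝟙 (δ u a) * 𝟙 (δ v b))
            ≡⟨ sum-+ (λ u → 𝟙 (y u v)) _ ⟩
          sum (λ u → 𝟙 (y u v)) + sum (λ u → 𝟙 (δ u a) * 𝟙 (δ v b))
            ≡⟨ cong (sum (λ u → 𝟙 (y u v)) +_) (sum-δ (λ _ → 𝟙 (δ v b)) a) ⟩
          sum (λ u → 𝟙 (y u v)) + 𝟙 (δ v b) ≤⟨ +-monoˡ-≤ (𝟙 (δ v b)) (col v) ⟩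
          (cc ⊖ b) v + 𝟙 (δ v b)            ≤⟨ restore cc b 1≤cc v ⟩
          cc v ∎
        size⁺ : k ≤ edges y⁺
        size⁺ = begin
          k                 ≤⟨ m≤n+m∸n k 1 ⟩
          1 + (k ∸ 1)       ≤⟨ +-monoʳ-≤ 1 size ⟩
          1 + edges y       ≡⟨ cong (_+ edges y) (point-sum (λ _ _ → true) a b) ⟨
          edges (λ u v → point a b u v ∧ true) + edges y
                            ≡⟨ ∑∑-distrib-+ (λ u v → 𝟙 (point a b u v ∧ true)) _ ⟨
          sum (λ u → sum (λ v → 𝟙 (point a b u v ∧ true) + 𝟙 (y u v)))
                            ≤⟨ ∑∑-mono (λ u v → disjoint (e u v) (point a b u v) (y u v) (y⊆e u v)) ⟩
          edges y⁺          ∎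
          where
          disjoint : ∀ e p y → (y ≡ true → e ∧ not p ≡ true) → 𝟙 (p ∧ true) + 𝟙 y ≤ 𝟙 (y ∨ p)
          disjoint e     false false h = z≤n
          disjoint e     false true  h = s≤s z≤n
          disjoint e     true  false h = s≤s z≤n
          disjoint true  true  true  h with () ← h refl
          disjoint false true  true  h with () ← h refl

    -- An edge is deleted if every cut allows it; otherwise it is forced into y. If neither works, two
    -- minimum cuts separate its ends in opposite ways and uncrossing them gives too small a cut.
    max-flow : ∀ m e cr cc k (side : Fin n → Bool) → edges e ≤ m →
      (∀ u v → e u v ≡ true → side u ≡ true × side v ≡ false) →
      (∀ v → side v ≡ false → cr v ≡ 0) → (∀ v → side v ≡ true → cc v ≡ 0) →
      (∀ Z → k ≤ cut e cr cc Z) → Flow e cr cc k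
    max-flow m e cr cc k side e≤m e-side cr-side cc-side k≤cut
      with any? (λ u → any? (λ v → e u v Boolₚ.≟ true))
    ... | no no-edge = (λ _ _ → false) , (λ _ _ ()) , (λ u → ≤-trans (≤-reflexive (sum-0 (λ _ → refl))) z≤n)
                     , (λ v → ≤-trans (≤-reflexive (sum-0 (λ _ → refl))) z≤n) , k≤0
      where
      no-e : ∀ u v → e u v ≡ false
      no-e u v = Boolₚ.¬-not (λ eq → no-edge (u , v , eq))
      out : ∀ v → cr v * 𝟙 (not (side v)) ≡ 0
      out v with side v in eq
      ... | true  = *-zeroʳ (cr v)
      ... | false rewrite cr-side v eq = refl
      inn : ∀ v → cc v * 𝟙 (side v) ≡ 0
      inn v with side v in eq
      ... | true  rewrite cc-side v eq = refl
      ... | false = *-zeroʳ (cc v)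
      leave : ∀ u v → 𝟙 (e u v ∧ side u ∧ not (side v)) ≡ 0
      leave u v rewrite no-e u v = refl
      -- Without edges, the cut `side` has capacity 0, which forces `k` to be 0.
      k≤0 : k ≤ edges (λ _ _ → false)
      k≤0 = ≤-trans (≤-trans (k≤cut side)
        (≤-reflexive (cong₂ _+_ (cong₂ _+_ (sum-0 out) (sum-0 inn)) (sum-0 (λ u → sum-0 (leave u)))))) z≤n
    max-flow zero e cr cc k side e≤m _ _ _ _ | yes (a , b , eab)
      with () ← ≤-trans (subst (λ t → 𝟙 t ≤ edges e) eab (edge≤edges e a b)) e≤m
    max-flow (suc m) e cr cc k side e≤m e-side cr-side cc-side k≤cut | yes (a , b , eab) = result
      where
      e′ = e ─ (a , b)
      e′⊆e : ∀ u v → e′ u v ≡ true → e u v ≡ true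
      e′⊆e u v eq with e u v
      ... | true = refl
      e′≤m : edges e′ ≤ m
      e′≤m = ≤-pred (≤-trans (edges-─ e a b eab) e≤m)
      minimum = argmin n (cut e′ cr cc) (cut-cong e′ cr cc)
      X = proj₁ minimum
      cr⁻ = cr ⊖ a
      cc⁻ = cc ⊖ b
      minimum⁻ = argmin n (cut e′ cr⁻ cc⁻) (cut-cong e′ cr⁻ cc⁻)
      Y = proj₁ minimum⁻
      true≢false : ∀ {x} → x ≡ true → x ≡ false → ⊥
      true≢false refl ()
      δ-side : ∀ {x y s} → side x ≡ s → side y ≡ not s → δ x y ≡ false
      δ-side {x} {y} {s} sx sy = Boolₚ.¬-not (λ eq → absurd s (trans (sym sx) (trans (cong side (δ⇒≡ x y eq)) sy)))
        where
        absurd : ∀ s → s ≡ not s → ⊥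
        absurd true  ()
        absurd false ()

      module _ (X<k : cut e′ cr cc X < k) where
        Xab : X a ∧ not (X b) ≡ true
        Xab with X a ∧ not (X b) | cut-─ e cr cc a b X
        ... | true  | _  = refl
        ... | false | le = ⊥-elim (<-irrefl refl (<-≤-trans X<k (≤-trans (k≤cut X)
                             (≤-trans le (≤-reflexive (+-identityʳ _))))))
        X≤k : cut e cr cc X ≤ k
        X≤k = ≤-trans (≤-trans (cut-─ e cr cc a b X) (≤-reflexive (trans (cong (λ t → cut e′ cr cc X + 𝟙 t) Xab) (+-comm _ 1)))) X<k
        -- If `cr a` were 0, dropping `a` from `X` would give a cut of `e` below `k`.
        1≤cr : 1 ≤ cr a
        1≤cr = n≢0⇒n>0 λ cra → <-irrefl refl (<-≤-trans X<k (≤-trans (k≤cut _)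
          (cut-drop e cr cc a b X (λ u v euv → δ-side (proj₂ (e-side u v euv)) (proj₁ (e-side a b eab))) cra)))
        1≤cc : 1 ≤ cc b
        1≤cc = n≢0⇒n>0 λ ccb → <-irrefl refl (<-≤-trans X<k (≤-trans (k≤cut _)
          (cut-add e cr cc a b X (λ u v euv → δ-side (proj₁ (e-side u v euv)) (proj₂ (e-side a b eab))) ccb)))

        small : cut e′ cr⁻ cc⁻ Y < k ∸ 1 → cut e cr cc Y ≤ cut e′ cr⁻ cc⁻ Y + 1 → ⊥
        small Y<k le = <-irrefl refl (begin-strict
          cut e cr cc Y             ≤⟨ le ⟩
          cut e′ cr⁻ cc⁻ Y + 1      ≡⟨ +-comm _ 1 ⟩
          suc (cut e′ cr⁻ cc⁻ Y)    ≤⟨ Y<k ⟩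
          k ∸ 1                     <⟨ pred< k (≤-trans (s≤s z≤n) Y<k) ⟩
          k                         ≤⟨ k≤cut Y ⟩
          cut e cr cc Y ∎)
          where
          open ≤-Reasoning
          pred< : ∀ k → 1 ≤ k ∸ 1 → k ∸ 1 < k
          pred< (suc k) _ = ≤-refl

        uncross : cut e′ cr⁻ cc⁻ Y < k ∸ 1 → ⊥
        uncross Y<k with X a in Xa | X b in Xb | Y a in Ya | Y b in Yb | cut-⊖ e cr cc a b Y | Xab
        -- The only case in which `cut-⊖` costs 2: now `X` and `Y` both have capacity at most `k` in
        -- `e` and cross at the edge, so strict submodularity leaves less than `k + k` for two cuts.
        ... | true | false | false | true | le | _ = <-irrefl refl (begin-strict
              k + k <⟨ m<m+n (k + k) (s≤s z≤n) ⟩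
              k + k + 1 ≤⟨ +-monoˡ-≤ 1 (+-mono-≤ (k≤cut _) (k≤cut _)) ⟩
              cut e cr cc (λ v → X v ∧ Y v) + cut e cr cc (λ v → X v ∨ Y v) + 1
                ≤⟨ submodular e cr cc X Y a b eab Xa Ya Xb Yb ⟩
              cut e cr cc X + cut e cr cc Y ≤⟨ +-mono-≤ X≤k (≤-trans le Y+2≤k) ⟩
              k + k ∎)
          where
          open ≤-Reasoning
          Y+2≤k : cut e′ cr⁻ cc⁻ Y + 2 ≤ k
          Y+2≤k = begin
            cut e′ cr⁻ cc⁻ Y + 2           ≡⟨ +-suc _ 1 ⟩
            suc (cut e′ cr⁻ cc⁻ Y) + 1     ≤⟨ +-monoˡ-≤ 1 Y<k ⟩
            k ∸ 1 + 1                      ≡⟨ m∸n+n≡m 1≤k ⟩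
            k ∎
            where
            1≤k : 1 ≤ k
            1≤k = ≤-trans (≤-trans (s≤s z≤n) Y<k) (m∸n≤m k 1)
        ... | true | false | true  | true  | le | _ = small Y<k le
        ... | true | false | true  | false | le | _ = small Y<k le
        ... | true | false | false | false | le | _ = small Y<k le

      shrink : ∀ (c : Fin n → ℕ) x v → c v ≡ 0 → (c ⊖ x) v ≡ 0
      shrink c x v cv rewrite cv = 0∸n≡0 (𝟙 (δ v x))

      result : Flow e cr cc k
      result with k ≤? cut e′ cr cc X
      ... | yes k≤X = lift (max-flow m e′ cr cc k side e′≤m (λ u v eq → e-side u v (e′⊆e u v eq)) cr-side cc-side
                             (λ Z → ≤-trans k≤X (proj₂ minimum Z)))
        where
        lift : Flow e′ cr cc k → Flow e cr cc k
        lift (y , y⊆e′ , rest) = y , (λ u v eq → e′⊆e u v (y⊆e′ u v eq)) , rest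
      ... | no k≰X with k ∸ 1 ≤? cut e′ cr⁻ cc⁻ Y
      ...   | no k-1≰Y = ⊥-elim (uncross (≰⇒> k≰X) (≰⇒> k-1≰Y))
      ...   | yes k-1≤Y = force e cr cc k a b eab (1≤cr (≰⇒> k≰X)) (1≤cc (≰⇒> k≰X))
                (max-flow m e′ cr⁻ cc⁻ (k ∸ 1) side e′≤m (λ u v eq → e-side u v (e′⊆e u v eq))
                  (λ v sv → shrink cr a v (cr-side v sv)) (λ v sv → shrink cc b v (cc-side v sv))
                  (λ Z → ≤-trans k-1≤Y (proj₂ minimum⁻ Z)))

  -- Finite differences over 𝔽₂ and Olson's theorem for powers of 2

  -- Bool with xor and ∧ serves as the field 𝔽₂.
  Δ₁ : (ℕ → Bool) → ℕ → Bool
  Δ₁ f m = f m xor f (suc m)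

  iterate-Δ₁ : ℕ → (ℕ → Bool) → ℕ → Bool
  iterate-Δ₁ zero    f = f
  iterate-Δ₁ (suc a) f = iterate-Δ₁ a (Δ₁ f)

  iterate-cong : ∀ a {f g} → (∀ m → f m ≡ g m) → ∀ m → iterate-Δ₁ a f m ≡ iterate-Δ₁ a g m
  iterate-cong zero    f≗g = f≗g
  iterate-cong (suc a) f≗g = iterate-cong a (λ m → cong₂ _xor_ (f≗g m) (f≗g (suc m)))

  iterate-+ : ∀ a b f m → iterate-Δ₁ (a + b) f m ≡ iterate-Δ₁ b (iterate-Δ₁ a f) m
  iterate-+ zero    b f m = refl
  iterate-+ (suc a) b f m = iterate-+ a b (Δ₁ f) m

  -- The Frobenius identity (T − 1)^q = T^q − 1 for the shift T, in characteristic 2.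
  iterate-2^ : ∀ k f m → iterate-Δ₁ (2 ^ k) f m ≡ f m xor f (2 ^ k + m)
  iterate-2^ zero    f m = refl
  iterate-2^ (suc k) f m = begin
    iterate-Δ₁ (2 ^ k + (2 ^ k + 0)) f m          ≡⟨ cong (λ t → iterate-Δ₁ (2 ^ k + t) f m) (+-identityʳ _) ⟩
    iterate-Δ₁ (2 ^ k + 2 ^ k) f m                ≡⟨ iterate-+ (2 ^ k) (2 ^ k) f m ⟩
    iterate-Δ₁ (2 ^ k) (iterate-Δ₁ (2 ^ k) f) m   ≡⟨ iterate-cong (2 ^ k) (iterate-2^ k f) m ⟩
    iterate-Δ₁ (2 ^ k) (λ m → f m xor f (2 ^ k + m)) m
      ≡⟨ iterate-2^ k _ m ⟩
    (f m xor f (2 ^ k + m)) xor (f (2 ^ k + m) xor f (2 ^ k + (2 ^ k + m)))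
      ≡⟨ telescope (f m) (f (2 ^ k + m)) (f (2 ^ k + (2 ^ k + m))) ⟩
    f m xor f (2 ^ k + (2 ^ k + m))               ≡⟨ cong (λ t → f m xor f t) (rearr (2 ^ k) m) ⟩
    f m xor f (2 ^ k + (2 ^ k + 0) + m)           ∎
    where
    open ≡-Reasoning
    telescope : ∀ x y z → (x xor y) xor (y xor z) ≡ x xor z
    telescope = by-cases (∀? λ x → ∀? λ y → ∀? λ z → _ Boolₚ.≟ _)
    rearr : ∀ q m → q + (q + m) ≡ q + (q + 0) + m
    rearr = solve-∀

  module _ {n : ℕ} where

    Function₂ : Set
    Function₂ = (Fin n → ℕ) → Bool

    _⊕_ : (Fin n → ℕ) → (Fin n → Bool) → Fin n → ℕ
    (m ⊕ t) v = 𝟙 (t v) + m v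

    Δ : (Fin n → Bool) → Function₂ → Function₂
    Δ t F m = F m xor F (m ⊕ t)

    -- Degree is measured by differences instead of monomials: all `a`-fold differences along 0-1
    -- vectors vanish. In particular `Deg< 0` means the zero function, and a nonzero constant has
    -- `Deg< 1`.
    Deg< : ℕ → Function₂ → Set
    Deg< zero    F = ∀ m → F m ≡ false
    Deg< (suc a) F = ∀ t → Deg< a (Δ t F)

    Deg<-cong : ∀ a {F G} → (∀ m → F m ≡ G m) → Deg< a F → Deg< a G
    Deg<-cong zero    F≗G d m = trans (sym (F≗G m)) (d m)
    Deg<-cong (suc a) F≗G d t = Deg<-cong a (λ m → cong₂ _xor_ (F≗G m) (F≗G (m ⊕ t))) (d t)

    Deg<-0 : ∀ a {F} → (∀ m → F m ≡ false) → Deg< a F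
    Deg<-0 zero    F≗0 = F≗0
    Deg<-0 (suc a) F≗0 t = Deg<-0 a (λ m → cong₂ _xor_ (F≗0 m) (F≗0 (m ⊕ t)))

    Deg<-suc : ∀ a {F} → Deg< a F → Deg< (suc a) F
    Deg<-suc zero    d t = Deg<-0 0 (λ m → cong₂ _xor_ (d m) (d (m ⊕ t)))
    Deg<-suc (suc a) d t = Deg<-suc a (d t)

    Deg<-mono : ∀ {a b} {F} → a ≤ b → Deg< a F → Deg< b F
    Deg<-mono a≤b = go (≤⇒≤′ a≤b)
      where
      go : ∀ {a b F} → a ≤′ b → Deg< a F → Deg< b F
      go ≤′-refl d = d
      go (≤′-step {n = b} le) d = Deg<-suc b (go le d)

    Deg<-xor : ∀ a {F G} → Deg< a F → Deg< a G → Deg< a (λ m → F m xor G m)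
    Deg<-xor zero    d e m rewrite d m | e m = refl
    Deg<-xor (suc a) {F} {G} d e t =
      Deg<-cong a (λ m → interchange (F m) (F (m ⊕ t)) (G m) (G (m ⊕ t))) (Deg<-xor a (d t) (e t))
      where
      interchange : ∀ x x′ y y′ → (x xor x′) xor (y xor y′) ≡ (x xor y) xor (x′ xor y′)
      interchange = by-cases (∀? λ x → ∀? λ x′ → ∀? λ y → ∀? λ y′ → _ Boolₚ.≟ _)

    -- Degrees add, in the shifted form of strict bounds. The induction uses the Leibniz rule Δ(FG)
    -- = ΔF·G + F·ΔG + ΔF·ΔG, whose third term, typical of differences, satisfies a still stronger
    -- bound.
    Deg<-∧ : ∀ c a b {F G} → a + b ≤ suc c → Deg< a F → Deg< b G → Deg< c (λ m → F m ∧ G m)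
    Deg<-∧ c zero b le d e = Deg<-0 c (λ m → cong (_∧ _) (d m))
    Deg<-∧ c (suc a) zero {F} le d e = Deg<-0 c (λ m → trans (cong (F m ∧_) (e m)) (Boolₚ.∧-zeroʳ (F m)))
    Deg<-∧ zero (suc a) (suc b) le d e with () ← subst (_≤ 0) (+-suc a b) (≤-pred le)
    Deg<-∧ (suc c) (suc a) (suc b) {F} {G} le d e t =
      Deg<-cong c (λ m → leibniz (F m) (F (m ⊕ t)) (G m) (G (m ⊕ t)))
        (Deg<-xor c {λ m → Δ t F m ∧ G m} {λ m → (F m ∧ Δ t G m) xor (Δ t F m ∧ Δ t G m)} (Deg<-∧ c a (suc b) {Δ t F} {G} (≤-pred le) (d t) e)
          (Deg<-xor c {λ m → F m ∧ Δ t G m} {λ m → Δ t F m ∧ Δ t G m} (Deg<-∧ c (suc a) b {F} {Δ t G} le′ d (e t))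
                      (Deg<-∧ c a b {Δ t F} {Δ t G} (≤-trans (n≤1+n _) le′) (d t) (e t))))
      where
      le′ : suc (a + b) ≤ suc c
      le′ = subst (_≤ suc c) (+-suc a b) (≤-pred le)
      leibniz : ∀ x x′ y y′ →
        ((x xor x′) ∧ y) xor ((x ∧ (y xor y′)) xor ((x xor x′) ∧ (y xor y′))) ≡ (x ∧ y) xor (x′ ∧ y′)
      leibniz = by-cases (∀? λ x → ∀? λ x′ → ∀? λ y → ∀? λ y′ → _ Boolₚ.≟ _)

    -- A shift by a 0-1 vector moves coordinate `v` by one or not at all, so each difference is
    -- either `Δ₁` in that coordinate or 0.
    Deg<-coordinate : ∀ a f v → (∀ m → iterate-Δ₁ a f m ≡ false) → Deg< a (λ m → f (m v))
    Deg<-coordinate zero    f v d m = d (m v)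
    Deg<-coordinate (suc a) f v d t with t v
    ... | true  = Deg<-coordinate a (Δ₁ f) v d
    ... | false = Deg<-0 a (λ m → Boolₚ.xor-same (f (m v)))

    ⋀ : ∀ {N} → (Fin N → Function₂) → Function₂
    ⋀ {zero}  G m = true
    ⋀ {suc N} G m = G zero m ∧ ⋀ (G ∘ suc) m

    Deg<-⋀ : ∀ {N} (G : Fin N → Function₂) d → (∀ j → Deg< (suc (d j)) (G j)) → Deg< (suc (sum d)) (⋀ G)
    Deg<-⋀ {zero}  G d D = Deg<-mono {a = 1} {F = λ _ → true} (s≤s z≤n) (λ t m → refl)
    Deg<-⋀ {suc N} G d D = Deg<-∧ _ (suc (d zero)) (suc (sum (d ∘ suc))) {G zero} {⋀ (G ∘ suc)} le (D zero) (Deg<-⋀ (G ∘ suc) (d ∘ suc) (D ∘ suc))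
      where
      le : suc (d zero) + suc (sum (d ∘ suc)) ≤ suc (suc (sum d))
      le = ≤-reflexive (trans (+-suc (suc (d zero)) (sum (d ∘ suc))) (cong (λ s → suc (suc s)) (sym (sum-suc d))))

    ⋀-elim : ∀ {N} (G : Fin N → Function₂) m → ⋀ G m ≡ true → ∀ j → G j m ≡ true
    ⋀-elim G m eq zero with G zero m
    ... | true = refl
    ⋀-elim G m eq (suc j) with G zero m
    ... | true = ⋀-elim (G ∘ suc) m eq j

    ⋀-intro : ∀ {N} (G : Fin N → Function₂) m → (∀ j → G j m ≡ true) → ⋀ G m ≡ true
    ⋀-intro {zero}  G m h = refl
    ⋀-intro {suc N} G m h rewrite h zero = ⋀-intro (G ∘ suc) m (h ∘ suc)

    accumulate : ∀ {M} → (Fin M → Bool) → (Fin M → Fin n → Bool) → (Fin n → ℕ) → Fin n → ℕ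
    accumulate {zero}  x t m = m
    accumulate {suc M} x t m with x zero
    ... | true  = accumulate (x ∘ suc) (t ∘ suc) m ⊕ t zero
    ... | false = accumulate (x ∘ suc) (t ∘ suc) m

    accumulate-sum : ∀ {M} (x : Fin M → Bool) t m v → accumulate x t m v ≡ m v + sum (λ i → 𝟙 (x i ∧ t i v))
    accumulate-sum {zero} x t m v = sym (trans (cong (m v +_) (sum-zero _)) (+-identityʳ (m v)))
    accumulate-sum {suc M} x t m v = trans step (cong (m v +_) (sym (sum-suc (λ i → 𝟙 (x i ∧ t i v)))))
      where
      step : accumulate x t m v ≡ m v + (𝟙 (x zero ∧ t zero v) + sum (λ i → 𝟙 (x (suc i) ∧ t (suc i) v)))
      step with x zero
      ... | true  = trans (cong (𝟙 (t zero v) +_) (accumulate-sum (x ∘ suc) (t ∘ suc) m v)) (rearr (𝟙 (t zero v)) (m v) _)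
        where
        rearr : ∀ a b c → a + (b + c) ≡ b + (a + c)
        rearr = solve-∀
      ... | false = accumulate-sum (x ∘ suc) (t ∘ suc) m v

    -- If F vanishes at m ⊕ t zero, then Δ (t zero) F does not vanish at m and has smaller degree.
    nonempty-root : ∀ {M} (y : Fin M → Bool) (t : Fin M → Fin n → Bool) F m →
      Deg< (sum (𝟙 ∘ y)) F → F m ≡ true →
      ∃[ x ] (∀ i → x i ≡ true → y i ≡ true) × (∃[ i ] x i ≡ true) × F (accumulate x t m) ≡ true
    nonempty-root {zero}  y t F m d Fm with () ← trans (sym (subst (λ a → Deg< a F) (sum-zero (𝟙 ∘ y)) d m)) Fm
    nonempty-root {suc M} y t F m d Fm with y zero in yz | subst (λ a → Deg< a F) (sum-suc (𝟙 ∘ y)) d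
    ... | false | d′ with nonempty-root (y ∘ suc) (t ∘ suc) F m d′ Fm
    ...   | x , x⊆y , (i , xi) , Fx = x⁺ , (λ { (suc i) → x⊆y i }) , (suc i , xi) , Fx
      where
      x⁺ : Fin (suc M) → Bool
      x⁺ zero    = false
      x⁺ (suc i) = x i
    nonempty-root {suc M} y t F m d Fm | true | d′ with F (m ⊕ t zero) in Ft
    ... | true = x⁺ , (λ { zero _ → yz }) , (zero , refl) , trans (accumulate-∅ (t ∘ suc) (λ m → F (m ⊕ t zero))) Ft
      where
      x⁺ : Fin (suc M) → Bool
      x⁺ zero    = true
      x⁺ (suc i) = false
      accumulate-∅ : ∀ {M} (t : Fin M → Fin n → Bool) (G : Function₂) → G (accumulate (λ _ → false) t m) ≡ G m
      accumulate-∅ {zero}  t G = refl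
      accumulate-∅ {suc M} t G = accumulate-∅ (t ∘ suc) G
    ... | false with nonempty-root (y ∘ suc) (t ∘ suc) (Δ (t zero) F) m
                       (d′ (t zero)) (cong₂ _xor_ Fm Ft)
    ...   | x , x⊆y , (i , xi) , Fx = split (F acc) refl
      where
      acc = accumulate x (t ∘ suc) m
      ext : Bool → Fin (suc M) → Bool
      ext b zero    = b
      ext b (suc i) = x i
      split : ∀ b → F acc ≡ b → ∃[ x ] (∀ i → x i ≡ true → y i ≡ true) × (∃[ i ] x i ≡ true) × F (accumulate x t m) ≡ true
      split true  Facc = ext false , (λ { (suc i) → x⊆y i }) , (suc i , xi) , Facc
      split false Facc = ext true , (λ { zero _ → yz ; (suc i) → x⊆y i }) , (suc i , xi)
                       , trans (cong (_xor F (acc ⊕ t zero)) (sym Facc)) Fx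

  -- Subgraphs in which all degrees are 0 or q

  divides? : ℕ → ℕ → Bool
  divides? q m = does (q ∣? m)

  divides?-sound : ∀ q m → divides? q m ≡ true → q ∣ m
  divides?-sound q m eq with q ∣? m
  ... | yes q∣m = q∣m
  divides?-sound q m () | no _

  divides?-0 : ∀ q → divides? q 0 ≡ true
  divides?-0 q with q ∣? 0
  ... | yes _   = refl
  ... | no q∤0 = ⊥-elim (q∤0 (q ∣0))

  divides?-periodic : ∀ q m → divides? q (q + m) ≡ divides? q m
  divides?-periodic q m with q ∣? m | q ∣? (q + m)
  ... | yes _   | yes _   = refl
  ... | no _    | no _    = refl
  ... | yes q∣m | no q∤   = ⊥-elim (q∤ (∣m∣n⇒∣m+n ∣-refl q∣m))
  ... | no q∤m  | yes q∣  = ⊥-elim (q∤m (∣m+n∣m⇒∣n q∣ ∣-refl))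

  multiple<2q : ∀ q m → q ∣ m → m < q + q → m ≡ 0 ⊎ m ≡ q
  multiple<2q q .(0 * q) (divides 0 refl) m<2q = inj₁ refl
  multiple<2q q .(1 * q) (divides 1 refl) m<2q = inj₂ (+-identityʳ q)
  multiple<2q q _ (divides (suc (suc c)) refl) m<2q =
    ⊥-elim (<-irrefl refl (<-≤-trans m<2q (+-monoʳ-≤ q (m≤m+n q (c * q)))))

  module _ {n : ℕ} (side live : Fin n → Bool) (y : Fin n → Fin n → Bool)
    (y-side : ∀ u v → y u v ≡ true → side u ≡ true × side v ≡ false)
    (y-live : ∀ u v → y u v ≡ true → live u ≡ true × live v ≡ true) where

    incident : (Fin n → Fin n → Bool) → Fin n → ℕ
    incident x v = sum (λ u → 𝟙 (x v u)) + sum (λ u → 𝟙 (x u v))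

    private
      #live = sum (λ v → 𝟙 (live v))

    incident-⊆ : ∀ x → (∀ u v → x u v ≡ true → y u v ≡ true) → ∀ v → incident x v ≤ incident y v
    incident-⊆ x x⊆y v = +-mono-≤ (sum-mono (λ u → 𝟙-mono (x⊆y v u))) (sum-mono (λ u → 𝟙-mono (x⊆y u v)))
      where
      𝟙-mono : ∀ {a b} → (a ≡ true → b ≡ true) → 𝟙 a ≤ 𝟙 b
      𝟙-mono {false} h = z≤n
      𝟙-mono {true}  h rewrite h refl = ≤-refl

    -- The indicator of "q divides the degree of every live vertex" is a product of factors of
    -- degree at most q - 1, so its degree is less than the number of edges of `y`. Being true for
    -- the empty edge set, it is true for a nonempty one as well. Since all degrees are below 2 q,
    -- the only multiples of q left are 0 and q.
    regular-or-isolated : ∀ k → let q = 2 ^ k in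
      (∀ v → incident y v < q + q) → #live * (q ∸ 1) < edges y →
      ∃[ x ] (∀ u v → x u v ≡ true → y u v ≡ true) × (∃[ u ] ∃[ v ] x u v ≡ true)
        × (∀ v → incident x v ≡ 0 ⊎ incident x v ≡ q)
    regular-or-isolated k small many = x , x⊆y , nonempty , regular
      where
      q = 2 ^ k
      q>0 : 1 ≤ q
      q>0 = m^n>0 2 k
      y′ : Fin (n * n) → Bool
      y′ i = uncurry y (remQuot n i)
      -- The incidence vector of the pair numbered `i`; sums of such vectors are degree sequences.
      t : Fin (n * n) → Fin n → Bool
      t i v = δ (proj₁ (remQuot {n} n i)) v ∨ δ (proj₂ (remQuot {n} n i)) v
      -- No condition is imposed at other vertices, so only live ones contribute q - 1 to the degree
      -- of the product.
      G : Fin n → Function₂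
      G v m = not (live v) ∨ divides? q (m v)
      G-deg : ∀ v → Deg< (suc (𝟙 (live v) * (q ∸ 1))) (G v)
      G-deg v with live v
      ... | false = λ t m → refl
      ... | true  = subst (λ d → Deg< d (λ m → divides? q (m v))) q≡ (Deg<-coordinate q (divides? q) v periodic)
        where
        q≡ : q ≡ suc (q ∸ 1 + 0)
        q≡ = sym (trans (cong suc (+-identityʳ (q ∸ 1))) (m+[n∸m]≡n q>0))
        periodic : ∀ m → iterate-Δ₁ q (divides? q) m ≡ false
        periodic m = trans (iterate-2^ k (divides? q) m)
          (trans (cong (divides? q m xor_) (divides?-periodic q m)) (Boolₚ.xor-same (divides? q m)))
      size : sum (𝟙 ∘ y′) ≡ edges y
      size = trans (sum-combine n (𝟙 ∘ y′))
        (sum-cong (λ a → sum-cong (λ b → cong (λ p → 𝟙 (uncurry y p)) (remQuot-combine {n} a b))))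
      degree-bound : suc (sum (λ v → 𝟙 (live v) * (q ∸ 1))) ≤ sum (𝟙 ∘ y′)
      degree-bound = ≤-trans (s≤s (≤-reflexive (trans (sum-cong (λ v → *-comm (𝟙 (live v)) (q ∸ 1)))
        (trans (sym (sum-* (q ∸ 1) (λ v → 𝟙 (live v)))) (*-comm (q ∸ 1) #live)))))
        (≤-trans many (≤-reflexive (sym size)))
      zeros : ∀ v → G v (λ _ → 0) ≡ true
      zeros v = trans (cong (not (live v) ∨_) (divides?-0 q)) (Boolₚ.∨-zeroʳ (not (live v)))
      found = nonempty-root y′ t (⋀ G) (λ _ → 0) (Deg<-mono {F = ⋀ G} degree-bound (Deg<-⋀ G _ G-deg))
                (⋀-intro G (λ _ → 0) zeros)
      x′ = proj₁ found
      x : Fin n → Fin n → Bool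
      x a b = x′ (combine a b)
      x⊆y : ∀ u v → x u v ≡ true → y u v ≡ true
      x⊆y u v xuv = trans (sym (cong (uncurry y) (remQuot-combine {n} u v))) (proj₁ (proj₂ found) (combine u v) xuv)
      nonempty : ∃[ u ] ∃[ v ] x u v ≡ true
      nonempty with proj₁ (proj₂ (proj₂ found))
      ... | i , xi = proj₁ (remQuot {n} n i) , proj₂ (remQuot {n} n i) , trans (cong x′ (combine-remQuot {n} n i)) xi
      total : ∀ v → accumulate x′ t (λ _ → 0) v ≡ incident x v
      total v = begin
        accumulate x′ t (λ _ → 0) v                     ≡⟨ accumulate-sum x′ t (λ _ → 0) v ⟩
        sum (λ i → 𝟙 (x′ i ∧ t i v))                    ≡⟨ sum-combine n _ ⟩
        sum (λ a → sum (λ b → 𝟙 (x a b ∧ t (combine a b) v)))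
          ≡⟨ sum-cong (λ a → sum-cong (λ b → cong (λ p → 𝟙 (x a b ∧ (δ (proj₁ p) v ∨ δ (proj₂ p) v))) (remQuot-combine {n} a b))) ⟩
        sum (λ a → sum (λ b → 𝟙 (x a b ∧ (δ a v ∨ δ b v))))
          ≡⟨ sum-cong (λ a → sum-cong (λ b → pointwise (x a b) (δ a v) (δ b v) (distinct a b))) ⟩
        sum (λ a → sum (λ b → 𝟙 (δ a v) * 𝟙 (x a b) + 𝟙 (δ b v) * 𝟙 (x a b)))
          ≡⟨ ∑∑-distrib-+ (λ a b → 𝟙 (δ a v) * 𝟙 (x a b)) _ ⟩
        sum (λ a → sum (λ b → 𝟙 (δ a v) * 𝟙 (x a b))) + sum (λ a → sum (λ b → 𝟙 (δ b v) * 𝟙 (x a b)))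
          ≡⟨ cong₂ _+_ (trans (sum-cong (λ a → sym (sum-* (𝟙 (δ a v)) _))) (sum-δ (λ a → sum (λ b → 𝟙 (x a b))) v))
                       (sum-cong (λ a → sum-δ (λ b → 𝟙 (x a b)) v)) ⟩
        incident x v ∎
        where
        open ≡-Reasoning
        -- The ends of an edge lie on different sides, so the `∨` in `t` never merges two
        -- contributions to one degree.
        distinct : ∀ a b → x a b ≡ true → δ a v ∧ δ b v ≡ false
        distinct a b xab with δ a v in av | δ b v in bv
        ... | false | _     = refl
        ... | true  | false = refl
        ... | true  | true with y-side a b (x⊆y a b xab)
        ...   | sa , sb with () ← trans (sym sa) (trans (cong side (trans (δ⇒≡ a v av) (sym (δ⇒≡ b v bv)))) sb)
        pointwise : ∀ x p r → (x ≡ true → p ∧ r ≡ false) → 𝟙 (x ∧ (p ∨ r)) ≡ 𝟙 p * 𝟙 x + 𝟙 r * 𝟙 x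
        pointwise false false false h = refl
        pointwise false false true  h = refl
        pointwise false true  false h = refl
        pointwise false true  true  h = refl
        pointwise true  false false h = refl
        pointwise true  false true  h = refl
        pointwise true  true  false h = refl
        pointwise true  true  true  h with () ← h refl
      divisible : ∀ v → live v ≡ true → q ∣ incident x v
      divisible v lv = subst (q ∣_) (total v) (divides?-sound q _
        (trans (cong (λ l → not l ∨ divides? q (accumulate x′ t (λ _ → 0) v)) (sym lv))
               (⋀-elim G _ (proj₂ (proj₂ (proj₂ found))) v)))
      regular : ∀ v → incident x v ≡ 0 ⊎ incident x v ≡ q
      regular v with live v in lv
      ... | true  = multiple<2q q _ (divisible v lv) (≤-<-trans (incident-⊆ x x⊆y v) (small v))
      ... | false = inj₁ (cong₂ _+_ (sum-0 (λ u → off (λ xvu → trans (sym (proj₁ (y-live v u (x⊆y v u xvu)))) lv)))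
                                    (sum-0 (λ u → off (λ xuv → trans (sym (proj₂ (y-live u v (x⊆y u v xuv)))) lv))))
        where
        off : ∀ {b} → (b ≡ true → true ≡ false) → 𝟙 b ≡ 0
        off {false} h = refl
        off {true}  h with () ← h refl

module Weighted where

  open import Algebra using (CommutativeRing)
  import Algebra.Properties.Semiring.Sum
  open import Data.Bool using (Bool; true; false; not; if_then_else_; _∧_; _∨_; _xor_)
  import Data.Bool.Properties as Boolₚ
  open import Data.Empty using (⊥; ⊥-elim)
  open import Data.Fin as Fin using (Fin; zero; suc)
  open import Data.Fin.Properties using (any?)
  import Data.Integer as ℤ
  import Data.Integer.Properties as ℤₚ
  open import Data.List as List using (allFin; foldr)
  open import Data.List.Properties using (map-tabulate)
  open import Data.Nat as ℕ using (ℕ; zero; suc; _∸_; _^_)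
  import Data.Nat.ListAction as ListAction
  import Data.Nat.Properties as ℕₚ
  open import Data.Product using (∃-syntax; _×_; _,_; proj₁; proj₂)
  open import Data.Rational
  open import Data.Rational.Properties
  open import Data.Rational.Unnormalised as ℚᵘ using (mkℚᵘ)
  import Data.Rational.Unnormalised.Properties as ℚᵘₚ
  open import Data.Sum using (_⊎_; inj₁; inj₂)
  open import Defs using (Graph; adj; degree; degreeIn; degreeSum; maxDegree; avgDegree; toℚ; RegularSubgraph)
  open import Function using (_∘_)
  open import Level using (0ℓ)
  open import Relation.Binary.PropositionalEquality
  open import Relation.Nullary using (Dec; does; yes; no)
  open import Relation.Nullary.Decidable using (dec⇒maybe)
  open import Tactic.RingSolver using (solve-∀)
  open import Tactic.RingSolver.Core.AlmostCommutativeRing using (AlmostCommutativeRing; fromCommutativeRing)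
  open Finite

  -- Ordered field arithmetic in ℚ

  ℚ-ring : AlmostCommutativeRing 0ℓ 0ℓ
  ℚ-ring = fromCommutativeRing +-*-commutativeRing (λ x → dec⇒maybe (0ℚ ≟ x))

  p≤q⇒0≤q-p : ∀ {p q} → p ≤ q → 0ℚ ≤ q - p
  p≤q⇒0≤q-p {p} {q} p≤q = subst (_≤ q - p) (+-inverseʳ p) (+-monoˡ-≤ (- p) p≤q)

  0≤q-p⇒p≤q : ∀ {p q} → 0ℚ ≤ q - p → p ≤ q
  0≤q-p⇒p≤q {p} {q} 0≤ = subst₂ _≤_ (+-identityˡ p) (cancel q p) (+-monoˡ-≤ p 0≤)
    where
    cancel : ∀ q p → q - p + p ≡ q
    cancel = solve-∀ ℚ-ring

  p<q⇒0<q-p : ∀ {p q} → p < q → 0ℚ < q - p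
  p<q⇒0<q-p {p} {q} p<q = subst (_< q - p) (+-inverseʳ p) (+-monoˡ-< (- p) p<q)

  0<q-p⇒p<q : ∀ {p q} → 0ℚ < q - p → p < q
  0<q-p⇒p<q {p} {q} 0< = subst₂ _<_ (+-identityˡ p) (cancel q p) (+-monoˡ-< p 0<)
    where
    cancel : ∀ q p → q - p + p ≡ q
    cancel = solve-∀ ℚ-ring

  -- Inequalities are proved by exhibiting the difference as a nonnegative ring expression.
  ≤-from : ∀ {p q} s → 0ℚ ≤ s → q - p ≡ s → p ≤ q
  ≤-from s 0≤s eq = 0≤q-p⇒p≤q (subst (0ℚ ≤_) (sym eq) 0≤s)

  <-from : ∀ {p q} s → 0ℚ < s → q - p ≡ s → p < q
  <-from s 0<s eq = 0<q-p⇒p<q (subst (0ℚ <_) (sym eq) 0<s)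

  0≤+ : ∀ {p q} → 0ℚ ≤ p → 0ℚ ≤ q → 0ℚ ≤ p + q
  0≤+ 0≤p 0≤q = +-mono-≤ 0≤p 0≤q

  0<+ : ∀ {p q} → 0ℚ < p → 0ℚ ≤ q → 0ℚ < p + q
  0<+ 0<p 0≤q = +-mono-<-≤ 0<p 0≤q

  p≤p+q : ∀ {p q} → 0ℚ ≤ q → p ≤ p + q
  p≤p+q {p} {q} 0≤q = subst (_≤ p + q) (+-identityʳ p) (+-monoʳ-≤ p 0≤q)

  p≤q+p : ∀ {p q} → 0ℚ ≤ q → p ≤ q + p
  p≤q+p {p} {q} 0≤q = subst (_≤ q + p) (+-identityˡ p) (+-monoˡ-≤ p 0≤q)

  *-monoʳ : ∀ {r p q} → 0ℚ ≤ r → p ≤ q → r * p ≤ r * q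
  *-monoʳ {r} 0≤r = *-monoˡ-≤-nonNeg r {{nonNegative 0≤r}}

  *-monoˡ : ∀ {r p q} → 0ℚ ≤ r → p ≤ q → p * r ≤ q * r
  *-monoˡ {r} 0≤r = *-monoʳ-≤-nonNeg r {{nonNegative 0≤r}}

  0≤* : ∀ {p q} → 0ℚ ≤ p → 0ℚ ≤ q → 0ℚ ≤ p * q
  0≤* {p} {q} 0≤p 0≤q = subst (_≤ p * q) (*-zeroʳ p) (*-monoʳ 0≤p 0≤q)

  0<* : ∀ {p q} → 0ℚ < p → 0ℚ < q → 0ℚ < p * q
  0<* {p} {q} 0<p 0<q = subst (_< p * q) (*-zeroʳ p) (*-monoʳ-<-pos p {{positive 0<p}} 0<q)

  *-mono : ∀ {p q r s} → 0ℚ ≤ p → 0ℚ ≤ s → p ≤ q → r ≤ s → p * r ≤ q * s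
  *-mono 0≤p 0≤s p≤q r≤s = ≤-trans (*-monoʳ 0≤p r≤s) (*-monoˡ 0≤s p≤q)

  *-cancel : ∀ {r p q} → 0ℚ < r → r * p ≤ r * q → p ≤ q
  *-cancel {r} 0<r = *-cancelˡ-≤-pos r {{positive 0<r}}

  *-cancel-< : ∀ {r p q} → 0ℚ ≤ r → r * p < r * q → p < q
  *-cancel-< {r} 0≤r = *-cancelˡ-<-nonNeg r {{nonNegative 0≤r}}

  0≤² : ∀ p → 0ℚ ≤ p * p
  0≤² p with ≤-total 0ℚ p
  ... | inj₁ 0≤p = 0≤* 0≤p 0≤p
  ... | inj₂ p≤0 = subst (0ℚ ≤_) (neg² p) (0≤* 0≤-p 0≤-p)
    where
    0≤-p : 0ℚ ≤ - p
    0≤-p = neg-antimono-≤ p≤0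
    neg² : ∀ p → (- p) * (- p) ≡ p * p
    neg² = solve-∀ ℚ-ring

  opaque
    reciprocal : ∀ {p} → 0ℚ < p → ∃[ i ] 0ℚ < i × i * p ≡ 1ℚ
    reciprocal {p} 0<p = (1/ p) {{p≢0}} , positive⁻¹ _ {{1/pos⇒pos p {{positive 0<p}}}} , *-inverseˡ p {{p≢0}}
      where
      p≢0 : NonZero p
      p≢0 = pos⇒nonZero p {{positive 0<p}}

    _≤𝔹_ : ℚ → ℚ → Bool
    p ≤𝔹 q = does (p ≤? q)

    ≤𝔹-true : ∀ {p q} → (p ≤𝔹 q) ≡ true → p ≤ q
    ≤𝔹-true {p} {q} = sound (p ≤? q)
      where
      sound : (d : Dec (p ≤ q)) → does d ≡ true → p ≤ q
      sound (yes p≤q) _ = p≤q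

    ≤𝔹-false : ∀ {p q} → (p ≤𝔹 q) ≡ false → q ≤ p
    ≤𝔹-false {p} {q} = sound (p ≤? q)
      where
      sound : (d : Dec (p ≤ q)) → does d ≡ false → q ≤ p
      sound (no p≰q) _ = <⇒≤ (≰⇒> p≰q)

  dbl quad : ℚ → ℚ
  dbl p  = p + p
  quad p = dbl (dbl p)

  0≤dbl : ∀ {p} → 0ℚ ≤ p → 0ℚ ≤ dbl p
  0≤dbl 0≤p = 0≤+ 0≤p 0≤p

  0<dbl : ∀ {p} → 0ℚ < p → 0ℚ < dbl p
  0<dbl 0<p = 0<+ 0<p (<⇒≤ 0<p)

  dbl-mono : ∀ {p q} → p ≤ q → dbl p ≤ dbl q
  dbl-mono p≤q = +-mono-≤ p≤q p≤q

  0≤quad : ∀ {p} → 0ℚ ≤ p → 0ℚ ≤ quad p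
  0≤quad 0≤p = 0≤dbl (0≤dbl 0≤p)

  0<1 : 0ℚ < 1ℚ
  0<1 = *<* (ℤ.+<+ (ℕ.s≤s ℕ.z≤n))

  0≤1 : 0ℚ ≤ 1ℚ
  0≤1 = <⇒≤ 0<1

  -- Sums of rationals and the embedding of ℕ

  private
    module ℚ∑ = Algebra.Properties.Semiring.Sum (CommutativeRing.semiring +-*-commutativeRing)

  opaque
    ∑ : ∀ {n} → (Fin n → ℚ) → ℚ
    ∑ = ℚ∑.sum

  opaque
    unfolding ∑

    ∑-zero : (f : Fin 0 → ℚ) → ∑ f ≡ 0ℚ
    ∑-zero f = refl

    ∑-suc : ∀ {n} (f : Fin (suc n) → ℚ) → ∑ f ≡ f zero + ∑ (f ∘ suc)
    ∑-suc f = refl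

    ∑-cong : ∀ {n} {f g : Fin n → ℚ} → (∀ i → f i ≡ g i) → ∑ f ≡ ∑ g
    ∑-cong = ℚ∑.sum-cong-≗

    ∑-+ : ∀ {n} (f g : Fin n → ℚ) → ∑ (λ i → f i + g i) ≡ ∑ f + ∑ g
    ∑-+ = ℚ∑.∑-distrib-+

    ∑-* : ∀ {n} c (f : Fin n → ℚ) → c * ∑ f ≡ ∑ (λ i → c * f i)
    ∑-* c f = ℚ∑.*-distribˡ-sum c f

    ∑-swap : ∀ {m n} (f : Fin m → Fin n → ℚ) → ∑ (λ i → ∑ (λ j → f i j)) ≡ ∑ (λ j → ∑ (λ i → f i j))
    ∑-swap = ℚ∑.∑-comm

    ∑-0 : ∀ {n} {f : Fin n → ℚ} → (∀ i → f i ≡ 0ℚ) → ∑ f ≡ 0ℚ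
    ∑-0 {n} f≡0 = trans (ℚ∑.sum-cong-≗ f≡0) (ℚ∑.sum-replicate-zero n)

    ∑-mono : ∀ {n} {f g : Fin n → ℚ} → (∀ i → f i ≤ g i) → ∑ f ≤ ∑ g
    ∑-mono {zero}  f≤g = ≤-refl
    ∑-mono {suc n} f≤g = +-mono-≤ (f≤g zero) (∑-mono {n} (f≤g ∘ suc))

  ∑-nonneg : ∀ {n} {f : Fin n → ℚ} → (∀ i → 0ℚ ≤ f i) → 0ℚ ≤ ∑ f
  ∑-nonneg {n} {f} 0≤f = subst (_≤ ∑ f) (∑-0 {n} {λ _ → 0ℚ} (λ _ → refl)) (∑-mono 0≤f)

  ∑-*ʳ : ∀ {n} c (f : Fin n → ℚ) → ∑ f * c ≡ ∑ (λ i → f i * c)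
  ∑-*ʳ c f = trans (*-comm (∑ f) c) (trans (∑-* c f) (∑-cong (λ i → *-comm c (f i))))

  ∑-neg : ∀ {n} (f : Fin n → ℚ) → ∑ (λ i → - f i) ≡ - ∑ f
  ∑-neg f = trans (∑-cong (λ i → neg-*-1 (f i))) (trans (sym (∑-* (- 1ℚ) f)) (sym (neg-*-1 (∑ f))))
    where
    neg-*-1 : ∀ p → - p ≡ - 1ℚ * p
    neg-*-1 = solve-∀ ℚ-ring

  ∑-- : ∀ {n} (f g : Fin n → ℚ) → ∑ (λ i → f i - g i) ≡ ∑ f - ∑ g
  ∑-- f g = trans (∑-+ f (λ i → - g i)) (cong (∑ f +_) (∑-neg g))

  opaque
    ι : ℕ → ℚ
    ι = toℚ

  opaque
    unfolding ι

    ι≡toℚ : ∀ m → ι m ≡ toℚ m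
    ι≡toℚ m = refl

    ι-0 : ι 0 ≡ 0ℚ
    ι-0 = refl

    ι-1 : ι 1 ≡ 1ℚ
    ι-1 = refl

    ι-toℚᵘ : ∀ m → toℚᵘ (ι m) ℚᵘ.≃ mkℚᵘ (ℤ.+ m) 0
    ι-toℚᵘ m = toℚᵘ-fromℚᵘ (mkℚᵘ (ℤ.+ m) 0)

    ι-+ : ∀ m n → ι (m ℕ.+ n) ≡ ι m + ι n
    ι-+ m n = toℚᵘ-injective (begin
      toℚᵘ (ι (m ℕ.+ n))                  ≈⟨ ι-toℚᵘ (m ℕ.+ n) ⟩
      mkℚᵘ (ℤ.+ (m ℕ.+ n)) 0                ≈⟨ ℚᵘ.*≡* (cong (ℤ._* ℤ.+ 1) (trans (ℤₚ.pos-+ m n) (sym (cong₂ ℤ._+_ (ℤₚ.*-identityʳ (ℤ.+ m)) (ℤₚ.*-identityʳ (ℤ.+ n)))))) ⟩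
      mkℚᵘ (ℤ.+ m) 0 ℚᵘ.+ mkℚᵘ (ℤ.+ n) 0    ≈⟨ ℚᵘₚ.+-cong (ℚᵘₚ.≃-sym (ι-toℚᵘ m)) (ℚᵘₚ.≃-sym (ι-toℚᵘ n)) ⟩
      toℚᵘ (ι m) ℚᵘ.+ toℚᵘ (ι n)        ≈⟨ toℚᵘ-homo-+ (ι m) (ι n) ⟨
      toℚᵘ (ι m + ι n)                  ∎)
      where open ℚᵘₚ.≃-Reasoning

    ι-* : ∀ m n → ι (m ℕ.* n) ≡ ι m * ι n
    ι-* m n = toℚᵘ-injective (begin
      toℚᵘ (ι (m ℕ.* n))                  ≈⟨ ι-toℚᵘ (m ℕ.* n) ⟩
      mkℚᵘ (ℤ.+ (m ℕ.* n)) 0                ≈⟨ ℚᵘ.*≡* (cong (ℤ._* ℤ.+ 1) (ℤₚ.pos-* m n)) ⟩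
      mkℚᵘ (ℤ.+ m) 0 ℚᵘ.* mkℚᵘ (ℤ.+ n) 0    ≈⟨ ℚᵘₚ.*-cong (ℚᵘₚ.≃-sym (ι-toℚᵘ m)) (ℚᵘₚ.≃-sym (ι-toℚᵘ n)) ⟩
      toℚᵘ (ι m) ℚᵘ.* toℚᵘ (ι n)        ≈⟨ toℚᵘ-homo-* (ι m) (ι n) ⟨
      toℚᵘ (ι m * ι n)                  ∎)
      where open ℚᵘₚ.≃-Reasoning

    ι-mono : ∀ {m n} → m ℕ.≤ n → ι m ≤ ι n
    ι-mono {m} {n} m≤n = toℚᵘ-cancel-≤ (ℚᵘₚ.≤-respˡ-≃ (ℚᵘₚ.≃-sym (ι-toℚᵘ m)) (ℚᵘₚ.≤-respʳ-≃ (ℚᵘₚ.≃-sym (ι-toℚᵘ n))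
      (ℚᵘ.*≤* (ℤₚ.*-monoʳ-≤-nonNeg (ℤ.+ 1) (ℤ.+≤+ m≤n)))))

    ι-cancel-< : ∀ {m n} → ι m < ι n → m ℕ.< n
    ι-cancel-< {m} {n} m<n = ℕₚ.≰⇒> λ n≤m → <-irrefl refl (<-≤-trans m<n (ι-mono {n} {m} n≤m))

    0≤ι : ∀ m → 0ℚ ≤ ι m
    0≤ι m = ι-mono {0} {m} ℕ.z≤n

    /-*-cancel : ∀ i n → (i / suc n) * ι (suc n) ≡ i / 1
    /-*-cancel i n = toℚᵘ-injective (begin
      toℚᵘ ((i / suc n) * ι (suc n))             ≈⟨ toℚᵘ-homo-* (i / suc n) (ι (suc n)) ⟩
      toℚᵘ (i / suc n) ℚᵘ.* toℚᵘ (ι (suc n))     ≈⟨ ℚᵘₚ.*-cong (toℚᵘ-fromℚᵘ (mkℚᵘ i n)) (ι-toℚᵘ (suc n)) ⟩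
      mkℚᵘ i n ℚᵘ.* mkℚᵘ (ℤ.+ suc n) 0             ≈⟨ ℚᵘ.*≡* (ℤₚ.*-assoc i (ℤ.+ suc n) (ℤ.+ 1)) ⟩
      mkℚᵘ i 0                                     ≈⟨ toℚᵘ-fromℚᵘ (mkℚᵘ i 0) ⟨
      toℚᵘ (i / 1)                                 ∎)
      where
      open ℚᵘₚ.≃-Reasoning

  ι-sum : ∀ {n} (f : Fin n → ℕ) → ι (sum f) ≡ ∑ (λ i → ι (f i))
  ι-sum {zero}  f = trans (trans (cong ι (sum-zero f)) ι-0) (sym (∑-zero _))
  ι-sum {suc n} f = begin
    ι (sum f)                                  ≡⟨ cong ι (sum-suc f) ⟩
    ι (f zero ℕ.+ sum (f ∘ suc))               ≡⟨ ι-+ (f zero) _ ⟩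
    ι (f zero) + ι (sum (f ∘ suc))           ≡⟨ cong (ι (f zero) +_) (ι-sum (f ∘ suc)) ⟩
    ι (f zero) + ∑ (λ i → ι (f (suc i)))     ≡⟨ ∑-suc (λ i → ι (f i)) ⟨
    ∑ (λ i → ι (f i))                          ∎
    where open ≡-Reasoning

  ι-suc : ∀ m → ι (suc m) ≡ 1ℚ + ι m
  ι-suc m = trans (ι-+ 1 m) (cong (_+ ι m) ι-1)

  ι-2 : ι 2 ≡ 1ℚ + 1ℚ
  ι-2 = trans (ι-+ 1 1) (cong₂ _+_ ι-1 ι-1)

  dbl≡ι2* : ∀ p → dbl p ≡ ι 2 * p
  dbl≡ι2* p = trans (rearr p) (cong (_* p) (sym ι-2))
    where
    rearr : ∀ p → p + p ≡ (1ℚ + 1ℚ) * p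
    rearr = solve-∀ ℚ-ring

  quad≡ι4* : ∀ p → quad p ≡ ι 4 * p
  quad≡ι4* p = trans (dbl≡ι2* (dbl p)) (trans (cong (ι 2 *_) (dbl≡ι2* p)) (trans (sym (*-assoc (ι 2) (ι 2) p)) (cong (_* p) (sym (ι-* 2 2)))))

  1≤ι : ∀ {m} → 1 ℕ.≤ m → 1ℚ ≤ ι m
  1≤ι {m} 1≤m = subst (_≤ ι m) ι-1 (ι-mono {1} {m} 1≤m)

  ι-cancel-≤ : ∀ {a b} → ι a ≤ ι b → a ℕ.≤ b
  ι-cancel-≤ {a} {b} le = ℕₚ.≮⇒≥ λ b<a → <-irrefl refl (<-≤-trans ιb<ι[1+b] (≤-trans (ι-mono {suc b} {a} b<a) le))
    where
    ιb<ι[1+b] : ι b < ι (suc b)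
    ιb<ι[1+b] = subst₂ _<_ (+-identityˡ (ι b)) (sym (ι-suc b)) (+-monoˡ-< (ι b) 0<1)

  χ : Bool → ℚ
  χ true  = 1ℚ
  χ false = 0ℚ

  0≤χ : ∀ b → 0ℚ ≤ χ b
  0≤χ true  = 0≤1
  0≤χ false = ≤-refl

  χ≤1 : ∀ b → χ b ≤ 1ℚ
  χ≤1 true  = ≤-refl
  χ≤1 false = 0≤1

  ι𝟙≡χ : ∀ b → ι (𝟙 b) ≡ χ b
  ι𝟙≡χ true  = ι-1
  ι𝟙≡χ false = ι-0

  χ-∧ : ∀ a b → χ (a ∧ b) ≤ χ a
  χ-∧ false b = ≤-refl
  χ-∧ true  b = χ≤1 b

  χ*≤ : ∀ b {p} → 0ℚ ≤ p → χ b * p ≤ p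
  χ*≤ b {p} 0≤p = subst (χ b * p ≤_) (*-identityˡ p) (*-monoˡ 0≤p (χ≤1 b))

  0≤1-χ : ∀ b → 0ℚ ≤ 1ℚ - χ b
  0≤1-χ b = p≤q⇒0≤q-p (χ≤1 b)

  ∑-δ : ∀ {n} (f : Fin n → ℚ) i → ∑ (λ j → χ (δ j i) * f j) ≡ f i
  ∑-δ {suc n} f zero = trans (∑-suc (λ j → χ (δ j zero) * f j)) (trans (cong (1ℚ * f zero +_) (∑-0 {n} (λ j → *-zeroˡ (f (suc j))))) (rearr (f zero)))
    where
    rearr : ∀ s → 1ℚ * s + 0ℚ ≡ s
    rearr = solve-∀ ℚ-ring
  ∑-δ {suc n} f (suc i) = trans (∑-suc (λ j → χ (δ j (suc i)) * f j)) (trans (cong₂ _+_ (*-zeroˡ (f zero)) (∑-δ (f ∘ suc) i)) (+-identityˡ (f (suc i))))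

  -- Expectation and variance for independent coordinates

  infixr 5 _∷ᶠ_
  _∷ᶠ_ : ∀ {n} → Bool → (Fin n → Bool) → Fin (suc n) → Bool
  (b ∷ᶠ x) zero    = b
  (b ∷ᶠ x) (suc i) = x i

  -- Expectation over independent coordinates with P(x v = true) = p v.
  E : ∀ {n} → (Fin n → ℚ) → ((Fin n → Bool) → ℚ) → ℚ
  E {zero}  p f = f (λ ())
  E {suc n} p f = p zero * E (p ∘ suc) (λ x → f (true ∷ᶠ x)) + (1ℚ - p zero) * E (p ∘ suc) (λ x → f (false ∷ᶠ x))

  E-cong : ∀ {n} (p : Fin n → ℚ) {f g} → (∀ x → f x ≡ g x) → E p f ≡ E p g
  E-cong {zero}  p f≗g = f≗g _
  E-cong {suc n} p f≗g = cong₂ _+_ (cong (p zero *_) (E-cong (p ∘ suc) (λ x → f≗g (true ∷ᶠ x))))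
                                   (cong ((1ℚ - p zero) *_) (E-cong (p ∘ suc) (λ x → f≗g (false ∷ᶠ x))))

  E-+ : ∀ {n} (p : Fin n → ℚ) f g → E p (λ x → f x + g x) ≡ E p f + E p g
  E-+ {zero}  p f g = refl
  E-+ {suc n} p f g = trans
    (cong₂ (λ s t → p zero * s + (1ℚ - p zero) * t) (E-+ (p ∘ suc) (λ x → f (true ∷ᶠ x)) (λ x → g (true ∷ᶠ x)))
                                                    (E-+ (p ∘ suc) (λ x → f (false ∷ᶠ x)) (λ x → g (false ∷ᶠ x))))
    (rearr (p zero) _ _ _ _)
    where
    rearr : ∀ p a b c d → p * (a + b) + (1ℚ - p) * (c + d) ≡ p * a + (1ℚ - p) * c + (p * b + (1ℚ - p) * d)
    rearr = solve-∀ ℚ-ring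

  E-const : ∀ {n} (p : Fin n → ℚ) c → E p (λ _ → c) ≡ c
  E-const {zero}  p c = refl
  E-const {suc n} p c rewrite E-const (p ∘ suc) c = rearr (p zero) c
    where
    rearr : ∀ p c → p * c + (1ℚ - p) * c ≡ c
    rearr = solve-∀ ℚ-ring

  E-* : ∀ {n} (p : Fin n → ℚ) c f → E p (λ x → c * f x) ≡ c * E p f
  E-* {zero}  p c f = refl
  E-* {suc n} p c f = trans
    (cong₂ (λ s t → p zero * s + (1ℚ - p zero) * t) (E-* (p ∘ suc) c (λ x → f (true ∷ᶠ x))) (E-* (p ∘ suc) c (λ x → f (false ∷ᶠ x))))
    (rearr (p zero) c _ _)
    where
    rearr : ∀ p c a b → p * (c * a) + (1ℚ - p) * (c * b) ≡ c * (p * a + (1ℚ - p) * b)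
    rearr = solve-∀ ℚ-ring

  E-∑ : ∀ {n m} (p : Fin n → ℚ) (f : Fin m → (Fin n → Bool) → ℚ) → E p (λ x → ∑ (λ i → f i x)) ≡ ∑ (λ i → E p (f i))
  E-∑ {m = zero}  p f = trans (trans (E-cong p (λ x → ∑-zero (λ i → f i x))) (E-const p 0ℚ)) (sym (∑-zero _))
  E-∑ {m = suc m} p f = begin
    E p (λ x → ∑ (λ i → f i x))                          ≡⟨ E-cong p (λ x → ∑-suc (λ i → f i x)) ⟩
    E p (λ x → f zero x + ∑ (λ i → f (suc i) x))         ≡⟨ E-+ p (f zero) _ ⟩
    E p (f zero) + E p (λ x → ∑ (λ i → f (suc i) x))     ≡⟨ cong (E p (f zero) +_) (E-∑ p (f ∘ suc)) ⟩
    E p (f zero) + ∑ (λ i → E p (f (suc i)))             ≡⟨ ∑-suc (λ i → E p (f i)) ⟨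
    ∑ (λ i → E p (f i))                                  ∎
    where open ≡-Reasoning

  E-χ : ∀ {n} (p : Fin n → ℚ) v → E p (λ x → χ (x v)) ≡ p v
  E-χ {suc n} p zero rewrite E-const (p ∘ suc) 1ℚ | E-const (p ∘ suc) 0ℚ = rearr (p zero)
    where
    rearr : ∀ p → p * 1ℚ + (1ℚ - p) * 0ℚ ≡ p
    rearr = solve-∀ ℚ-ring
  E-χ {suc n} p (suc v) rewrite E-χ (p ∘ suc) v = rearr (p zero) (p (suc v))
    where
    rearr : ∀ p c → p * c + (1ℚ - p) * c ≡ c
    rearr = solve-∀ ℚ-ring

  affine : ∀ {n} → ℚ → (Fin n → ℚ) → (Fin n → Bool) → ℚ
  affine c a x = c + ∑ (λ u → a u * χ (x u))

  affine-∷ : ∀ {n} c (a : Fin (suc n) → ℚ) b x → affine c a (b ∷ᶠ x) ≡ affine (c + a zero * χ b) (a ∘ suc) x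
  affine-∷ c a b x = trans (cong (c +_) (∑-suc (λ u → a u * χ ((b ∷ᶠ x) u))))
                           (sym (+-assoc c (a zero * χ b) _))

  variance : ∀ {n} → (Fin n → ℚ) → (Fin n → ℚ) → ℚ
  variance p a = ∑ (λ u → a u * a u * (p u * (1ℚ - p u)))

  mean : ∀ {n} → (Fin n → ℚ) → ℚ → (Fin n → ℚ) → ℚ
  mean p c a = c + ∑ (λ u → a u * p u)

  mean-suc : ∀ {n} (p : Fin (suc n) → ℚ) c a → mean p c a ≡ mean (p ∘ suc) c (a ∘ suc) + a zero * p zero
  mean-suc p c a = trans (cong (c +_) (∑-suc (λ u → a u * p u))) (rearr c (a zero * p zero) _)
    where
    rearr : ∀ c x s → c + (x + s) ≡ (c + s) + x
    rearr = solve-∀ ℚ-ring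

  mean-shift : ∀ {n} (p : Fin n → ℚ) c d a → mean p (c + d) a ≡ mean p c a + d
  mean-shift p c d a = rearr c d _
    where
    rearr : ∀ c x s → c + x + s ≡ (c + s) + x
    rearr = solve-∀ ℚ-ring

  -- The law of total variance, one coordinate at a time: fixing the first coordinate moves the
  -- conditional mean by `a zero` or by 0, and this spread contributes the first term of `variance`.
  E-affine² : ∀ {n} (p : Fin n → ℚ) c a →
    E p (λ x → affine c a x * affine c a x) ≡ mean p c a * mean p c a + variance p a
  E-affine² {zero} p c a = trans
    (cong (λ s → (c + s) * (c + s)) (trans (∑-zero _) (sym (∑-zero (λ u → a u * p u)))))
    (sym (trans (cong (mean p c a * mean p c a +_) (∑-zero _)) (+-identityʳ _)))
  E-affine² {suc n} p c a = begin
    q * E (p ∘ suc) (λ x → affine c a (true ∷ᶠ x) * affine c a (true ∷ᶠ x))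
      + (1ℚ - q) * E (p ∘ suc) (λ x → affine c a (false ∷ᶠ x) * affine c a (false ∷ᶠ x))
      ≡⟨ cong₂ (λ s t → q * s + (1ℚ - q) * t) (case true) (case false) ⟩
    q * ((m + a₀ * 1ℚ) * (m + a₀ * 1ℚ) + w) + (1ℚ - q) * ((m + a₀ * 0ℚ) * (m + a₀ * 0ℚ) + w)
      ≡⟨ rearr q m a₀ w ⟩
    (m + a₀ * q) * (m + a₀ * q) + (a₀ * a₀ * (q * (1ℚ - q)) + w)
      ≡⟨ cong₂ (λ s t → s * s + t) (mean-suc p c a) (∑-suc (λ u → a u * a u * (p u * (1ℚ - p u)))) ⟨
    mean p c a * mean p c a + variance p a ∎
    where
    open ≡-Reasoning
    q = p zero
    a₀ = a zero
    m = mean (p ∘ suc) c (a ∘ suc)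
    w = variance (p ∘ suc) (a ∘ suc)
    case : ∀ b → E (p ∘ suc) (λ x → affine c a (b ∷ᶠ x) * affine c a (b ∷ᶠ x)) ≡ (m + a₀ * χ b) * (m + a₀ * χ b) + w
    case b = trans (E-cong (p ∘ suc) (λ x → cong₂ _*_ (affine-∷ c a b x) (affine-∷ c a b x)))
      (trans (E-affine² (p ∘ suc) (c + a₀ * χ b) (a ∘ suc))
             (cong (λ s → s * s + w) (mean-shift (p ∘ suc) c (a₀ * χ b) (a ∘ suc))))
    rearr : ∀ q m a w → q * ((m + a * 1ℚ) * (m + a * 1ℚ) + w) + (1ℚ - q) * ((m + a * 0ℚ) * (m + a * 0ℚ) + w)
          ≡ (m + a * q) * (m + a * q) + (a * a * (q * (1ℚ - q)) + w)
    rearr = solve-∀ ℚ-ring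

  E-χ-independent : ∀ {n} (p : Fin n → ℚ) v f → (∀ x y → (∀ u → u ≢ v → x u ≡ y u) → f x ≡ f y) →
    E p (λ x → χ (x v) * f x) ≡ p v * E p f
  E-χ-independent {suc n} p zero f indep = begin
    q * E (p ∘ suc) (λ x → 1ℚ * f (true ∷ᶠ x)) + (1ℚ - q) * E (p ∘ suc) (λ x → 0ℚ * f (false ∷ᶠ x))
      ≡⟨ cong₂ (λ s t → q * s + (1ℚ - q) * t) (E-* (p ∘ suc) 1ℚ (λ x → f (true ∷ᶠ x))) (E-* (p ∘ suc) 0ℚ (λ x → f (false ∷ᶠ x))) ⟩
    q * (1ℚ * Et) + (1ℚ - q) * (0ℚ * Ef)      ≡⟨ cong (λ t → q * (1ℚ * Et) + (1ℚ - q) * (0ℚ * t)) Ef≡Et ⟩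
    q * (1ℚ * Et) + (1ℚ - q) * (0ℚ * Et)      ≡⟨ rearr q Et ⟩
    q * (q * Et + (1ℚ - q) * Et)              ≡⟨ cong (λ t → q * (q * Et + (1ℚ - q) * t)) Ef≡Et ⟨
    q * E p f ∎
    where
    open ≡-Reasoning
    q = p zero
    Et = E (p ∘ suc) (λ x → f (true ∷ᶠ x))
    Ef = E (p ∘ suc) (λ x → f (false ∷ᶠ x))
    Ef≡Et : Ef ≡ Et
    Ef≡Et = E-cong (p ∘ suc) (λ x → indep _ _ λ { zero z≢z → ⊥-elim (z≢z refl) ; (suc u) _ → refl })
    rearr : ∀ q t → q * (1ℚ * t) + (1ℚ - q) * (0ℚ * t) ≡ q * (q * t + (1ℚ - q) * t)
    rearr = solve-∀ ℚ-ring
  E-χ-independent {suc n} p (suc v) f indep = trans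
    (cong₂ (λ s t → p zero * s + (1ℚ - p zero) * t) (case true) (case false)) (rearr (p zero) (p (suc v)) _ _)
    where
    case : ∀ b → E (p ∘ suc) (λ x → χ (x v) * f (b ∷ᶠ x)) ≡ p (suc v) * E (p ∘ suc) (λ x → f (b ∷ᶠ x))
    case b = E-χ-independent (p ∘ suc) v (λ x → f (b ∷ᶠ x))
      (λ x y eq → indep (b ∷ᶠ x) (b ∷ᶠ y) λ { zero _ → refl ; (suc u) u≢v → eq u (λ u≡v → u≢v (cong suc u≡v)) })
    rearr : ∀ q r s t → q * (r * s) + (1ℚ - q) * (r * t) ≡ r * (q * s + (1ℚ - q) * t)
    rearr = solve-∀ ℚ-ring

  affine-independent : ∀ {n} c (a : Fin n → ℚ) v → a v ≡ 0ℚ → ∀ x y → (∀ u → u ≢ v → x u ≡ y u) → affine c a x ≡ affine c a y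
  affine-independent c a v av≡0 x y eq = cong (c +_) (∑-cong term)
    where
    term : ∀ u → a u * χ (x u) ≡ a u * χ (y u)
    term u with u Fin.≟ v
    ... | no u≢v   = cong (λ b → a u * χ b) (eq u u≢v)
    ... | yes refl = trans (vanish (x u)) (sym (vanish (y u)))
      where
      vanish : ∀ b → a u * χ b ≡ 0ℚ
      vanish b = trans (cong (_* χ b) av≡0) (*-zeroˡ (χ b))

  -- With `a v` equal to 0 the affine function ignores coordinate `v`. Applied to a graph without
  -- loops, the survival of a vertex is independent of its sampled degree.
  E-χ-affine² : ∀ {n} (p : Fin n → ℚ) c a v → a v ≡ 0ℚ →
    E p (λ x → χ (x v) * (affine c a x * affine c a x)) ≡ p v * (mean p c a * mean p c a + variance p a)
  E-χ-affine² p c a v av≡0 = trans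
    (E-χ-independent p v (λ x → affine c a x * affine c a x) (λ x y eq → cong (λ t → t * t) (affine-independent c a v av≡0 x y eq)))
    (cong (p v *_) (E-affine² p c a))

  E-affine : ∀ {n} (p : Fin n → ℚ) c a → E p (affine c a) ≡ mean p c a
  E-affine p c a = trans (E-+ p (λ _ → c) (λ x → ∑ (λ u → a u * χ (x u)))) (cong₂ _+_ (E-const p c)
    (trans (E-∑ p (λ u x → a u * χ (x u))) (∑-cong (λ u → trans (E-* p (a u) (λ x → χ (x u))) (cong (a u *_) (E-χ p u))))))

  E-χ-affine : ∀ {n} (p : Fin n → ℚ) c a v → a v ≡ 0ℚ → E p (λ x → χ (x v) * affine c a x) ≡ p v * mean p c a
  E-χ-affine p c a v av≡0 = trans (E-χ-independent p v (affine c a) (affine-independent c a v av≡0)) (cong (p v *_) (E-affine p c a))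

  -- Each coordinate is fixed at the value with the smaller conditional expectation. The outcome may
  -- even have probability 0; only the inequality matters.
  E-attained : ∀ {n} (p : Fin n → ℚ) f → (∀ v → 0ℚ ≤ p v) → (∀ v → p v ≤ 1ℚ) → ∃[ x ] f x ≤ E p f
  E-attained {zero}  p f 0≤p p≤1 = (λ ()) , ≤-refl
  E-attained {suc n} p f 0≤p p≤1 = choose (≤-total Et Ef)
    where
    q = p zero
    Et = E (p ∘ suc) (λ x → f (true ∷ᶠ x))
    Ef = E (p ∘ suc) (λ x → f (false ∷ᶠ x))
    choose : Et ≤ Ef ⊎ Ef ≤ Et → ∃[ x ] f x ≤ q * Et + (1ℚ - q) * Ef
    choose (inj₁ t≤f) with E-attained (p ∘ suc) (λ x → f (true ∷ᶠ x)) (0≤p ∘ suc) (p≤1 ∘ suc)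
    ... | x , fx≤ = true ∷ᶠ x , ≤-trans fx≤ (≤-from ((1ℚ - q) * (Ef - Et)) (0≤* (p≤q⇒0≤q-p (p≤1 zero)) (p≤q⇒0≤q-p t≤f)) (rearr q Et Ef))
      where
      rearr : ∀ q s t → q * s + (1ℚ - q) * t - s ≡ (1ℚ - q) * (t - s)
      rearr = solve-∀ ℚ-ring
    choose (inj₂ f≤t) with E-attained (p ∘ suc) (λ x → f (false ∷ᶠ x)) (0≤p ∘ suc) (p≤1 ∘ suc)
    ... | x , fx≤ = false ∷ᶠ x , ≤-trans fx≤ (≤-from (q * (Et - Ef)) (0≤* (0≤p zero) (p≤q⇒0≤q-p f≤t)) (rearr q Et Ef))
      where
      rearr : ∀ q s t → q * s + (1ℚ - q) * t - t ≡ q * (s - t)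
      rearr = solve-∀ ℚ-ring

  -- Weightings and one round of random sampling

  record Weighting {n} (e : Fin n → Fin n → Bool) (W M : ℚ) (w : Fin n → Fin n → ℚ) : Set where
    field
      symmetric : ∀ u v → w u v ≡ w v u
      nonneg    : ∀ u v → 0ℚ ≤ w u v
      bounded   : ∀ u v → w u v ≤ W
      supported : ∀ u v → e u v ≡ false → w u v ≡ 0ℚ
      row≤      : ∀ v → ∑ (w v) ≤ M

  gap gap² : ∀ {n} → ℚ → (Fin n → Bool) → (Fin n → Fin n → ℚ) → Fin n → ℚ
  gap  M l w v = χ (l v) * (M - ∑ (w v))
  gap² M l w v = χ (l v) * ((M - ∑ (w v)) * (M - ∑ (w v)))

  -- Completing the square: with A = ∑ α and X = ∑ α h, the difference of the two sides times M is ∑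
  -- α (M h - X)² + (M - A) X².
  weighted-cauchy : ∀ {n} M (α h : Fin n → ℚ) → 0ℚ < M → (∀ u → 0ℚ ≤ α u) → ∑ α ≤ M →
    ∑ (λ u → α u * h u) * ∑ (λ u → α u * h u) ≤ M * ∑ (λ u → α u * (h u * h u))
  weighted-cauchy {n} M α h 0<M 0≤α A≤M = *-cancel 0<M (≤-from (S + (M - A) * (X * X)) (0≤+ 0≤S (0≤* (p≤q⇒0≤q-p A≤M) (0≤² X))) (trans (rearr M A X Y) (cong (_+ (M - A) * (X * X)) (sym S≡))))
    where
    A = ∑ α
    X = ∑ (λ u → α u * h u)
    Y = ∑ (λ u → α u * (h u * h u))
    S = ∑ (λ u → α u * ((M * h u - X) * (M * h u - X)))
    0≤S : 0ℚ ≤ S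
    0≤S = ∑-nonneg (λ u → 0≤* (0≤α u) (0≤² (M * h u - X)))
    rearr : ∀ M A X Y → M * (M * Y) - M * (X * X) ≡ M * M * Y + - (M * X + M * X) * X + X * X * A + (M - A) * (X * X)
    rearr = solve-∀ ℚ-ring
    expand : ∀ M X a h → a * ((M * h - X) * (M * h - X)) ≡ M * M * (a * (h * h)) + - (M * X + M * X) * (a * h) + X * X * a
    expand = solve-∀ ℚ-ring
    S≡ : S ≡ M * M * Y + - (M * X + M * X) * X + X * X * A
    S≡ = begin
      S ≡⟨ ∑-cong (λ u → expand M X (α u) (h u)) ⟩
      ∑ (λ u → M * M * (α u * (h u * h u)) + - (M * X + M * X) * (α u * h u) + X * X * α u)
        ≡⟨ ∑-+ (λ u → M * M * (α u * (h u * h u)) + - (M * X + M * X) * (α u * h u)) (λ u → X * X * α u) ⟩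
      ∑ (λ u → M * M * (α u * (h u * h u)) + - (M * X + M * X) * (α u * h u)) + ∑ (λ u → X * X * α u)
        ≡⟨ cong (_+ ∑ (λ u → X * X * α u)) (∑-+ (λ u → M * M * (α u * (h u * h u))) (λ u → - (M * X + M * X) * (α u * h u))) ⟩
      ∑ (λ u → M * M * (α u * (h u * h u))) + ∑ (λ u → - (M * X + M * X) * (α u * h u)) + ∑ (λ u → X * X * α u)
        ≡⟨ cong₂ _+_ (cong₂ _+_ (∑-* (M * M) (λ u → α u * (h u * h u))) (∑-* (- (M * X + M * X)) (λ u → α u * h u))) (∑-* (X * X) α) ⟨
      M * M * Y + - (M * X + M * X) * X + X * X * A ∎
      where open ≡-Reasoning

  -- A live vertex of weighted degree D survives with probability p = D / M and its weights are
  -- multiplied by b = M / D; for the other vertices p = b = 1.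
  record Boost (M β : ℚ) (live : Bool) (D : ℚ) : Set where
    field
      b p   : ℚ
      1≤b   : 1ℚ ≤ b
      b≤β   : b ≤ β
      0≤p   : 0ℚ ≤ p
      p≤1   : p ≤ 1ℚ
      pb≡1  : p * b ≡ 1ℚ
      gap≡  : (1ℚ - p) * M ≡ χ live * (M - D)
      full  : live ≡ true → b * D ≡ M
      bD≤M  : b * D ≤ M

  boost : ∀ {M β} live D → 0ℚ < M → 1ℚ ≤ β → D ≤ M → (live ≡ true → M ≤ β * D) → Boost M β live D
  boost {M} {β} false D 0<M 1≤β D≤M low = record
    { b = 1ℚ ; p = 1ℚ ; 1≤b = ≤-refl ; b≤β = 1≤β ; 0≤p = 0≤1 ; p≤1 = ≤-refl ; pb≡1 = *-identityˡ 1ℚ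
    ; gap≡ = rearr M D ; full = λ () ; bD≤M = subst (_≤ M) (sym (*-identityˡ D)) D≤M }
    where
    rearr : ∀ M D → (1ℚ - 1ℚ) * M ≡ 0ℚ * (M - D)
    rearr = solve-∀ ℚ-ring
  boost {M} {β} true D 0<M 1≤β D≤M low = record
    { b = M * i ; p = D * j
    ; 1≤b = *-cancel 0<D (subst₂ _≤_ (sym (*-identityʳ D)) (sym Db≡M) D≤M)
    ; b≤β = *-cancel 0<D (subst₂ _≤_ (sym Db≡M) (*-comm β D) (low refl))
    ; 0≤p = 0≤* (<⇒≤ 0<D) (<⇒≤ 0<j)
    ; p≤1 = subst (D * j ≤_) (trans (*-comm M j) jM≡1) (*-monoˡ (<⇒≤ 0<j) D≤M)
    ; pb≡1 = trans (rearr₁ D j M i) (trans (cong₂ _*_ jM≡1 iD≡1) (*-identityˡ 1ℚ))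
    ; gap≡ = trans (rearr₂ D j M) (trans (cong (λ t → M - D * t) jM≡1) (rearr₃ M D))
    ; full = λ _ → trans (*-comm (M * i) D) Db≡M
    ; bD≤M = ≤-reflexive (trans (*-comm (M * i) D) Db≡M) }
    where
    0<D : 0ℚ < D
    0<D = *-cancel-< (≤-trans 0≤1 1≤β) (subst (_< β * D) (sym (*-zeroʳ β)) (<-≤-trans 0<M (low refl)))
    i = proj₁ (reciprocal 0<D)
    iD≡1 : i * D ≡ 1ℚ
    iD≡1 = proj₂ (proj₂ (reciprocal 0<D))
    j = proj₁ (reciprocal 0<M)
    0<j : 0ℚ < j
    0<j = proj₁ (proj₂ (reciprocal 0<M))
    jM≡1 : j * M ≡ 1ℚ
    jM≡1 = proj₂ (proj₂ (reciprocal 0<M))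
    Db≡M : D * (M * i) ≡ M
    Db≡M = trans (rearr D M i) (trans (cong (M *_) iD≡1) (*-identityʳ M))
      where
      rearr : ∀ D M i → D * (M * i) ≡ M * (i * D)
      rearr = solve-∀ ℚ-ring
    rearr₁ : ∀ D j M i → D * j * (M * i) ≡ j * M * (i * D)
    rearr₁ = solve-∀ ℚ-ring
    rearr₂ : ∀ D j M → (1ℚ - D * j) * M ≡ M - D * (j * M)
    rearr₂ = solve-∀ ℚ-ring
    rearr₃ : ∀ M D → M - D * 1ℚ ≡ 1ℚ * (M - D)
    rearr₃ = solve-∀ ℚ-ring

  -- Scaling weights by c = min(1, M / F), for the sampled degree F with mean T, at both of their ends
  -- makes all degrees at most M; error≤ pays for the scaling with the sampling error.
  record Cap (M : ℚ) (live : Bool) (T F : ℚ) : Set where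
    field
      c      : ℚ
      0≤c    : 0ℚ ≤ c
      c≤1    : c ≤ 1ℚ
      cF≤M   : c * F ≤ M
      error≤ : χ live * ((M - c * F) * (M - c * F)) + M * (F * ((1ℚ - c) * (1ℚ - c))) ≤ (F - T) * (F - T)

  cap : ∀ {M} live T F → 0ℚ < M → T ≤ M → (live ≡ true → T ≡ M) → Cap M live T F
  cap {M} live T F 0<M T≤M full with ≤-total F M
  ... | inj₁ F≤M = record { c = 1ℚ ; 0≤c = 0≤1 ; c≤1 = ≤-refl ; cF≤M = subst (_≤ M) (sym (*-identityˡ F)) F≤M
                          ; error≤ = ≤-trans (≤-reflexive (rearr (χ live) M F)) (bound live full) }
    where
    rearr : ∀ t M F → t * ((M - 1ℚ * F) * (M - 1ℚ * F)) + M * (F * ((1ℚ - 1ℚ) * (1ℚ - 1ℚ))) ≡ t * ((F - M) * (F - M))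
    rearr = solve-∀ ℚ-ring
    bound : ∀ live → (live ≡ true → T ≡ M) → χ live * ((F - M) * (F - M)) ≤ (F - T) * (F - T)
    bound true  full = ≤-reflexive (trans (*-identityˡ _) (cong (λ t → (F - t) * (F - t)) (sym (full refl))))
    bound false full = ≤-trans (≤-reflexive (*-zeroˡ ((F - M) * (F - M)))) (0≤² (F - T))
  -- Now c = M / F, so the first term of `error≤` vanishes and M F (1 - c)² equals c (F - M)². This
  -- is at most (F - T)² because T ≤ M ≤ F.
  ... | inj₂ M≤F = record { c = M * i ; 0≤c = 0≤* 0≤M (<⇒≤ 0<i) ; c≤1 = c≤1 ; cF≤M = ≤-reflexive cF≡M
                          ; error≤ = ≤-trans (≤-from s 0≤s eq) (≤-from ((M - T) * ((F - M) + (F - T))) (0≤* (p≤q⇒0≤q-p T≤M) (0≤+ (p≤q⇒0≤q-p M≤F) (p≤q⇒0≤q-p (≤-trans T≤M M≤F)))) (rearr₂ F T M)) }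
    where
    0≤M = <⇒≤ 0<M
    0<F = <-≤-trans 0<M M≤F
    i = proj₁ (reciprocal 0<F)
    0<i : 0ℚ < i
    0<i = proj₁ (proj₂ (reciprocal 0<F))
    iF≡1 : i * F ≡ 1ℚ
    iF≡1 = proj₂ (proj₂ (reciprocal 0<F))
    c≤1 : M * i ≤ 1ℚ
    c≤1 = subst (M * i ≤_) (trans (*-comm F i) iF≡1) (*-monoˡ (<⇒≤ 0<i) M≤F)
    cF≡M : M * i * F ≡ M
    cF≡M = trans (*-assoc M i F) (trans (cong (M *_) iF≡1) (*-identityʳ M))
    s = (F - M) * (F - M) * (1ℚ - M * i)
    0≤s : 0ℚ ≤ s
    0≤s = 0≤* (0≤² (F - M)) (p≤q⇒0≤q-p c≤1)
    rearr₂ : ∀ F T M → (F - T) * (F - T) - (F - M) * (F - M) ≡ (M - T) * ((F - M) + (F - T))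
    rearr₂ = solve-∀ ℚ-ring
    eq : (F - M) * (F - M) - (χ live * ((M - M * i * F) * (M - M * i * F)) + M * (F * ((1ℚ - M * i) * (1ℚ - M * i)))) ≡ s
    eq = begin
      (F - M) * (F - M) - (χ live * ((M - M * i * F) * (M - M * i * F)) + M * (F * ((1ℚ - M * i) * (1ℚ - M * i))))
        ≡⟨ cong₂ (λ t r → (F - M) * (F - M) - (χ live * ((M - t) * (M - t)) + r)) cF≡M loss ⟩
      (F - M) * (F - M) - (χ live * ((M - M) * (M - M)) + M * i * ((F - M) * (F - M)))
        ≡⟨ rearr (χ live) F M i ⟩
      s ∎
      where
      open ≡-Reasoning
      rearr : ∀ t F M i → (F - M) * (F - M) - (t * ((M - M) * (M - M)) + M * i * ((F - M) * (F - M)))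
            ≡ (F - M) * (F - M) * (1ℚ - M * i)
      rearr = solve-∀ ℚ-ring
      loss : M * (F * ((1ℚ - M * i) * (1ℚ - M * i))) ≡ M * i * ((F - M) * (F - M))
      loss = begin
        M * (F * ((1ℚ - M * i) * (1ℚ - M * i)))             ≡⟨ l₁ M F i ⟩
        M * (1ℚ - M * i) * (F - M * (i * F))                ≡⟨ cong (λ t → M * (1ℚ - M * i) * (F - M * t)) iF≡1 ⟩
        M * (1ℚ - M * i) * (F - M * 1ℚ)                     ≡⟨ cong (λ t → M * (t - M * i) * (F - M * 1ℚ)) (sym iF≡1) ⟩
        M * (i * F - M * i) * (F - M * 1ℚ)                  ≡⟨ l₂ M F i ⟩
        M * i * ((F - M) * (F - M))                         ∎
        where
        l₁ : ∀ M F i → M * (F * ((1ℚ - M * i) * (1ℚ - M * i))) ≡ M * (1ℚ - M * i) * (F - M * (i * F))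
        l₁ = solve-∀ ℚ-ring
        l₂ : ∀ M F i → M * (i * F - M * i) * (F - M * 1ℚ) ≡ M * i * ((F - M) * (F - M))
        l₂ = solve-∀ ℚ-ring

  module RandomStep {n} {e : Fin n → Fin n → Bool} {W M β μ : ℚ} {w : Fin n → Fin n → ℚ} (l : Fin n → Bool)
    (e-irrefl : ∀ v → e v v ≡ false) (0<M : 0ℚ < M) (1≤β : 1ℚ ≤ β) (0≤μ : 0ℚ ≤ μ) (0≤W : 0ℚ ≤ W)
    (weighting : Weighting e W M w) (low : ∀ v → l v ≡ true → M ≤ β * ∑ (w v)) where

    open Weighting weighting

    private
      D : Fin n → ℚ
      D v = ∑ (w v)
      boosts : ∀ v → Boost M β (l v) (D v)
      boosts v = boost (l v) (D v) 0<M 1≤β (row≤ v) (low v)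
      module B v = Boost (boosts v)
      b p T : Fin n → ℚ
      b v = B.b v
      p v = B.p v
      T v = b v * D v
      a : Fin n → Fin n → ℚ
      a v u = b v * b u * w v u
      V = β * β * W
      0≤β = ≤-trans 0≤1 1≤β
      0≤V : 0ℚ ≤ V
      0≤V = 0≤* (0≤* 0≤β 0≤β) 0≤W
      0≤M = <⇒≤ 0<M
      0≤b : ∀ v → 0ℚ ≤ b v
      0≤b v = ≤-trans 0≤1 (B.1≤b v)
      0≤a : ∀ v u → 0ℚ ≤ a v u
      0≤a v u = 0≤* (0≤* (0≤b v) (0≤b u)) (nonneg v u)
      a≤V : ∀ v u → a v u ≤ V
      a≤V v u = *-mono (0≤* (0≤b v) (0≤b u)) 0≤W (*-mono (0≤b v) 0≤β (B.b≤β v) (B.b≤β u)) (bounded v u)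
      a-sym : ∀ v u → a v u ≡ a u v
      a-sym v u = trans (cong (b v * b u *_) (symmetric v u)) (cong (_* w u v) (*-comm (b v) (b u)))
      a-irrefl : ∀ v → a v v ≡ 0ℚ
      a-irrefl v = trans (cong (b v * b v *_) (supported v v (e-irrefl v))) (*-zeroʳ (b v * b v))

      err : Fin n → (Fin n → Bool) → ℚ
      err v = affine (- T v) (a v)
      -- One outcome has to control both the squared errors at surviving vertices and the number of
      -- removed vertices; `μ` sets the price of a removal.
      Φ₁ Φ₂ : (Fin n → Bool) → ℚ
      Φ₁ x = ∑ (λ v → χ (x v) * (err v x * err v x))
      Φ₂ x = ∑ (λ v → M * μ * (1ℚ - χ (x v)))

      -- The boost of `u` cancels its survival probability, so in the mean only the boost of `v`
      -- itself remains.
      mean-err : ∀ v → mean p (- T v) (a v) ≡ 0ℚ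
      mean-err v = trans (cong (- T v +_) (trans (∑-cong inner) (sym (∑-* (b v) (w v))))) (+-inverseˡ (T v))
        where
        rearr : ∀ s t w p → s * t * w * p ≡ s * w * (p * t)
        rearr = solve-∀ ℚ-ring
        inner : ∀ u → a v u * p u ≡ b v * w v u
        inner u = trans (rearr (b v) (b u) (w v u) (p u)) (trans (cong (b v * w v u *_) (B.pb≡1 u)) (*-identityʳ _))

      -- The two boosts in one factor `a v u` cancel the survival probabilities of both ends, which
      -- leaves w v u · a v u ≤ V · w v u. Summing over `v`, the randomness of `u` contributes at
      -- most V · D u · (1 - p u), which is at most V times its gap. So squared errors are bounded
      -- linearly in the gaps.
      E-Φ₁ : E p Φ₁ ≤ V * ∑ (gap M l w)
      E-Φ₁ = begin
        E p Φ₁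
          ≡⟨ E-∑ p (λ v x → χ (x v) * (err v x * err v x)) ⟩
        ∑ (λ v → E p (λ x → χ (x v) * (err v x * err v x)))
          ≡⟨ ∑-cong (λ v → trans (E-χ-affine² p (- T v) (a v) v (a-irrefl v)) (simplify v)) ⟩
        ∑ (λ v → ∑ (λ u → p v * (a v u * a v u * (p u * (1ℚ - p u)))))
          ≤⟨ ∑-mono (λ v → ∑-mono (λ u → pointwise v u)) ⟩
        ∑ (λ v → ∑ (λ u → V * (w v u * (1ℚ - p u))))
          ≡⟨ ∑-swap (λ v u → V * (w v u * (1ℚ - p u))) ⟩
        ∑ (λ u → ∑ (λ v → V * (w v u * (1ℚ - p u))))
          ≡⟨ ∑-cong column ⟩
        ∑ (λ u → V * (D u * (1ℚ - p u)))
          ≤⟨ ∑-mono (λ u → *-monoʳ 0≤V (D≤gap u)) ⟩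
        ∑ (λ u → V * gap M l w u)
          ≡⟨ ∑-* V (gap M l w) ⟨
        V * ∑ (gap M l w) ∎
        where
        open ≤-Reasoning
        0≤1-p : ∀ u → 0ℚ ≤ 1ℚ - p u
        0≤1-p u = p≤q⇒0≤q-p (B.p≤1 u)
        simplify : ∀ v → p v * (mean p (- T v) (a v) * mean p (- T v) (a v) + variance p (a v))
          ≡ ∑ (λ u → p v * (a v u * a v u * (p u * (1ℚ - p u))))
        simplify v = trans (cong (λ m → p v * (m * m + variance p (a v))) (mean-err v))
          (trans (cong (p v *_) (drop (variance p (a v)))) (∑-* (p v) (λ u → a v u * a v u * (p u * (1ℚ - p u)))))
          where
          drop : ∀ s → 0ℚ * 0ℚ + s ≡ s
          drop = solve-∀ ℚ-ring
        rearr : ∀ p q s t w → p * (s * t * w * (s * t * w) * (q * (1ℚ - q))) ≡ (p * s) * (q * t) * (s * t * w * (w * (1ℚ - q)))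
        rearr = solve-∀ ℚ-ring
        ones : ∀ s → 1ℚ * 1ℚ * s ≡ s
        ones = solve-∀ ℚ-ring
        pointwise : ∀ v u → p v * (a v u * a v u * (p u * (1ℚ - p u))) ≤ V * (w v u * (1ℚ - p u))
        pointwise v u = begin
          p v * (a v u * a v u * (p u * (1ℚ - p u)))
            ≡⟨ rearr (p v) (p u) (b v) (b u) (w v u) ⟩
          (p v * b v) * (p u * b u) * (a v u * (w v u * (1ℚ - p u)))
            ≡⟨ cong₂ (λ s t → s * t * (a v u * (w v u * (1ℚ - p u)))) (B.pb≡1 v) (B.pb≡1 u) ⟩
          1ℚ * 1ℚ * (a v u * (w v u * (1ℚ - p u)))
            ≡⟨ ones (a v u * (w v u * (1ℚ - p u))) ⟩
          a v u * (w v u * (1ℚ - p u))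
            ≤⟨ *-monoˡ (0≤* (nonneg v u) (0≤1-p u)) (a≤V v u) ⟩
          V * (w v u * (1ℚ - p u)) ∎
        column : ∀ u → ∑ (λ v → V * (w v u * (1ℚ - p u))) ≡ V * (D u * (1ℚ - p u))
        column u = trans (sym (∑-* V (λ v → w v u * (1ℚ - p u)))) (cong (V *_)
          (trans (sym (∑-*ʳ (1ℚ - p u) (λ v → w v u))) (cong (_* (1ℚ - p u)) (∑-cong (λ v → symmetric v u)))))
        D≤gap : ∀ u → D u * (1ℚ - p u) ≤ gap M l w u
        D≤gap u = ≤-trans (*-monoˡ (0≤1-p u) (row≤ u)) (≤-reflexive (trans (*-comm M (1ℚ - p u)) (B.gap≡ u)))

      -- By `gap≡`, a vertex is removed with probability gap / M.
      E-Φ₂ : E p Φ₂ ≡ μ * ∑ (gap M l w)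
      E-Φ₂ = begin
        E p Φ₂                                    ≡⟨ E-∑ p (λ v x → M * μ * (1ℚ - χ (x v))) ⟩
        ∑ (λ v → E p (λ x → M * μ * (1ℚ - χ (x v))))
          ≡⟨ ∑-cong term ⟩
        ∑ (λ v → μ * gap M l w v)                 ≡⟨ ∑-* μ (gap M l w) ⟨
        μ * ∑ (gap M l w)                         ∎
        where
        open ≡-Reasoning
        split : ∀ k t → k * (1ℚ - t) ≡ k + - k * t
        split = solve-∀ ℚ-ring
        rearr : ∀ M μ p → M * μ + - (M * μ) * p ≡ μ * ((1ℚ - p) * M)
        rearr = solve-∀ ℚ-ring
        term : ∀ v → E p (λ x → M * μ * (1ℚ - χ (x v))) ≡ μ * gap M l w v
        term v = begin
          E p (λ x → M * μ * (1ℚ - χ (x v)))             ≡⟨ E-cong p (λ x → split (M * μ) (χ (x v))) ⟩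
          E p (λ x → M * μ + - (M * μ) * χ (x v))        ≡⟨ E-+ p (λ _ → M * μ) (λ x → - (M * μ) * χ (x v)) ⟩
          E p (λ _ → M * μ) + E p (λ x → - (M * μ) * χ (x v))
            ≡⟨ cong₂ _+_ (E-const p (M * μ)) (trans (E-* p (- (M * μ)) (λ x → χ (x v))) (cong (- (M * μ) *_) (E-χ p v))) ⟩
          M * μ + - (M * μ) * p v                        ≡⟨ rearr M μ (p v) ⟩
          μ * ((1ℚ - p v) * M)                           ≡⟨ cong (μ *_) (B.gap≡ v) ⟩
          μ * gap M l w v ∎

      outcome = E-attained p (λ x → Φ₁ x + Φ₂ x) B.0≤p B.p≤1

    x : Fin n → Bool
    x = proj₁ outcome

    private
      Φ≤ : Φ₁ x + Φ₂ x ≤ (V + μ) * ∑ (gap M l w)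
      Φ≤ = begin
        Φ₁ x + Φ₂ x                                        ≤⟨ proj₂ outcome ⟩
        E p (λ x → Φ₁ x + Φ₂ x)                            ≡⟨ E-+ p Φ₁ Φ₂ ⟩
        E p Φ₁ + E p Φ₂                                    ≤⟨ +-mono-≤ E-Φ₁ (≤-reflexive E-Φ₂) ⟩
        V * ∑ (gap M l w) + μ * ∑ (gap M l w)              ≡⟨ *-distribʳ-+ (∑ (gap M l w)) V μ ⟨
        (V + μ) * ∑ (gap M l w) ∎
        where open ≤-Reasoning

      F : Fin n → ℚ
      F v = ∑ (λ u → a v u * χ (x u))
      caps : ∀ v → Cap M (l v) (T v) (F v)
      caps v = cap (l v) (T v) (F v) 0<M (B.bD≤M v) (B.full v)
      module C v = Cap (caps v)
      c h : Fin n → ℚ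
      c v = C.c v
      h v = 1ℚ - c v

    w′ : Fin n → Fin n → ℚ
    w′ v u = χ (x v) * χ (x u) * (c v * c u * a v u)

    private
      D′≡ : ∀ v → ∑ (w′ v) ≡ χ (x v) * (c v * ∑ (λ u → c u * (a v u * χ (x u))))
      D′≡ v = trans (∑-cong (λ u → rearr (χ (x v)) (χ (x u)) (c v) (c u) (a v u)))
        (trans (sym (∑-* (χ (x v)) (λ u → c v * (c u * (a v u * χ (x u))))))
               (cong (χ (x v) *_) (sym (∑-* (c v) (λ u → c u * (a v u * χ (x u)))))))
        where
        rearr : ∀ s t c d a → s * t * (c * d * a) ≡ s * (c * (d * (a * t)))
        rearr = solve-∀ ℚ-ring

      capped-row : ∀ v → c v * ∑ (λ u → c u * (a v u * χ (x u))) ≤ M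
      capped-row v = ≤-trans (*-monoʳ (C.0≤c v) (∑-mono (λ u → ≤-trans (*-monoˡ (0≤* (0≤a v u) (0≤χ (x u))) (C.c≤1 u)) (≤-reflexive (*-identityˡ _))))) (C.cF≤M v)

      χ*≤M : ∀ b {s} → s ≤ M → χ b * s ≤ M
      χ*≤M true  s≤M = subst (_≤ M) (sym (*-identityˡ _)) s≤M
      χ*≤M false {s} s≤M = subst (_≤ M) (sym (*-zeroˡ s)) 0≤M

    supported′ : ∀ u v → w u v ≡ 0ℚ → w′ u v ≡ 0ℚ
    supported′ u v eq = trans (cong (λ t → χ (x u) * χ (x v) * (c u * c v * (b u * b v * t))) eq) (zero-out (χ (x u)) (χ (x v)) (c u) (c v) (b u) (b v))
      where
      zero-out : ∀ s t c d a b → s * t * (c * d * (a * b * 0ℚ)) ≡ 0ℚ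
      zero-out = solve-∀ ℚ-ring

    weighting′ : Weighting e V M w′
    weighting′ = record
      { symmetric = λ u v → trans (cong (λ t → χ (x u) * χ (x v) * (c u * c v * t)) (a-sym u v)) (rearr (χ (x u)) (χ (x v)) (c u) (c v) (a v u))
      ; nonneg = λ u v → 0≤* (0≤* (0≤χ (x u)) (0≤χ (x v))) (0≤* (0≤* (C.0≤c u) (C.0≤c v)) (0≤a u v))
      ; bounded = λ u v → ≤-trans
          (*-mono (0≤* (0≤χ (x u)) (0≤χ (x v))) 0≤V (*-mono (0≤χ (x u)) 0≤1 (χ≤1 (x u)) (χ≤1 (x v)))
            (≤-trans (*-mono (0≤* (C.0≤c u) (C.0≤c v)) 0≤V (*-mono (C.0≤c u) 0≤1 (C.c≤1 u) (C.c≤1 v)) (a≤V u v)) (≤-reflexive (ones V))))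
          (≤-reflexive (ones V))
      ; supported = λ u v euv → supported′ u v (supported u v euv)
      ; row≤ = λ v → subst (_≤ M) (sym (D′≡ v)) (χ*≤M (x v) (capped-row v))
      }
      where
      rearr : ∀ s t c d a → s * t * (c * d * a) ≡ t * s * (d * c * a)
      rearr = solve-∀ ℚ-ring
      ones : ∀ s → 1ℚ * 1ℚ * s ≡ s
      ones = solve-∀ ℚ-ring

    removed : ∀ u v → x u ≡ false → w′ u v ≡ 0ℚ
    removed u v xu = trans (cong (λ t → χ t * χ (x v) * (c u * c v * a u v)) xu) (zero-out (χ (x v)) (c u * c v * a u v))
      where
      zero-out : ∀ s t → 0ℚ * s * t ≡ 0ℚ
      zero-out = solve-∀ ℚ-ring

    l′ : Fin n → Bool
    l′ v = l v ∧ x v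

    private
      spill : Fin n → ℚ
      spill v = ∑ (λ u → a v u * χ (x u) * (h u * h u))

      -- The new gap at `v` is G + L, where G is what its own sampling and cap leave open and L is
      -- what the caps of its neighbours take away. Then (G + L)² ≤ 2 G² + 2 L², and L² ≤ M ·
      -- `spill` by Cauchy-Schwarz with the weights `α`, whose sum is at most M.
      gap²≤ : ∀ v → gap² M l′ w′ v ≤ (1ℚ + 1ℚ) * (χ (x v) * (χ (l v) * ((M - c v * F v) * (M - c v * F v))))
                                    + (1ℚ + 1ℚ) * (χ (x v) * (M * spill v))
      gap²≤ v = main (l v) (x v) refl refl
        where
        open ≤-Reasoning
        α : Fin n → ℚ
        α u = c v * (a v u * χ (x u))
        0≤ax : ∀ u → 0ℚ ≤ a v u * χ (x u)
        0≤ax u = 0≤* (0≤a v u) (0≤χ (x u))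
        L = ∑ (λ u → α u * h u)
        G = M - c v * F v
        L²≤ : L * L ≤ M * spill v
        L²≤ = ≤-trans (weighted-cauchy M α h 0<M (λ u → 0≤* (C.0≤c v) (0≤ax u))
                        (subst (_≤ M) (∑-* (c v) (λ u → a v u * χ (x u))) (C.cF≤M v)))
                (*-monoʳ 0≤M (∑-mono (λ u → *-monoˡ {q = a v u * χ (x u)} (0≤² (h u)) (≤-trans (*-monoˡ (0≤ax u) (C.c≤1 v)) (≤-reflexive (*-identityˡ (a v u * χ (x u))))))))
        split : c v * F v ≡ c v * ∑ (λ u → c u * (a v u * χ (x u))) + L
        split = trans (cong (c v *_) (trans (∑-cong (λ u → parts (a v u * χ (x u)) (c u))) (∑-+ (λ u → c u * (a v u * χ (x u))) (λ u → (a v u * χ (x u)) * h u))))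
          (trans (*-distribˡ-+ (c v) _ _) (cong (c v * ∑ (λ u → c u * (a v u * χ (x u))) +_)
            (trans (∑-* (c v) (λ u → (a v u * χ (x u)) * h u)) (∑-cong (λ u → sym (*-assoc (c v) (a v u * χ (x u)) (h u)))))))
          where
          parts : ∀ s c → s ≡ c * s + s * (1ℚ - c)
          parts = solve-∀ ℚ-ring
        gap≡ : x v ≡ true → M - ∑ (w′ v) ≡ G + L
        gap≡ xv = trans (cong (λ t → M - t) (trans (D′≡ v) (trans (cong (λ t → χ t * R) xv) (*-identityˡ R))))
          (trans (rearr M R L) (cong (λ t → M - t + L) (sym split)))
          where
          R = c v * ∑ (λ u → c u * (a v u * χ (x u)))
          rearr : ∀ M R L → M - R ≡ M - (R + L) + L
          rearr = solve-∀ ℚ-ring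
        young : ∀ G L → (1ℚ + 1ℚ) * (1ℚ * (1ℚ * (G * G))) + (1ℚ + 1ℚ) * (1ℚ * (L * L)) - 1ℚ * ((G + L) * (G + L)) ≡ (G - L) * (G - L)
        young = solve-∀ ℚ-ring
        0≤2 : 0ℚ ≤ 1ℚ + 1ℚ
        0≤2 = 0≤+ 0≤1 0≤1
        0≤spill : 0ℚ ≤ M * spill v
        0≤spill = ≤-trans (0≤² L) L²≤
        main : ∀ lv xv → l v ≡ lv → x v ≡ xv → χ (lv ∧ xv) * ((M - ∑ (w′ v)) * (M - ∑ (w′ v)))
          ≤ (1ℚ + 1ℚ) * (χ xv * (χ lv * (G * G))) + (1ℚ + 1ℚ) * (χ xv * (M * spill v))
        main true true lv≡ xv≡ = begin
          1ℚ * ((M - ∑ (w′ v)) * (M - ∑ (w′ v)))  ≡⟨ cong (λ t → 1ℚ * (t * t)) (gap≡ xv≡) ⟩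
          1ℚ * ((G + L) * (G + L))                ≤⟨ ≤-from ((G - L) * (G - L)) (0≤² (G - L)) (young G L) ⟩
          (1ℚ + 1ℚ) * (1ℚ * (1ℚ * (G * G))) + (1ℚ + 1ℚ) * (1ℚ * (L * L))
            ≤⟨ +-monoʳ-≤ ((1ℚ + 1ℚ) * (1ℚ * (1ℚ * (G * G)))) (*-monoʳ 0≤2 (*-monoʳ 0≤1 L²≤)) ⟩
          (1ℚ + 1ℚ) * (1ℚ * (1ℚ * (G * G))) + (1ℚ + 1ℚ) * (1ℚ * (M * spill v)) ∎
        main false xv lv≡ xv≡ = ≤-trans (≤-reflexive (*-zeroˡ ((M - ∑ (w′ v)) * (M - ∑ (w′ v)))))
          (0≤+ (0≤* 0≤2 (0≤* (0≤χ xv) (0≤* ≤-refl (0≤² G)))) (0≤* 0≤2 (0≤* (0≤χ xv) 0≤spill)))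
        main true false lv≡ xv≡ = ≤-trans (≤-reflexive (*-zeroˡ ((M - ∑ (w′ v)) * (M - ∑ (w′ v)))))
          (0≤+ (0≤* 0≤2 (0≤* ≤-refl (0≤* 0≤1 (0≤² G)))) (0≤* 0≤2 (0≤* ≤-refl 0≤spill)))

      -- Double counting charges the damage that a cap does to the neighbours back to the capped
      -- vertex, where `error≤` pays for it.
      spill-sum : ∑ (λ v → χ (x v) * (M * spill v)) ≡ ∑ (λ u → χ (x u) * (M * (F u * (h u * h u))))
      spill-sum = begin
        ∑ (λ v → χ (x v) * (M * spill v))
          ≡⟨ ∑-cong (λ v → trans (sym (*-assoc (χ (x v)) M (spill v))) (∑-* (χ (x v) * M) (λ u → a v u * χ (x u) * (h u * h u)))) ⟩
        ∑ (λ v → ∑ (λ u → χ (x v) * M * (a v u * χ (x u) * (h u * h u))))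
          ≡⟨ ∑-swap (λ v u → χ (x v) * M * (a v u * χ (x u) * (h u * h u))) ⟩
        ∑ (λ u → ∑ (λ v → χ (x v) * M * (a v u * χ (x u) * (h u * h u))))
          ≡⟨ ∑-cong (λ u → trans (∑-cong (λ v → trans (cong (λ t → χ (x v) * M * (t * χ (x u) * (h u * h u))) (a-sym v u)) (rearr (χ (x v)) (χ (x u)) M (a u v) (h u))))
                      (trans (sym (∑-* (χ (x u) * M * (h u * h u)) (λ v → a u v * χ (x v)))) (rearr′ (χ (x u)) M (h u) (F u)))) ⟩
        ∑ (λ u → χ (x u) * (M * (F u * (h u * h u)))) ∎
        where
        open ≡-Reasoning
        rearr : ∀ s t M a h → s * M * (a * t * (h * h)) ≡ t * M * (h * h) * (a * s)
        rearr = solve-∀ ℚ-ring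
        rearr′ : ∀ t M h F → t * M * (h * h) * F ≡ t * (M * (F * (h * h)))
        rearr′ = solve-∀ ℚ-ring

      energy : ∑ (gap² M l′ w′) ≤ (1ℚ + 1ℚ) * Φ₁ x
      energy = begin
        ∑ (gap² M l′ w′)
          ≤⟨ ∑-mono gap²≤ ⟩
        ∑ (λ v → (1ℚ + 1ℚ) * g v + (1ℚ + 1ℚ) * (χ (x v) * (M * spill v)))
          ≡⟨ ∑-+ (λ v → (1ℚ + 1ℚ) * g v) (λ v → (1ℚ + 1ℚ) * (χ (x v) * (M * spill v))) ⟩
        ∑ (λ v → (1ℚ + 1ℚ) * g v) + ∑ (λ v → (1ℚ + 1ℚ) * (χ (x v) * (M * spill v)))
          ≡⟨ cong₂ _+_ (∑-* (1ℚ + 1ℚ) g) (∑-* (1ℚ + 1ℚ) (λ v → χ (x v) * (M * spill v))) ⟨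
        (1ℚ + 1ℚ) * ∑ g + (1ℚ + 1ℚ) * ∑ (λ v → χ (x v) * (M * spill v))
          ≡⟨ cong (λ t → (1ℚ + 1ℚ) * ∑ g + (1ℚ + 1ℚ) * t) spill-sum ⟩
        (1ℚ + 1ℚ) * ∑ g + (1ℚ + 1ℚ) * ∑ k
          ≡⟨ *-distribˡ-+ (1ℚ + 1ℚ) (∑ g) (∑ k) ⟨
        (1ℚ + 1ℚ) * (∑ g + ∑ k)
          ≡⟨ cong ((1ℚ + 1ℚ) *_) (∑-+ g k) ⟨
        (1ℚ + 1ℚ) * ∑ (λ v → g v + k v)
          ≤⟨ *-monoʳ (0≤+ 0≤1 0≤1) (∑-mono (λ v → ≤-trans (≤-reflexive (sym (*-distribˡ-+ (χ (x v)) _ _))) (*-monoʳ (0≤χ (x v))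
               (≤-trans (C.error≤ v) (≤-reflexive (cong (λ t → t * t) (+-comm (F v) (- T v)))))))) ⟩
        (1ℚ + 1ℚ) * Φ₁ x ∎
        where
        open ≤-Reasoning
        g k : Fin n → ℚ
        g v = χ (x v) * (χ (l v) * ((M - c v * F v) * (M - c v * F v)))
        k v = χ (x v) * (M * (F v * (h v * h v)))

    -- Squares of the new gaps are bounded by first powers of the old ones, which is where the
    -- square root gain comes from. The loss stays on the left, to be used by each caller according
    -- to its choice of `μ`.
    energy+loss : ∑ (gap² M l′ w′) + dbl (M * μ * ∑ (λ v → 1ℚ - χ (x v))) ≤ dbl ((V + μ) * ∑ (gap M l w))
    energy+loss = begin
      ∑ (gap² M l′ w′) + dbl (M * μ * ∑ (λ v → 1ℚ - χ (x v)))
        ≤⟨ +-mono-≤ energy (≤-reflexive (cong dbl (∑-* (M * μ) (λ v → 1ℚ - χ (x v))))) ⟩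
      (1ℚ + 1ℚ) * Φ₁ x + dbl (Φ₂ x)              ≡⟨ rearr (Φ₁ x) (Φ₂ x) ⟩
      dbl (Φ₁ x + Φ₂ x)                          ≤⟨ +-mono-≤ Φ≤ Φ≤ ⟩
      dbl ((V + μ) * ∑ (gap M l w)) ∎
      where
      open ≤-Reasoning
      rearr : ∀ a b → (1ℚ + 1ℚ) * a + (b + b) ≡ (a + b) + (a + b)
      rearr = solve-∀ ℚ-ring

  -- The invariant of the later rounds and its preservation

  count : ∀ {n} → (Fin n → Bool) → ℚ
  count l = ∑ (λ v → χ (l v))

  0≤count : ∀ {n} (l : Fin n → Bool) → 0ℚ ≤ count l
  0≤count l = ∑-nonneg (λ v → 0≤χ (l v))

  -- Cauchy-Schwarz without a square root: 2 s g ≤ g² + s² at each live vertex, for a given bound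
  -- `s` on the root mean square.
  gap-young : ∀ {n} M (l : Fin n → Bool) w s N → 0ℚ < s → count l ≤ N → ∑ (gap² M l w) ≤ s * s * N → ∑ (gap M l w) ≤ s * N
  gap-young {n} M l w s N 0<s l≤N energy = *-cancel (0<dbl 0<s) (begin
    dbl s * ∑ (gap M l w)
      ≡⟨ ∑-* (dbl s) (gap M l w) ⟩
    ∑ (λ v → dbl s * gap M l w v)
      ≤⟨ ∑-mono (λ v → ≤-from (χ (l v) * ((M - ∑ (w v) - s) * (M - ∑ (w v) - s))) (0≤* (0≤χ (l v)) (0≤² (M - ∑ (w v) - s))) (young (χ (l v)) s (M - ∑ (w v)))) ⟩
    ∑ (λ v → gap² M l w v + s * s * χ (l v))
      ≡⟨ trans (∑-+ (gap² M l w) (λ v → s * s * χ (l v))) (cong (∑ (gap² M l w) +_) (sym (∑-* (s * s) (λ v → χ (l v))))) ⟩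
    ∑ (gap² M l w) + s * s * count l
      ≤⟨ +-mono-≤ energy (*-monoʳ (0≤² s) l≤N) ⟩
    s * s * N + s * s * N
      ≡⟨ rearr s N ⟩
    dbl s * (s * N) ∎)
    where
    open ≤-Reasoning
    young : ∀ t s x → t * (x * x) + s * s * t - (s + s) * (t * x) ≡ t * ((x - s) * (x - s))
    young = solve-∀ ℚ-ring
    rearr : ∀ s N → s * s * N + s * s * N ≡ (s + s) * (s * N)
    rearr = solve-∀ ℚ-ring

  gap²-∧ : ∀ {n} M (l k : Fin n → Bool) w → ∑ (gap² M (λ v → l v ∧ k v) w) ≤ ∑ (gap² M l w)
  gap²-∧ M l k w = ∑-mono (λ v → *-monoˡ (0≤² (M - ∑ (w v))) (χ-∧ (l v) (k v)))

  count-∧ : ∀ {n} (l k : Fin n → Bool) → count (λ v → l v ∧ k v) ≤ count l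
  count-∧ l k = ∑-mono (λ v → χ-∧ (l v) (k v))

  p≤p[1+q]² : ∀ {p q} → 0ℚ ≤ p → 0ℚ ≤ q → p ≤ p * ((1ℚ + q) * (1ℚ + q))
  p≤p[1+q]² {p} {q} 0≤p 0≤q = ≤-from (p * ((q + q) + q * q)) (0≤* 0≤p (0≤+ (0≤dbl 0≤q) (0≤² q))) (rearr p q)
    where
    rearr : ∀ p q → p * ((1ℚ + q) * (1ℚ + q)) - p ≡ p * ((q + q) + q * q)
    rearr = solve-∀ ℚ-ring

  -- Vertices in l are live; those in z are dead, and their weights are no longer boosted; all others
  -- have been removed. The live gaps have mean square at most (ρ t)². Each round halves ρ and t, and
  -- dead≤, total≥ and W≤ are stated so that the geometrically decreasing losses of all later rounds
  -- are already paid for: they only need M² count z, M (count l + count z) and W.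
  record State {n} (e : Fin n → Fin n → Bool) (M N Wₘ Z L ρ t : ℚ) : Set where
    field
      l z       : Fin n → Bool
      w         : Fin n → Fin n → ℚ
      W         : ℚ
      0<W       : 0ℚ < W
      weighting : Weighting e W M w
      W≤        : W * ((1ℚ + quad t) * (1ℚ + quad t)) ≤ Wₘ
      energy    : ∑ (gap² M l w) ≤ (ρ * t) * (ρ * t) * N
      removed   : ∀ u v → l u ≡ false → z u ≡ false → w u v ≡ 0ℚ
      disjoint  : ∀ v → l v ≡ true → z v ≡ false
      live≤     : count l ≤ N
      dead≤     : M * M * count z + dbl (ρ * ρ * N) ≤ Z
      total≥    : L + quad (ρ * t * N) ≤ M * (count l + count z)

  -- One round from (2 ρ, 2 t) to (ρ, t). The gaps add up to at most 4 ρ t N before it, so the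
  -- squared gaps to at most 4 V · 4 ρ t N after it; `s-large` bounds 16 V by ρ t.
  module Advance {n} {e : Fin n → Fin n → Bool} {M N Wₘ Z L ρ t : ℚ}
    (e-irrefl : ∀ v → e v v ≡ false) (0<M : 0ℚ < M) (0≤N : 0ℚ ≤ N)
    (0<t : 0ℚ < t) (t≤⅛ : quad (t + t) ≤ 1ℚ) (0<ρ : 0ℚ < ρ) (s-large : quad (quad Wₘ) ≤ ρ * t)
    (state : State e M N Wₘ Z L (ρ + ρ) (t + t)) where

    open State state

    private
      0≤M = <⇒≤ 0<M
      T = t + t
      P = ρ + ρ
      0<T : 0ℚ < T
      0<T = 0<+ 0<t (<⇒≤ 0<t)
      0<P : 0ℚ < P
      0<P = 0<+ 0<ρ (<⇒≤ 0<ρ)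
      0<1-T : 0ℚ < 1ℚ - T
      0<1-T = subst (0ℚ <_) (rearr T) (0<+ 0<T (0≤+ (p≤q⇒0≤q-p t≤⅛) (0≤dbl (<⇒≤ 0<T))))
        where
        rearr : ∀ T → T + ((1ℚ - ((T + T) + (T + T))) + (T + T)) ≡ 1ℚ - T
        rearr = solve-∀ ℚ-ring
      -- Vertices that remain live have weighted degree at least (1 - T) M, so this bounds their
      -- boosts.
      β = proj₁ (reciprocal 0<1-T)
      0<β : 0ℚ < β
      0<β = proj₁ (proj₂ (reciprocal 0<1-T))
      β-inv : β * (1ℚ - T) ≡ 1ℚ
      β-inv = proj₂ (proj₂ (reciprocal 0<1-T))
      1≤β : 1ℚ ≤ β
      1≤β = ≤-from (β * T) (0≤* (<⇒≤ 0<β) (<⇒≤ 0<T)) (trans (cong (λ o → β - o) (sym β-inv)) (rearr β T))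
        where
        rearr : ∀ β T → β - β * (1ℚ - T) ≡ β * T
        rearr = solve-∀ ℚ-ring
      D : Fin n → ℚ
      D v = ∑ (w v)
      high new l₁ z′ : Fin n → Bool
      high v = ((1ℚ - T) * M) ≤𝔹 D v
      new v = l v ∧ not (high v)
      l₁ v = l v ∧ high v
      z′ v = z v ∨ new v
      high-sound : ∀ v → l₁ v ≡ true → M ≤ β * D v
      high-sound v eq = subst (_≤ β * D v)
        (trans (sym (*-assoc β (1ℚ - T) M)) (trans (cong (_* M) β-inv) (*-identityˡ M)))
        (*-monoʳ (<⇒≤ 0<β) (≤𝔹-true (∧-trueʳ (l v) eq)))
        where
        ∧-trueʳ : ∀ a {b} → a ∧ b ≡ true → b ≡ true
        ∧-trueʳ true eq = eq

      -- Chebyshev's inequality: each newly dead vertex has a gap of at least T M.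
      new-count : M * M * count new ≤ P * P * N
      new-count = *-cancel (0<* 0<T 0<T) (begin
        T * T * (M * M * count new)                ≡⟨ rearr₁ T M (count new) ⟩
        (T * M) * (T * M) * count new              ≡⟨ ∑-* ((T * M) * (T * M)) (λ v → χ (new v)) ⟩
        ∑ (λ v → (T * M) * (T * M) * χ (new v))    ≤⟨ ∑-mono pointwise ⟩
        ∑ (gap² M l w)                             ≤⟨ energy ⟩
        (P * T) * (P * T) * N                      ≡⟨ rearr₂ P T N ⟩
        T * T * (P * P * N)                        ∎)
        where
        open ≤-Reasoning
        rearr₁ : ∀ T M c → T * T * (M * M * c) ≡ (T * M) * (T * M) * c
        rearr₁ = solve-∀ ℚ-ring
        rearr₂ : ∀ P T N → (P * T) * (P * T) * N ≡ T * T * (P * P * N)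
        rearr₂ = solve-∀ ℚ-ring
        0≤TM : 0ℚ ≤ T * M
        0≤TM = 0≤* (<⇒≤ 0<T) 0≤M
        case : ∀ lv hv d → (hv ≡ false → d ≤ (1ℚ - T) * M) → (T * M) * (T * M) * χ (lv ∧ not hv) ≤ χ lv * ((M - d) * (M - d))
        case false hv   d h = ≤-reflexive (trans (*-zeroʳ ((T * M) * (T * M))) (sym (*-zeroˡ ((M - d) * (M - d)))))
        case true true  d h = subst₂ _≤_ (sym (*-zeroʳ ((T * M) * (T * M)))) (sym (*-identityˡ ((M - d) * (M - d)))) (0≤² (M - d))
        case true false d h = subst₂ _≤_ (sym (*-identityʳ _)) (sym (*-identityˡ _)) (*-mono 0≤TM (≤-trans 0≤TM TM≤) TM≤ TM≤)
          where
          TM≤ : T * M ≤ M - d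
          TM≤ = ≤-from ((1ℚ - T) * M - d) (p≤q⇒0≤q-p (h refl)) (rearr T M d)
            where
            rearr : ∀ T M D → M - D - T * M ≡ (1ℚ - T) * M - D
            rearr = solve-∀ ℚ-ring
        pointwise : ∀ v → (T * M) * (T * M) * χ (new v) ≤ gap² M l w v
        pointwise v = case (l v) (high v) (D v) ≤𝔹-false

      V = β * β * W
      0<V : 0ℚ < V
      0<V = 0<* (0<* 0<β 0<β) 0<W
      -- The price `V` makes the error and removal parts of the mean cost equally large; the bound
      -- on the loss then no longer involves `V`.
      open RandomStep {β = β} {μ = V} l₁ e-irrefl 0<M 1≤β (<⇒≤ 0<V) (<⇒≤ 0<W) weighting high-sound
        renaming (removed to removed-x)
      G = ∑ (gap M l₁ w)
      loss = ∑ (λ v → 1ℚ - χ (x v))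
      s = P * T
      0<s : 0ℚ < s
      0<s = 0<* 0<P 0<T
      G≤ : G ≤ s * N
      G≤ = gap-young M l₁ w s N 0<s (≤-trans (count-∧ l high) live≤) (≤-trans (gap²-∧ M l high w) energy)
      0≤loss : 0ℚ ≤ loss
      0≤loss = ∑-nonneg (λ v → 0≤1-χ (x v))
      0≤gap² : 0ℚ ≤ ∑ (gap² M l′ w′)
      0≤gap² = ∑-nonneg (λ v → 0≤* (0≤χ (l′ v)) (0≤² (M - ∑ (w′ v))))
      -- Boosting both ends costs a factor 1 / (1 - T)². It is absorbed by halving T inside the
      -- square, as (1 + 4 T)(1 - T) ≥ 1 + 2 T for T ≤ 1/4.
      W′≤ : V * ((1ℚ + quad t) * (1ℚ + quad t)) ≤ Wₘ
      W′≤ = ≤-trans (≤-trans (*-monoʳ (<⇒≤ 0<V) (*-mono 0≤a (≤-trans 0≤a a≤b) a≤b a≤b)) (≤-reflexive eq)) W≤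
        where
        a = 1ℚ + quad t
        B = (1ℚ + quad T) * (1ℚ - T)
        0≤a : 0ℚ ≤ a
        0≤a = 0≤+ 0≤1 (0≤quad (<⇒≤ 0<t))
        rearr : ∀ t → (1ℚ + (((t + t) + (t + t)) + ((t + t) + (t + t)))) * (1ℚ - (t + t)) - (1ℚ + ((t + t) + (t + t)))
              ≡ (t + t) * (1ℚ - (((t + t) + (t + t)) + ((t + t) + (t + t))))
        rearr = solve-∀ ℚ-ring
        a≤b : a ≤ B
        a≤b = ≤-from (T * (1ℚ - quad T)) (0≤* (<⇒≤ 0<T) (p≤q⇒0≤q-p t≤⅛)) (rearr t)
        eq : V * (B * B) ≡ W * ((1ℚ + quad T) * (1ℚ + quad T))
        eq = trans (rearr₁ β W (1ℚ + quad T) (1ℚ - T)) (trans (cong (λ r → r * r * (W * ((1ℚ + quad T) * (1ℚ + quad T)))) β-inv) (rearr₂ (W * ((1ℚ + quad T) * (1ℚ + quad T)))))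
          where
          rearr₁ : ∀ β W f r → β * β * W * (f * r * (f * r)) ≡ (β * r) * (β * r) * (W * (f * f))
          rearr₁ = solve-∀ ℚ-ring
          rearr₂ : ∀ s → 1ℚ * 1ℚ * s ≡ s
          rearr₂ = solve-∀ ℚ-ring
      V≤Wₘ : V ≤ Wₘ
      V≤Wₘ = ≤-trans (p≤p[1+q]² (<⇒≤ 0<V) (0≤quad (<⇒≤ 0<t))) W′≤
      energy′ : ∑ (gap² M l′ w′) ≤ (ρ * t) * (ρ * t) * N
      energy′ = begin
        ∑ (gap² M l′ w′)
          ≤⟨ p≤p+q (0≤dbl (0≤* (0≤* 0≤M (<⇒≤ 0<V)) 0≤loss)) ⟩
        ∑ (gap² M l′ w′) + dbl (M * V * loss)
          ≤⟨ energy+loss ⟩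
        dbl ((V + V) * G)
          ≤⟨ dbl-mono (*-monoʳ (<⇒≤ (0<dbl 0<V)) G≤) ⟩
        dbl ((V + V) * (s * N))
          ≡⟨ rearr V ρ t N ⟩
        quad (quad V) * (ρ * t * N)
          ≤⟨ *-monoˡ (0≤* 0≤ρt 0≤N) (≤-trans (dbl-mono (dbl-mono (dbl-mono (dbl-mono V≤Wₘ)))) s-large) ⟩
        (ρ * t) * (ρ * t * N)
          ≡⟨ *-assoc (ρ * t) (ρ * t) N ⟨
        (ρ * t) * (ρ * t) * N ∎
        where
        open ≤-Reasoning
        0≤ρt = <⇒≤ (0<* 0<ρ 0<t)
        rearr : ∀ V ρ t N → (V + V) * ((ρ + ρ) * (t + t) * N) + (V + V) * ((ρ + ρ) * (t + t) * N)
          ≡ ((((V + V) + (V + V)) + ((V + V) + (V + V))) + (((V + V) + (V + V)) + ((V + V) + (V + V)))) * (ρ * t * N)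
        rearr = solve-∀ ℚ-ring
      loss≤ : M * loss ≤ dbl (s * N)
      loss≤ = ≤-trans (*-cancel (0<dbl 0<V) (begin
        dbl V * (M * loss)                    ≡⟨ rearr₁ V M loss ⟩
        dbl (M * V * loss)                    ≤⟨ p≤q+p 0≤gap² ⟩
        ∑ (gap² M l′ w′) + dbl (M * V * loss) ≤⟨ energy+loss ⟩
        dbl ((V + V) * G)                      ≡⟨ rearr₂ V G ⟩
        dbl V * dbl G                          ∎)) (dbl-mono G≤)
        where
        open ≤-Reasoning
        rearr₁ : ∀ V M r → (V + V) * (M * r) ≡ M * V * r + M * V * r
        rearr₁ = solve-∀ ℚ-ring
        rearr₂ : ∀ V G → (V + V) * G + (V + V) * G ≡ (V + V) * (G + G)
        rearr₂ = solve-∀ ℚ-ring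

      count-split : count l + count z ≤ (count l′ + count z′) + loss
      count-split = begin
        count l + count z                                          ≡⟨ ∑-+ (λ v → χ (l v)) (λ v → χ (z v)) ⟨
        ∑ (λ v → χ (l v) + χ (z v))                                ≤⟨ ∑-mono (λ v → pointwise (l v) (z v) (high v) (x v) (disjoint v)) ⟩
        ∑ (λ v → (χ (l′ v) + χ (z′ v)) + (1ℚ - χ (x v)))           ≡⟨ ∑-+ (λ v → χ (l′ v) + χ (z′ v)) (λ v → 1ℚ - χ (x v)) ⟩
        ∑ (λ v → χ (l′ v) + χ (z′ v)) + loss                       ≡⟨ cong (_+ loss) (∑-+ (λ v → χ (l′ v)) (λ v → χ (z′ v))) ⟩
        (count l′ + count z′) + loss ∎
        where
        open ≤-Reasoning
        pointwise : ∀ l z h x → (l ≡ true → z ≡ false) → χ l + χ z ≤ (χ ((l ∧ h) ∧ x) + χ (z ∨ (l ∧ not h))) + (1ℚ - χ x)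
        pointwise false false h x     d = ≤-from (1ℚ - χ x) (0≤1-χ x) (rearr (χ x))
          where
          rearr : ∀ s → (0ℚ + 0ℚ) + (1ℚ - s) - (0ℚ + 0ℚ) ≡ 1ℚ - s
          rearr = solve-∀ ℚ-ring
        pointwise false true  h x     d = ≤-from (1ℚ - χ x) (0≤1-χ x) (rearr (χ x))
          where
          rearr : ∀ s → (0ℚ + 1ℚ) + (1ℚ - s) - (0ℚ + 1ℚ) ≡ 1ℚ - s
          rearr = solve-∀ ℚ-ring
        pointwise true  true  h x     d with () ← d refl
        pointwise true  false true  x d = ≤-reflexive (rearr (χ x))
          where
          rearr : ∀ s → 1ℚ + 0ℚ ≡ (s + 0ℚ) + (1ℚ - s)
          rearr = solve-∀ ℚ-ring
        pointwise true  false false x d = ≤-from (1ℚ - χ x) (0≤1-χ x) (rearr (χ x))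
          where
          rearr : ∀ s → (0ℚ + 1ℚ) + (1ℚ - s) - (1ℚ + 0ℚ) ≡ 1ℚ - s
          rearr = solve-∀ ℚ-ring

    next : State e M N Wₘ Z L ρ t
    next = record
      { l = l′ ; z = z′ ; w = w′ ; W = V ; 0<W = 0<V ; weighting = weighting′ ; W≤ = W′≤ ; energy = energy′
      ; removed = removed′
      ; disjoint = disjoint′
      ; live≤ = ≤-trans (count-∧ l₁ x) (≤-trans (count-∧ l high) live≤)
      ; dead≤ = dead′≤
      ; total≥ = total′≥
      }
      where
      open ≤-Reasoning
      removed′ : ∀ u v → l′ u ≡ false → z′ u ≡ false → w′ u v ≡ 0ℚ
      removed′ u v = case (l u) (z u) (high u) (x u) refl refl refl
        where
        case : ∀ a b c d → l u ≡ a → z u ≡ b → x u ≡ d → (a ∧ c) ∧ d ≡ false → b ∨ (a ∧ not c) ≡ false → w′ u v ≡ 0ℚ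
        case false false c     d     lu zu xu _  _ = supported′ u v (removed u v lu zu)
        case true  b     true  false lu zu xu _  _ = removed-x u v xu
        case true  false false d     lu zu xu _  ()
        case true  true  false d     lu zu xu _  ()
        case true  b     true  true  lu zu xu () _
        case false true  c     d     lu zu xu _  ()
      disjoint′ : ∀ v → l′ v ≡ true → z′ v ≡ false
      disjoint′ v = case (l v) (z v) (high v) (x v) (disjoint v)
        where
        case : ∀ a b c d → (a ≡ true → b ≡ false) → (a ∧ c) ∧ d ≡ true → b ∨ (a ∧ not c) ≡ false
        case true false true true h _ = refl
        case true true  true true h _ with () ← h refl
      χ-∨ : ∀ a b → χ (a ∨ b) ≤ χ a + χ b
      χ-∨ false b = ≤-reflexive (sym (+-identityˡ (χ b)))
      χ-∨ true  b = p≤p+q (0≤χ b)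
      -- The old reserve is 8 ρ² N: at most 4 ρ² N goes to the newly dead vertices, and 2 ρ² N is
      -- the next reserve.
      dead′≤ : M * M * count z′ + dbl (ρ * ρ * N) ≤ Z
      dead′≤ = begin
        M * M * count z′ + dbl (ρ * ρ * N)
          ≤⟨ +-monoˡ-≤ (dbl (ρ * ρ * N)) (*-monoʳ (0≤² M) (≤-trans (∑-mono (λ v → χ-∨ (z v) (new v))) (≤-reflexive (∑-+ (λ v → χ (z v)) (λ v → χ (new v)))))) ⟩
        M * M * (count z + count new) + dbl (ρ * ρ * N)
          ≤⟨ ≤-from ((P * P * N - M * M * count new) + dbl (ρ * ρ * N)) (0≤+ (p≤q⇒0≤q-p new-count) (0≤dbl (0≤* (0≤² ρ) 0≤N))) (rearr M (count z) (count new) ρ N) ⟩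
        M * M * count z + dbl (P * P * N)
          ≤⟨ dead≤ ⟩
        Z ∎
        where
        rearr : ∀ M z c ρ N → M * M * z + ((ρ + ρ) * (ρ + ρ) * N + (ρ + ρ) * (ρ + ρ) * N) - (M * M * (z + c) + (ρ * ρ * N + ρ * ρ * N))
              ≡ ((ρ + ρ) * (ρ + ρ) * N - M * M * c) + (ρ * ρ * N + ρ * ρ * N)
        rearr = solve-∀ ℚ-ring
      -- The old reserve is 16 ρ t N: at most 8 ρ t N pays for the removed vertices, and 4 ρ t N is
      -- the next reserve.
      total′≥ : L + quad (ρ * t * N) ≤ M * (count l′ + count z′)
      total′≥ = ≤-from ((M * ((count l′ + count z′) + loss) - M * (count l + count z)) + ((M * (count l + count z) - (L + quad (P * T * N)))
                  + ((dbl (s * N) - M * loss) + quad (ρ * t * N))))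
        (0≤+ (p≤q⇒0≤q-p (*-monoʳ 0≤M count-split)) (0≤+ (p≤q⇒0≤q-p total≥) (0≤+ (p≤q⇒0≤q-p loss≤) (0≤quad (0≤* (<⇒≤ (0<* 0<ρ 0<t)) 0≤N)))))
        (rearr M (count l′ + count z′) loss (count l + count z) L ρ t N)
        where
        rearr : ∀ M c′ r c L ρ t N → let q = ρ * t * N + ρ * t * N ; p = (ρ + ρ) * (t + t) * N in
          M * c′ - (L + (q + q))
          ≡ (M * (c′ + r) - M * c) + ((M * c - (L + ((p + p) + (p + p)))) + (((p + p) - M * r) + (q + q)))
        rearr = solve-∀ ℚ-ring

  -- A ladder whose rungs grow at most 16-fold has a rung in [R, 16 R]. This chooses the number of
  -- rounds without logarithms or square roots.
  window : (g : ℕ → ℚ) → (∀ k → g (suc k) ≤ ι 16 * g k) → ∀ R K → 0ℚ ≤ R → g 0 ≤ R → R ≤ g K →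
    ∃[ k ] R ≤ g k × g k ≤ ι 16 * R
  window g ratio R zero 0≤R g0≤R R≤gK = 0 , R≤gK , ≤-trans g0≤R (subst (_≤ ι 16 * R) (*-identityˡ R) (*-monoˡ 0≤R (1≤ι {16} (ℕ.s≤s ℕ.z≤n))))
  window g ratio R (suc K) 0≤R g0≤R R≤gK with ≤-total R (g K)
  ... | inj₁ R≤ = window g ratio R K 0≤R g0≤R R≤
  ... | inj₂ ≤R = suc K , R≤gK , ≤-trans (ratio K) (*-monoʳ (0≤ι 16) ≤R)

  opaque
    unfolding ι

    archimedean : ∀ p → ∃[ m ] p ≤ ι m
    archimedean p = m , toℚᵘ-cancel-≤ (ℚᵘₚ.≤-respʳ-≃ (ℚᵘₚ.≃-sym (ι-toℚᵘ m)) (bound p))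
      where
      m : ℕ
      m = ℤ.∣ ↥ p ∣
      bound : ∀ p → toℚᵘ p ℚᵘ.≤ mkℚᵘ (ℤ.+ ℤ.∣ ↥ p ∣) 0
      bound (mkℚ (ℤ.+ k) d _)    = ℚᵘ.*≤* (ℤₚ.*-monoˡ-≤-nonNeg (ℤ.+ k) (ℤ.+≤+ (ℕ.s≤s ℕ.z≤n)))
      bound (mkℚ ℤ.-[1+ k ] d _) = ℚᵘ.*≤* ℤ.-≤+

  sqrt-mono : ∀ {p q} → 0ℚ ≤ q → p * p ≤ q * q → p ≤ q
  sqrt-mono {p} {q} 0≤q pp≤qq = ≮⇒≥ λ q<p → <-irrefl refl (<-≤-trans (qq<pp q<p) pp≤qq)
    where
    qq<pp : q < p → q * q < p * p
    qq<pp q<p = <-from ((p - q) * (p - q) + (q + q) * (p - q)) (0<+ (0<* (p<q⇒0<q-p q<p) (p<q⇒0<q-p q<p)) (0≤* (0≤dbl 0≤q) (<⇒≤ (p<q⇒0<q-p q<p)))) (rearr p q)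
      where
      rearr : ∀ p q → p * p - q * q ≡ (p - q) * (p - q) + (q + q) * (p - q)
      rearr = solve-∀ ℚ-ring

  2^ : ℕ → ℚ
  2^ zero    = 1ℚ
  2^ (suc k) = dbl (2^ k)

  0<2^ : ∀ k → 0ℚ < 2^ k
  0<2^ zero    = 0<1
  0<2^ (suc k) = 0<dbl (0<2^ k)

  1≤2^ : ∀ k → 1ℚ ≤ 2^ k
  1≤2^ zero    = ≤-refl
  1≤2^ (suc k) = ≤-trans (1≤2^ k) (p≤p+q (<⇒≤ (0<2^ k)))

  1+ι≤2^ : ∀ k → 1ℚ + ι k ≤ 2^ k
  1+ι≤2^ zero    = ≤-reflexive (trans (cong (1ℚ +_) ι-0) (+-identityʳ 1ℚ))
  1+ι≤2^ (suc k) = ≤-trans (≤-reflexive (cong (1ℚ +_) (ι-suc k))) (+-mono-≤ (1≤2^ k) (1+ι≤2^ k))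

  module _ {n} {e : Fin n → Fin n → Bool} {M N Wₘ Z L : ℚ}
    (e-irrefl : ∀ v → e v v ≡ false) (0<M : 0ℚ < M) (0≤N : 0ℚ ≤ N) where

    -- The upper bound on `t` is tightest in the first round and the lower bound on `ρ * t` in the
    -- last, so these two instances suffice.
    iterate : ∀ k {ρ t} → 0ℚ < ρ → 0ℚ < t → quad (2^ k * t) ≤ 1ℚ → quad (quad Wₘ) ≤ ρ * t →
      State e M N Wₘ Z L (2^ k * ρ) (2^ k * t) → State e M N Wₘ Z L ρ t
    iterate zero {ρ} {t} 0<ρ 0<t t≤ s≥ state = subst₂ (State e M N Wₘ Z L) (*-identityˡ ρ) (*-identityˡ t) state
    iterate (suc k) {ρ} {t} 0<ρ 0<t t≤ s≥ state = iterate k 0<ρ 0<t t≤′ s≥ (Advance.next e-irrefl 0<M 0≤N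
        (0<* (0<2^ k) 0<t) (subst (λ x → quad x ≤ 1ℚ) (*-distribʳ-+ t (2^ k) (2^ k)) t≤) (0<* (0<2^ k) 0<ρ) s≥′
        (subst₂ (State e M N Wₘ Z L) (*-distribʳ-+ ρ (2^ k) (2^ k)) (*-distribʳ-+ t (2^ k) (2^ k)) state))
      where
      2^t≤ : 2^ k * t ≤ dbl (2^ k) * t
      2^t≤ = *-monoˡ {p = 2^ k} {q = dbl (2^ k)} (<⇒≤ 0<t) (p≤p+q (<⇒≤ (0<2^ k)))
      t≤′ : quad (2^ k * t) ≤ 1ℚ
      t≤′ = ≤-trans (dbl-mono (dbl-mono 2^t≤)) t≤
      s≥′ : quad (quad Wₘ) ≤ (2^ k * ρ) * (2^ k * t)
      s≥′ = ≤-trans s≥ (*-mono (<⇒≤ 0<ρ) (<⇒≤ (0<* (0<2^ k) 0<t)) (grow 0<ρ) (grow 0<t))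
        where
        grow : ∀ {x} → 0ℚ < x → x ≤ 2^ k * x
        grow {x} 0<x = subst (_≤ 2^ k * x) (*-identityˡ x) (*-monoˡ (<⇒≤ 0<x) (1≤2^ k))

  -- Near-regular weightings and the deletion of dead vertices

  record NearRegular {n} (e : Fin n → Fin n → Bool) (W M H : ℚ) : Set where
    field
      l         : Fin n → Bool
      w         : Fin n → Fin n → ℚ
      weighting : Weighting e W M w
      inside    : ∀ u v → l u ≡ false → w u v ≡ 0ℚ
      nonempty  : 0ℚ < count l
      deficit   : ∑ (gap M l w) ≤ H * count l

  module DropDead {n} {e : Fin n → Fin n → Bool} {M N Wₘ Z L ρ t : ℚ} (0<M : 0ℚ < M) (state : State e M N Wₘ Z L ρ t) where
    open State state
    open Weighting weighting

    w° : Fin n → Fin n → ℚ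
    w° u v = χ (l u) * χ (l v) * w u v

    private
      0≤M = <⇒≤ 0<M
      w°≤w : ∀ u v → w° u v ≤ w u v
      w°≤w u v = ≤-trans (≤-reflexive (*-assoc (χ (l u)) (χ (l v)) (w u v))) (≤-trans (χ*≤ (l u) (0≤* (0≤χ (l v)) (nonneg u v))) (χ*≤ (l v) (nonneg u v)))

    weighting° : Weighting e W M w°
    weighting° = record
      { symmetric = λ u v → cong₂ _*_ (*-comm (χ (l u)) (χ (l v))) (symmetric u v)
      ; nonneg = λ u v → 0≤* (0≤* (0≤χ (l u)) (0≤χ (l v))) (nonneg u v)
      ; bounded = λ u v → ≤-trans (w°≤w u v) (bounded u v)
      ; supported = λ u v euv → trans (cong (χ (l u) * χ (l v) *_) (supported u v euv)) (*-zeroʳ (χ (l u) * χ (l v)))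
      ; row≤ = λ v → ≤-trans (∑-mono (w°≤w v)) (row≤ v)
      }

    inside° : ∀ u v → l u ≡ false → w° u v ≡ 0ℚ
    inside° u v lu = trans (cong (λ b → χ b * χ (l v) * w u v) lu) (rearr (χ (l v)) (w u v))
      where
      rearr : ∀ s t → 0ℚ * s * t ≡ 0ℚ
      rearr = solve-∀ ℚ-ring

    -- A dead vertex takes from the live ones at most its own weighted degree, hence at most `M`; a
    -- removed vertex has no weight to take away.
    deficit° : ∑ (gap M l w°) ≤ ∑ (gap M l w) + M * count z
    deficit° = begin
      ∑ (gap M l w°)
        ≤⟨ ∑-mono pointwise ⟩
      ∑ (λ v → gap M l w v + lost v)
        ≡⟨ ∑-+ (gap M l w) lost ⟩
      ∑ (gap M l w) + ∑ lost
        ≡⟨ cong (∑ (gap M l w) +_) (trans (∑-swap (λ v u → (1ℚ - χ (l u)) * w v u))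
             (∑-cong (λ u → trans (sym (∑-* (1ℚ - χ (l u)) (λ v → w v u))) (cong ((1ℚ - χ (l u)) *_) (∑-cong (λ v → symmetric v u)))))) ⟩
      ∑ (gap M l w) + ∑ (λ u → (1ℚ - χ (l u)) * ∑ (w u))
        ≤⟨ +-monoʳ-≤ (∑ (gap M l w)) (∑-mono (λ u → dead (l u) (z u) (∑ (w u)) (row≤ u) (λ lu zu → ∑-0 (λ v → removed u v lu zu)))) ⟩
      ∑ (gap M l w) + ∑ (λ u → M * χ (z u))
        ≡⟨ cong (∑ (gap M l w) +_) (sym (∑-* M (λ u → χ (z u)))) ⟩
      ∑ (gap M l w) + M * count z ∎
      where
      open ≤-Reasoning
      lost : Fin n → ℚ
      lost v = ∑ (λ u → (1ℚ - χ (l u)) * w v u)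
      pointwise : ∀ v → gap M l w° v ≤ gap M l w v + lost v
      pointwise v = case (l v) refl
        where
        row : l v ≡ true → ∑ (w v) ≡ ∑ (w° v) + lost v
        row lv = trans (∑-cong (λ u → trans (rearr (χ (l u)) (w v u)) (cong (λ b → χ b * χ (l u) * w v u + (1ℚ - χ (l u)) * w v u) (sym lv))))
                       (∑-+ (w° v) (λ u → (1ℚ - χ (l u)) * w v u))
          where
          rearr : ∀ s w → w ≡ 1ℚ * s * w + (1ℚ - s) * w
          rearr = solve-∀ ℚ-ring
        case : ∀ b → l v ≡ b → χ b * (M - ∑ (w° v)) ≤ χ b * (M - ∑ (w v)) + lost v
        case true lv = ≤-reflexive (trans (rearr M (∑ (w° v)) (lost v)) (cong (λ d → 1ℚ * (M - d) + lost v) (sym (row lv))))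
          where
          rearr : ∀ M d r → 1ℚ * (M - d) ≡ 1ℚ * (M - (d + r)) + r
          rearr = solve-∀ ℚ-ring
        case false lv = ≤-from (lost v) (∑-nonneg (λ u → 0≤* (0≤1-χ (l u)) (nonneg v u))) (rearr (M - ∑ (w° v)) (M - ∑ (w v)) (lost v))
          where
          rearr : ∀ a b r → 0ℚ * b + r - 0ℚ * a ≡ r
          rearr = solve-∀ ℚ-ring
      dead : ∀ b c d → d ≤ M → (b ≡ false → c ≡ false → d ≡ 0ℚ) → (1ℚ - χ b) * d ≤ M * χ c
      dead true  c     d d≤M h = ≤-trans (≤-reflexive (rearr d)) (0≤* 0≤M (0≤χ c))
        where
        rearr : ∀ d → (1ℚ - 1ℚ) * d ≡ 0ℚ
        rearr = solve-∀ ℚ-ring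
      dead false true  d d≤M h = subst₂ _≤_ (rearr d) (sym (*-identityʳ M)) d≤M
        where
        rearr : ∀ d → d ≡ (1ℚ - 0ℚ) * d
        rearr = solve-∀ ℚ-ring
      dead false false d d≤M h = ≤-reflexive (trans (cong ((1ℚ - 0ℚ) *_) (h refl refl)) (rearr M))
        where
        rearr : ∀ M → (1ℚ - 0ℚ) * 0ℚ ≡ M * 0ℚ
        rearr = solve-∀ ℚ-ring

  -- The first round, and the choice of parameters for the others

  module FirstRound {n} {e : Fin n → Fin n → Bool} {M β : ℚ} {w₀ : Fin n → Fin n → ℚ} (l₀ : Fin n → Bool)
    (e-irrefl : ∀ v → e v v ≡ false) (0<M : 0ℚ < M) (1≤β : 1ℚ ≤ β) (weighting₀ : Weighting e 1ℚ M w₀)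
    (low : ∀ v → l₀ v ≡ true → M ≤ β * ∑ (w₀ v)) (off : ∀ u v → l₀ u ≡ false → w₀ u v ≡ 0ℚ)
    (0<N₀ : 0ℚ < count l₀) where

    V = β * β * 1ℚ
    B = β * V

    0<β : 0ℚ < β
    0<β = <-≤-trans 0<1 1≤β

    1≤V : 1ℚ ≤ V
    1≤V = ≤-trans (≤-reflexive (rearr 1ℚ)) (*-mono (0≤* 0≤1 0≤1) 0≤1 (*-mono 0≤1 (<⇒≤ 0<β) 1≤β 1≤β) ≤-refl)
      where
      rearr : ∀ s → s ≡ 1ℚ * 1ℚ * s
      rearr = solve-∀ ℚ-ring

    0<V : 0ℚ < V
    0<V = <-≤-trans 0<1 1≤V

    0<B : 0ℚ < B
    0<B = 0<* 0<β 0<V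

    private
      0≤M = <⇒≤ 0<M
      -- Gaps may still be a constant fraction of M here, and so may the proportion of lost
      -- vertices. The price is high enough for the loss term to yield a lower bound on the
      -- survivors.
      module R = RandomStep {β = β} {μ = dbl B} l₀ e-irrefl 0<M 1≤β (<⇒≤ (0<dbl 0<B)) 0≤1 weighting₀ low
      G = ∑ (gap M l₀ w₀)
      N₀ = count l₀
      Q = ∑ (gap² M R.l′ R.w′)
      loss = ∑ (λ v → 1ℚ - χ (R.x v))

    N : ℚ
    N = count R.l′

    private
      βG≤ : β * G ≤ (β - 1ℚ) * M * N₀
      βG≤ = begin
        β * G                                       ≡⟨ ∑-* β (gap M l₀ w₀) ⟩
        ∑ (λ v → β * gap M l₀ w₀ v)                 ≤⟨ ∑-mono (λ v → case (l₀ v) (∑ (w₀ v)) (low v)) ⟩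
        ∑ (λ v → (β - 1ℚ) * M * χ (l₀ v))           ≡⟨ ∑-* ((β - 1ℚ) * M) (λ v → χ (l₀ v)) ⟨
        (β - 1ℚ) * M * N₀                           ∎
        where
        open ≤-Reasoning
        case : ∀ b d → (b ≡ true → M ≤ β * d) → β * (χ b * (M - d)) ≤ (β - 1ℚ) * M * χ b
        case true d h = ≤-from (β * d - M) (p≤q⇒0≤q-p (h refl)) (rearr β M d)
          where
          rearr : ∀ β M d → (β - 1ℚ) * M * 1ℚ - β * (1ℚ * (M - d)) ≡ β * d - M
          rearr = solve-∀ ℚ-ring
        case false d h = ≤-reflexive (rearr β M d)
          where
          rearr : ∀ β M d → β * (0ℚ * (M - d)) ≡ (β - 1ℚ) * M * 0ℚ
          rearr = solve-∀ ℚ-ring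
      G≤ : G ≤ M * N₀
      G≤ = begin
        G                                ≤⟨ ∑-mono (λ v → ≤-from (χ (l₀ v) * ∑ (w₀ v)) (0≤* (0≤χ (l₀ v)) (∑-nonneg (Weighting.nonneg weighting₀ v))) (rearr M (χ (l₀ v)) (∑ (w₀ v)))) ⟩
        ∑ (λ v → M * χ (l₀ v))           ≡⟨ ∑-* M (λ v → χ (l₀ v)) ⟨
        M * N₀                           ∎
        where
        open ≤-Reasoning
        rearr : ∀ M c d → M * c - c * (M - d) ≡ c * d
        rearr = solve-∀ ℚ-ring
      loss≥ : N₀ ≤ N + loss
      loss≥ = ≤-trans (∑-mono (λ v → case (l₀ v) (R.x v))) (≤-reflexive (∑-+ (λ v → χ (R.l′ v)) (λ v → 1ℚ - χ (R.x v))))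
        where
        case : ∀ b c → χ b ≤ χ (b ∧ c) + (1ℚ - χ c)
        case true  c = ≤-reflexive (rearr (χ c))
          where
          rearr : ∀ s → 1ℚ ≡ s + (1ℚ - s)
          rearr = solve-∀ ℚ-ring
        case false c = p≤p+q (0≤1-χ c)
      -- In `energy+loss` the loss has coefficient 4 B M and is at least N₀ - N. Against 4 B M N₀
      -- stand the gap terms 4 B G, at most 4 B M N₀ - 4 V M N₀ by `βG≤`, and 2 V G, at most 2 V M
      -- N₀. The surplus 2 V M N₀ shows that N is positive, so that mean squares can be taken over
      -- the survivors.
      energy₁ : Q + dbl (V * M * N₀) ≤ quad (B * M) * N
      energy₁ = ≤-from
        ((dbl ((V + dbl B) * G) - (Q + dbl (M * dbl B * loss))) + (quad (B * M * ((N + loss) - N₀))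
          + (quad (V * ((β - 1ℚ) * M * N₀ - β * G)) + dbl (V * (M * N₀ - G)))))
        (0≤+ (p≤q⇒0≤q-p R.energy+loss) (0≤+ (0≤quad (0≤* (0≤* (<⇒≤ 0<B) 0≤M) (p≤q⇒0≤q-p loss≥)))
          (0≤+ (0≤quad (0≤* (<⇒≤ 0<V) (p≤q⇒0≤q-p βG≤))) (0≤dbl (0≤* (<⇒≤ 0<V) (p≤q⇒0≤q-p G≤))))))
        (rearr V β M N N₀ G Q loss)
        where
        rearr : ∀ V β M N N₀ G Q r → let BM = β * V * M ; E = (V + (β * V + β * V)) * G ; F = M * (β * V + β * V) * r
                                         P = BM * ((N + r) - N₀) ; S = V * ((β - 1ℚ) * M * N₀ - β * G) ; U = V * (M * N₀ - G) in
          ((BM + BM) + (BM + BM)) * N - (Q + (V * M * N₀ + V * M * N₀))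
          ≡ ((E + E) - (Q + (F + F))) + (((P + P) + (P + P)) + (((S + S) + (S + S)) + (U + U)))
        rearr = solve-∀ ℚ-ring
      0≤Q : 0ℚ ≤ Q
      0≤Q = ∑-nonneg (λ v → 0≤* (0≤χ (R.l′ v)) (0≤² (M - ∑ (R.w′ v))))
      0<VMN₀ : 0ℚ < dbl (V * M * N₀)
      0<VMN₀ = 0<dbl (0<* (0<* 0<V 0<M) 0<N₀)

    energy : Q ≤ quad (B * M) * N
    energy = ≤-trans (p≤p+q (<⇒≤ 0<VMN₀)) energy₁

    0<N : 0ℚ < N
    0<N = *-cancel-< (0≤quad (0≤* (<⇒≤ 0<B) 0≤M)) (subst (_< quad (B * M) * N) (sym (*-zeroʳ (quad (B * M))))
            (<-≤-trans (subst (0ℚ <_) (+-comm (dbl (V * M * N₀)) Q) (0<+ 0<VMN₀ 0≤Q)) energy₁))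

    -- The last two bounds of the invariant are set up as equalities: nothing is dead yet, and `Z`
    -- and `L` are exactly the full reserves. As 4 t = 1, the weight bound for all later rounds is 4
    -- V.
    initial : ∀ ρ t → quad t ≡ 1ℚ → quad (B * M) ≤ (ρ * t) * (ρ * t) →
      State e M N (quad V) (dbl (ρ * ρ * N)) (M * N - quad (ρ * t * N)) ρ t
    initial ρ t quad-t≡1 R≤ = record
      { l = R.l′ ; z = λ _ → false ; w = R.w′ ; W = V ; 0<W = 0<V ; weighting = R.weighting′
      ; W≤ = ≤-reflexive (trans (cong (λ q → V * ((1ℚ + q) * (1ℚ + q))) quad-t≡1) (rearr V))
      ; energy = ≤-trans energy (*-monoˡ (<⇒≤ 0<N) R≤)
      ; removed = λ u v lu _ → gone u v (l₀ u) (R.x u) refl refl lu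
      ; disjoint = λ _ _ → refl
      ; live≤ = ≤-refl
      ; dead≤ = ≤-reflexive (trans (cong (λ c → M * M * c + dbl (ρ * ρ * N)) (∑-0 {n} (λ _ → refl))) (rearr′ (M * M) (dbl (ρ * ρ * N))))
      ; total≥ = ≤-reflexive (trans (rearr″ M N (quad (ρ * t * N))) (cong (λ c → M * (N + c)) (sym (∑-0 {n} (λ _ → refl)))))
      }
      where
      rearr : ∀ V → V * ((1ℚ + 1ℚ) * (1ℚ + 1ℚ)) ≡ (V + V) + (V + V)
      rearr = solve-∀ ℚ-ring
      rearr′ : ∀ a b → a * 0ℚ + b ≡ b
      rearr′ = solve-∀ ℚ-ring
      rearr″ : ∀ M N q → M * N - q + q ≡ M * (N + 0ℚ)
      rearr″ = solve-∀ ℚ-ring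
      gone : ∀ u v a b → l₀ u ≡ a → R.x u ≡ b → a ∧ b ≡ false → R.w′ u v ≡ 0ℚ
      gone u v false b     lu xu _ = R.supported′ u v (off u v lu)
      gone u v true  false lu xu _ = R.removed u v xu

    private
      -- 16 times the weight bound 4 V, the least value of `ρ * t` that a round can reach: the
      -- rounds stop here.
      σ : ℚ
      σ = quad (quad (quad V))

      σ≡ : σ ≡ ι 64 * V
      σ≡ = trans (quad≡ι4* (quad (quad V))) (trans (cong (ι 4 *_) (trans (quad≡ι4* (quad V)) (cong (ι 4 *_) (quad≡ι4* V)))) (begin
        ι 4 * (ι 4 * (ι 4 * V))   ≡⟨ rearr (ι 4) V ⟩
        ι 4 * (ι 4 * ι 4) * V     ≡⟨ cong (λ c → ι 4 * c * V) (ι-* 4 4) ⟨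
        ι 4 * ι 16 * V            ≡⟨ cong (_* V) (ι-* 4 16) ⟨
        ι 64 * V                  ∎))
        where
        open ≡-Reasoning
        rearr : ∀ c V → c * (c * (c * V)) ≡ c * (c * c) * V
        rearr = solve-∀ ℚ-ring

      V≤B : V ≤ B
      V≤B = subst (_≤ B) (*-identityˡ V) (*-monoˡ (<⇒≤ 0<V) 1≤β)

      1≤σ : 1ℚ ≤ σ
      1≤σ = ≤-trans 1≤V (≤-trans (grow V (<⇒≤ 0<V)) (≤-trans (grow (quad V) (0≤quad (<⇒≤ 0<V))) (grow (quad (quad V)) (0≤quad (0≤quad (<⇒≤ 0<V))))))
        where
        grow : ∀ p → 0ℚ ≤ p → p ≤ quad p
        grow p 0≤p = ≤-trans (p≤p+q 0≤p) (p≤p+q (0≤dbl 0≤p))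

      0≤σ : 0ℚ ≤ σ
      0≤σ = ≤-trans 0≤1 1≤σ

    -- With s² ≤ 64 B M, the bound 16384 = 256 · 64 gives 16 s ≤ M; since also 16384 = 8 · 2048, the
    -- dead vertices carry at most M N / 8. In the conclusion 4224 = 2 (64 + 2048): the final gaps,
    -- the deleted dead vertices, and a factor 2 from `survive`.
    near-regular : ι 16384 * B ≤ M → NearRegular e (quad V) M (ι 4224 * B)
    near-regular M-large = record
      { l = l ; w = DropDead.w° 0<M final ; weighting = bounded-by (DropDead.weighting° 0<M final)
      ; inside = DropDead.inside° 0<M final ; nonempty = 0<count ; deficit = deficit }
      where
      open ≤-Reasoning
      R = quad (B * M)
      0≤BM : 0ℚ ≤ B * M
      0≤BM = 0≤* (<⇒≤ 0<B) 0≤M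
      R≡ : R ≡ ι 4 * (B * M)
      R≡ = quad≡ι4* (B * M)
      a g : ℕ → ℚ
      a k = σ * 2^ k * 2^ k
      g k = a k * a k
      0≤a : ∀ k → 0ℚ ≤ a k
      0≤a k = 0≤* (0≤* 0≤σ (<⇒≤ (0<2^ k))) (<⇒≤ (0<2^ k))
      ratio : ∀ k → g (suc k) ≤ ι 16 * g k
      ratio k = ≤-reflexive (trans (rearr σ (2^ k)) (trans (quad≡ι4* (quad (g k))) (trans (cong (ι 4 *_) (quad≡ι4* (g k)))
        (trans (sym (*-assoc (ι 4) (ι 4) (g k))) (cong (_* g k) (sym (ι-* 4 4)))))))
        where
        rearr : ∀ s p → let b = s * p * p * (s * p * p) ; c = (b + b) + (b + b) in
          s * (p + p) * (p + p) * (s * (p + p) * (p + p)) ≡ (c + c) + (c + c)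
        rearr = solve-∀ ℚ-ring
      g0≤R : g 0 ≤ R
      g0≤R = begin
        g 0                               ≡⟨ rearr σ ⟩
        σ * σ                             ≤⟨ *-mono 0≤σ (0≤* (0≤ι 64) (<⇒≤ 0<B)) σ≤ σ≤ ⟩
        ι 64 * B * (ι 64 * B)             ≡⟨ rearr′ (ι 64) B ⟩
        (ι 64 * ι 64) * (B * B)           ≡⟨ cong (_* (B * B)) (ι-* 64 64) ⟨
        ι 4096 * (B * B)                  ≤⟨ *-monoˡ (0≤² B) (ι-mono {4096} {65536} (ℕₚ.≤ᵇ⇒≤ 4096 65536 _)) ⟩
        ι 65536 * (B * B)                 ≡⟨ cong (_* (B * B)) (ι-* 4 16384) ⟩
        ι 4 * ι 16384 * (B * B)           ≡⟨ rearr″ (ι 4) (ι 16384) B ⟩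
        ι 4 * (B * (ι 16384 * B))         ≤⟨ *-monoʳ (0≤ι 4) (*-monoʳ (<⇒≤ 0<B) M-large) ⟩
        ι 4 * (B * M)                     ≡⟨ R≡ ⟨
        R                                 ∎
        where
        σ≤ : σ ≤ ι 64 * B
        σ≤ = subst (_≤ ι 64 * B) (sym σ≡) (*-monoʳ (0≤ι 64) V≤B)
        rearr : ∀ s → s * 1ℚ * 1ℚ * (s * 1ℚ * 1ℚ) ≡ s * s
        rearr = solve-∀ ℚ-ring
        rearr′ : ∀ c B → c * B * (c * B) ≡ c * c * (B * B)
        rearr′ = solve-∀ ℚ-ring
        rearr″ : ∀ c d B → c * d * (B * B) ≡ c * (B * (d * B))
        rearr″ = solve-∀ ℚ-ring
      top = archimedean R
      R≤top : R ≤ g (proj₁ top)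
      R≤top = begin
        R                       ≤⟨ proj₂ top ⟩
        ι m                     ≤⟨ p≤q+p 0≤1 ⟩
        1ℚ + ι m                ≤⟨ 1+ι≤2^ m ⟩
        p                       ≡⟨ rearr′ p ⟩
        1ℚ * 1ℚ * p * 1ℚ        ≤⟨ *-mono (0≤* (0≤* 0≤1 0≤1) (<⇒≤ (0<2^ m))) (0≤a m) (*-monoˡ (<⇒≤ (0<2^ m)) σp≥) a≥1 ⟩
        g m                     ∎
        where
        m = proj₁ top
        p = 2^ m
        rearr′ : ∀ s → s ≡ 1ℚ * 1ℚ * s * 1ℚ
        rearr′ = solve-∀ ℚ-ring
        σp≥ : 1ℚ * 1ℚ ≤ σ * p
        σp≥ = *-mono 0≤1 (<⇒≤ (0<2^ m)) 1≤σ (1≤2^ m)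
        a≥1 : 1ℚ ≤ a m
        a≥1 = ≤-trans (≤-reflexive (sym (trans (*-identityʳ (1ℚ * 1ℚ)) (*-identityˡ 1ℚ)))) (*-mono (0≤* 0≤1 0≤1) (<⇒≤ (0<2^ m)) σp≥ (1≤2^ m))
      -- (σ 4ᵏ)² is comparable to the mean square gap after the first round.
      chosen = window g ratio R (proj₁ top) (0≤quad 0≤BM) g0≤R R≤top
      k = proj₁ chosen
      p = 2^ k
      0<p = 0<2^ k
      s = a k
      inverse = reciprocal (0<dbl (0<dbl 0<p))
      -- The `k` rounds lead from (p ρ, p t) to (ρ, t). The start has 4 p t = 1 and product s = σ
      -- p², the end has product σ.
      t ρ : ℚ
      t = proj₁ inverse
      ρ = σ * quad p
      0<t : 0ℚ < t
      0<t = proj₁ (proj₂ inverse)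
      0<ρ : 0ℚ < ρ
      0<ρ = 0<* (<-≤-trans 0<1 1≤σ) (0<dbl (0<dbl 0<p))
      t*4p≡1 : t * quad p ≡ 1ℚ
      t*4p≡1 = proj₂ (proj₂ inverse)
      quad-pt : quad (p * t) ≡ 1ℚ
      quad-pt = trans (rearr p t) t*4p≡1
        where
        rearr : ∀ p t → (p * t + p * t) + (p * t + p * t) ≡ t * ((p + p) + (p + p))
        rearr = solve-∀ ℚ-ring
      ρt≡σ : ρ * t ≡ σ
      ρt≡σ = trans (rearr σ (quad p) t) (trans (cong (σ *_) t*4p≡1) (*-identityʳ σ))
        where
        rearr : ∀ s q t → s * q * t ≡ s * (t * q)
        rearr = solve-∀ ℚ-ring
      s₀≡ : (p * ρ) * (p * t) ≡ s
      s₀≡ = trans (rearr σ p t) (trans (cong (s *_) quad-pt) (*-identityʳ s))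
        where
        rearr : ∀ s p t → (p * (s * ((p + p) + (p + p)))) * (p * t) ≡ s * p * p * ((p * t + p * t) + (p * t + p * t))
        rearr = solve-∀ ℚ-ring
      pρ≡ : p * ρ ≡ quad s
      pρ≡ = rearr σ p
        where
        rearr : ∀ s p → let b = s * p * p in p * (s * ((p + p) + (p + p))) ≡ (b + b) + (b + b)
        rearr = solve-∀ ℚ-ring
      Z = dbl ((p * ρ) * (p * ρ) * N)
      L = M * N - quad ((p * ρ) * (p * t) * N)
      final : State e M N (quad V) Z L ρ t
      final = iterate e-irrefl 0<M (<⇒≤ 0<N) k 0<ρ 0<t (≤-reflexive quad-pt) (≤-reflexive (sym ρt≡σ))
        (initial (p * ρ) (p * t) quad-pt (subst (λ q → R ≤ q * q) (sym s₀≡) (proj₁ (proj₂ chosen))))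
      open State final using (l; z; w; W; 0<W; W≤; weighting; live≤; dead≤; total≥) renaming (energy to final-energy)
      bounded-by : ∀ {w} → Weighting e W M w → Weighting e (quad V) M w
      bounded-by weighting = record
        { symmetric = Weighting.symmetric weighting ; nonneg = Weighting.nonneg weighting
        ; bounded = λ u v → ≤-trans (Weighting.bounded weighting u v) W≤′
        ; supported = Weighting.supported weighting ; row≤ = Weighting.row≤ weighting }
        where
        W≤′ : W ≤ quad V
        W≤′ = ≤-trans (p≤p[1+q]² (<⇒≤ 0<W) (0≤quad (<⇒≤ 0<t))) W≤

      s²≤ : s * s ≤ ι 64 * (B * M)
      s²≤ = begin
        s * s                   ≤⟨ proj₂ (proj₂ chosen) ⟩
        ι 16 * R                ≡⟨ cong (ι 16 *_) R≡ ⟩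
        ι 16 * (ι 4 * (B * M))  ≡⟨ *-assoc (ι 16) (ι 4) (B * M) ⟨
        ι 16 * ι 4 * (B * M)    ≡⟨ cong (_* (B * M)) (ι-* 16 4) ⟨
        ι 64 * (B * M)          ∎
      16s≤M : ι 16 * s ≤ M
      16s≤M = sqrt-mono 0≤M (begin
        ι 16 * s * (ι 16 * s)         ≡⟨ rearr (ι 16) s ⟩
        ι 16 * ι 16 * (s * s)         ≡⟨ cong (_* (s * s)) (ι-* 16 16) ⟨
        ι 256 * (s * s)               ≤⟨ *-monoʳ (0≤ι 256) s²≤ ⟩
        ι 256 * (ι 64 * (B * M))      ≡⟨ trans (sym (*-assoc (ι 256) (ι 64) (B * M))) (trans (cong (_* (B * M)) (sym (ι-* 256 64))) (sym (*-assoc (ι 16384) B M))) ⟩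
        ι 16384 * B * M               ≤⟨ *-monoˡ 0≤M M-large ⟩
        M * M                         ∎)
        where
        rearr : ∀ c s → c * s * (c * s) ≡ c * c * (s * s)
        rearr = solve-∀ ℚ-ring
      dead-weight : M * count z ≤ ι 2048 * B * N
      dead-weight = *-cancel 0<M (begin
        M * (M * count z)                    ≡⟨ *-assoc M M (count z) ⟨
        M * M * count z                      ≤⟨ p≤p+q (0≤dbl (0≤* (0≤² ρ) (<⇒≤ 0<N))) ⟩
        M * M * count z + dbl (ρ * ρ * N)    ≤⟨ dead≤ ⟩
        Z                                    ≡⟨ cong (λ q → dbl (q * q * N)) pρ≡ ⟩
        dbl (quad s * quad s * N)            ≡⟨ dbl≡ι2* (quad s * quad s * N) ⟩
        ι 2 * (quad s * quad s * N)          ≡⟨ cong (λ q → ι 2 * (q * q * N)) (quad≡ι4* s) ⟩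
        ι 2 * (ι 4 * s * (ι 4 * s) * N)      ≡⟨ rearr₁ (ι 2) (ι 4) s N ⟩
        ι 2 * (ι 4 * ι 4) * N * (s * s)      ≡⟨ cong (λ c → c * N * (s * s)) (trans (cong (ι 2 *_) (sym (ι-* 4 4))) (sym (ι-* 2 16))) ⟩
        ι 32 * N * (s * s)                   ≤⟨ *-monoʳ (0≤* (0≤ι 32) (<⇒≤ 0<N)) s²≤ ⟩
        ι 32 * N * (ι 64 * (B * M))          ≡⟨ rearr₂ (ι 32) (ι 64) N B M ⟩
        M * (ι 32 * ι 64 * B * N)            ≡⟨ cong (λ c → M * (c * B * N)) (ι-* 32 64) ⟨
        M * (ι 2048 * B * N)                 ∎)
        where
        rearr₁ : ∀ c d s N → c * (d * s * (d * s) * N) ≡ c * (d * d) * N * (s * s)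
        rearr₁ = solve-∀ ℚ-ring
        rearr₂ : ∀ c d N B M → c * N * (d * (B * M)) ≡ M * (c * d * B * N)
        rearr₂ = solve-∀ ℚ-ring
      8dead≤M : ι 8 * (ι 2048 * B * N) ≤ M * N
      8dead≤M = ≤-trans (≤-reflexive (trans (rearr (ι 8) (ι 2048) B N) (cong (λ c → c * B * N) (sym (ι-* 8 2048))))) (*-monoˡ (<⇒≤ 0<N) M-large)
        where
        rearr : ∀ c d B N → c * (d * B * N) ≡ c * d * B * N
        rearr = solve-∀ ℚ-ring
      -- Removed vertices account for at most 4 s N ≤ M N / 4 and dead ones for at most M N / 8, so
      -- M · count l ≥ 5/8 M N. The comparison is multiplied by 8 to clear fractions.
      survive : N ≤ dbl (count l)
      survive = *-cancel 0<M (*-cancel 0<8 (≤-from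
        ((ι 16 * (M * (count l + count z)) - ι 16 * (L + quad (ρ * t * N))) + (ι 16 * quad (ρ * t * N)
          + ((quad (M * N) - quad (ι 16 * s * N)) + (ι 16 * (ι 2048 * B * N - M * count z) + (ι 2 * (M * N - ι 8 * (ι 2048 * B * N)) + ι 2 * (M * N))))))
        (0≤+ (p≤q⇒0≤q-p (*-monoʳ (0≤ι 16) total≥)) (0≤+ (0≤* (0≤ι 16) (0≤quad (0≤* (<⇒≤ (0<* 0<ρ 0<t)) (<⇒≤ 0<N))))
          (0≤+ (p≤q⇒0≤q-p (dbl-mono (dbl-mono (*-monoˡ (<⇒≤ 0<N) 16s≤M)))) (0≤+ (0≤* (0≤ι 16) (p≤q⇒0≤q-p dead-weight))
            (0≤+ (0≤* (0≤ι 2) (p≤q⇒0≤q-p 8dead≤M)) (0≤* (0≤ι 2) (0≤* 0≤M (<⇒≤ 0<N))))))))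
        identity))
        where
        0<8 : 0ℚ < ι 8
        0<8 = <-≤-trans 0<1 (1≤ι {8} (ℕ.s≤s ℕ.z≤n))
        identity : ι 8 * (M * dbl (count l)) - ι 8 * (M * N) ≡
          ((ι 16 * (M * (count l + count z)) - ι 16 * (L + quad (ρ * t * N))) + (ι 16 * quad (ρ * t * N)
          + ((quad (M * N) - quad (ι 16 * s * N)) + (ι 16 * (ι 2048 * B * N - M * count z) + (ι 2 * (M * N - ι 8 * (ι 2048 * B * N)) + ι 2 * (M * N))))))
        identity = expand (ι 2) (ι 8) (ι 16) ι-2 (trans (ι-+ 4 4) (cong₂ _+_ 2+2 2+2)) (ι-+ 8 8) M N (count l) (count z) (ρ * t * N) s _ (ι 2048 * B * N) s₀≡
          where
          2+2 : ι 4 ≡ (1ℚ + 1ℚ) + (1ℚ + 1ℚ)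
          2+2 = trans (ι-+ 2 2) (cong₂ _+_ ι-2 ι-2)
          -- The numerals are opaque to the ring solver, so they are generalized to variables and
          -- replaced by sums of ones.
          expand : ∀ c a b → c ≡ 1ℚ + 1ℚ → a ≡ ((1ℚ + 1ℚ) + (1ℚ + 1ℚ)) + ((1ℚ + 1ℚ) + (1ℚ + 1ℚ)) → b ≡ a + a →
            ∀ M N l z r s s′ D → s′ ≡ s → a * (M * dbl l) - a * (M * N) ≡
              (b * (M * (l + z)) - b * (M * N - quad (s′ * N) + quad r)) + (b * quad r
              + ((quad (M * N) - quad (b * s * N)) + (b * (D - M * z) + (c * (M * N - a * D) + c * (M * N)))))
          expand _ _ _ refl refl refl M N l z r s _ D refl = ring M N l z r s D
            where
            ring : ∀ M N l z r s D → let c = 1ℚ + 1ℚ ; a = (c + c) + (c + c) ; b = a + a ; q = s * N ; m = M * N ; y = b * s * N in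
              a * (M * (l + l)) - a * m ≡
              (b * (M * (l + z)) - b * (m - ((q + q) + (q + q)) + ((r + r) + (r + r)))) + (b * ((r + r) + (r + r))
              + ((((m + m) + (m + m)) - ((y + y) + (y + y))) + (b * (D - M * z) + (c * (m - a * D) + c * m))))
            ring = solve-∀ ℚ-ring
      0<count : 0ℚ < count l
      0<count = *-cancel-< (<⇒≤ (0<dbl 0<1)) (subst₂ _<_ (sym (*-zeroʳ (dbl 1ℚ))) (rearr (count l)) (<-≤-trans 0<N survive))
        where
        rearr : ∀ c → c + c ≡ (1ℚ + 1ℚ) * c
        rearr = solve-∀ ℚ-ring
      deficit : ∑ (gap M l (DropDead.w° 0<M final)) ≤ ι 4224 * B * count l
      deficit = begin
        ∑ (gap M l (DropDead.w° 0<M final))           ≤⟨ DropDead.deficit° 0<M final ⟩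
        ∑ (gap M l w) + M * count z                   ≤⟨ +-mono-≤ (gap-young M l w (ρ * t) N (0<* 0<ρ 0<t) live≤ final-energy) dead-weight ⟩
        ρ * t * N + ι 2048 * B * N                    ≡⟨ cong (λ q → q * N + ι 2048 * B * N) (trans ρt≡σ σ≡) ⟩
        ι 64 * V * N + ι 2048 * B * N                 ≤⟨ +-monoˡ-≤ (ι 2048 * B * N) (*-monoˡ (<⇒≤ 0<N) (*-monoʳ (0≤ι 64) V≤B)) ⟩
        ι 64 * B * N + ι 2048 * B * N                 ≡⟨ trans (rearr₁ (ι 64) (ι 2048) B N) (cong (λ c → c * B * N) (sym (ι-+ 64 2048))) ⟩
        ι 2112 * B * N                                ≤⟨ *-monoʳ (0≤* (0≤ι 2112) (<⇒≤ 0<B)) survive ⟩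
        ι 2112 * B * dbl (count l)                    ≡⟨ trans (rearr₂ (ι 2112) B (count l)) (cong (λ c → c * B * count l) (sym (ι-+ 2112 2112))) ⟩
        ι 4224 * B * count l                          ∎
        where
        rearr₁ : ∀ c d B N → c * B * N + d * B * N ≡ (c + d) * B * N
        rearr₁ = solve-∀ ℚ-ring
        rearr₂ : ∀ c B l → c * B * (l + l) ≡ (c + c) * B * l
        rearr₂ = solve-∀ ℚ-ring

  -- Weak duality for fractional flows

  module _ {n} (f : Fin n → Fin n → Bool) (cr cc : Fin n → ℕ) (s m : ℚ) (X : Fin n → Fin n → ℚ)
    (0≤s : 0ℚ ≤ s) (0≤m : 0ℚ ≤ m) (0≤X : ∀ u v → 0ℚ ≤ X u v)
    (X≤f : ∀ u v → s * X u v ≤ m * χ (f u v))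
    (row : ∀ u → s * ∑ (X u) ≤ m * ι (cr u))
    (col : ∀ v → s * ∑ (λ u → X u v) ≤ m * ι (cc v)) where

    -- (s / m) X is a fractional flow, with denominators cleared. Its value on an arc is charged to
    -- the source arc if the tail is outside `Z`, to the sink arc if the head is inside, and
    -- otherwise to the arc itself, which then leaves `Z`.
    weak-duality : ∀ Z → s * ∑ (λ u → ∑ (X u)) ≤ m * ι (cut f cr cc Z)
    weak-duality Z = begin
      s * ∑ (λ u → ∑ (X u))
        ≡⟨ trans (∑-* s (λ u → ∑ (X u))) (∑-cong (λ u → ∑-* s (X u))) ⟩
      ∑ (λ u → ∑ (λ v → s * X u v))
        ≤⟨ ∑-mono (λ u → ∑-mono (λ v → case (Z u) (Z v) (f u v) (s * X u v) (0≤* 0≤s (0≤X u v)) (X≤f u v))) ⟩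
      ∑ (λ u → ∑ (λ v → O u v + I u v + L u v))
        ≡⟨ ∑-cong (λ u → trans (∑-+ (λ v → O u v + I u v) (L u)) (cong (_+ ∑ (L u)) (∑-+ (O u) (I u)))) ⟩
      ∑ (λ u → ∑ (O u) + ∑ (I u) + ∑ (L u))
        ≡⟨ trans (∑-+ (λ u → ∑ (O u) + ∑ (I u)) (λ u → ∑ (L u))) (cong (_+ ∑ (λ u → ∑ (L u))) (∑-+ (λ u → ∑ (O u)) (λ u → ∑ (I u)))) ⟩
      ∑ (λ u → ∑ (O u)) + ∑ (λ u → ∑ (I u)) + ∑ (λ u → ∑ (L u))
        ≤⟨ +-mono-≤ (+-mono-≤ out inn) (≤-reflexive leave) ⟩
      m * ι (outsideCapacity cr Z) + m * ι (insideCapacity cc Z) + m * ι (leaving f Z)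
        ≡⟨ trans (cong (m *_) (trans (ι-+ (outsideCapacity cr Z ℕ.+ insideCapacity cc Z) (leaving f Z)) (cong (_+ ι (leaving f Z)) (ι-+ (outsideCapacity cr Z) (insideCapacity cc Z)))))
                 (distrib m (ι (outsideCapacity cr Z)) (ι (insideCapacity cc Z)) (ι (leaving f Z))) ⟨
      m * ι (cut f cr cc Z) ∎
      where
      open ≤-Reasoning
      O I L : Fin n → Fin n → ℚ
      O u v = χ (not (Z u)) * (s * X u v)
      I u v = χ (Z v) * (s * X u v)
      L u v = m * χ (f u v ∧ Z u ∧ not (Z v))
      distrib : ∀ m a b c → m * (a + b + c) ≡ m * a + m * b + m * c
      distrib = solve-∀ ℚ-ring
      case : ∀ a b e y → 0ℚ ≤ y → y ≤ m * χ e → y ≤ χ (not a) * y + χ b * y + m * χ (e ∧ a ∧ not b)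
      case false b e y 0≤y y≤ = ≤-from (χ b * y + m * χ (e ∧ false)) (0≤+ (0≤* (0≤χ b) 0≤y) (0≤* 0≤m (0≤χ (e ∧ false)))) (rearr y (χ b * y) (m * χ (e ∧ false)))
        where
        rearr : ∀ y s t → 1ℚ * y + s + t - y ≡ s + t
        rearr = solve-∀ ℚ-ring
      case true true e y 0≤y y≤ = ≤-from (m * χ (e ∧ false)) (0≤* 0≤m (0≤χ (e ∧ false))) (rearr y (m * χ (e ∧ false)))
        where
        rearr : ∀ y t → 0ℚ * y + 1ℚ * y + t - y ≡ t
        rearr = solve-∀ ℚ-ring
      case true false true y 0≤y y≤ = ≤-trans y≤ (≤-reflexive (rearr y (m * 1ℚ)))
        where
        rearr : ∀ y t → t ≡ 0ℚ * y + 0ℚ * y + t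
        rearr = solve-∀ ℚ-ring
      case true false false y 0≤y y≤ = ≤-trans y≤ (≤-reflexive (rearr y (m * 0ℚ)))
        where
        rearr : ∀ y t → t ≡ 0ℚ * y + 0ℚ * y + t
        rearr = solve-∀ ℚ-ring
      weighted : ∀ (c : Fin n → ℕ) (g : Fin n → Bool) → m * ι (sum (λ v → c v ℕ.* 𝟙 (g v))) ≡ ∑ (λ v → χ (g v) * (m * ι (c v)))
      weighted c g = trans (cong (m *_) (ι-sum (λ v → c v ℕ.* 𝟙 (g v)))) (trans (∑-* m (λ v → ι (c v ℕ.* 𝟙 (g v))))
        (∑-cong (λ v → trans (cong (m *_) (trans (ι-* (c v) (𝟙 (g v))) (cong (ι (c v) *_) (ι𝟙≡χ (g v))))) (rearr m (ι (c v)) (χ (g v))))))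
        where
        rearr : ∀ m c x → m * (c * x) ≡ x * (m * c)
        rearr = solve-∀ ℚ-ring
      out : ∑ (λ u → ∑ (O u)) ≤ m * ι (outsideCapacity cr Z)
      out = ≤-trans (∑-mono (λ u → ≤-trans (≤-reflexive (trans (sym (∑-* (χ (not (Z u))) (λ v → s * X u v))) (cong (χ (not (Z u)) *_) (sym (∑-* s (X u))))))
                      (*-monoʳ (0≤χ (not (Z u))) (row u))))
              (≤-reflexive (sym (weighted cr (λ u → not (Z u)))))
      inn : ∑ (λ u → ∑ (I u)) ≤ m * ι (insideCapacity cc Z)
      inn = ≤-trans (≤-reflexive (∑-swap I)) (≤-trans (∑-mono (λ v → ≤-trans
              (≤-reflexive (trans (sym (∑-* (χ (Z v)) (λ u → s * X u v))) (cong (χ (Z v) *_) (sym (∑-* s (λ u → X u v))))))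
              (*-monoʳ (0≤χ (Z v)) (col v))))
              (≤-reflexive (sym (weighted cc Z))))
      leave : ∑ (λ u → ∑ (L u)) ≡ m * ι (leaving f Z)
      leave = sym (trans (cong (m *_) (trans (ι-sum _) (∑-cong (λ u → trans (ι-sum (λ v → 𝟙 (f u v ∧ Z u ∧ not (Z v))))
        (∑-cong (λ v → ι𝟙≡χ (f u v ∧ Z u ∧ not (Z v))))))))
        (trans (∑-* m _) (∑-cong (λ u → ∑-* m (λ v → χ (f u v ∧ Z u ∧ not (Z v)))))))

  -- From a q-regular to an r-regular bipartite graph

  sum-tight : ∀ {n} (f g : Fin n → ℕ) → (∀ i → f i ℕ.≤ g i) → sum g ℕ.≤ sum f → ∀ i → f i ≡ g i
  sum-tight f g f≤g Σg≤Σf i = ℕₚ.≤-antisym (f≤g i) (ℕₚ.m∸n≡0⇒m≤n (ℕₚ.n≤0⇒n≡0 (ℕₚ.≤-trans (term≤sum (λ i → g i ∸ f i) i) slack)))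
    where
    slack : sum (λ i → g i ∸ f i) ℕ.≤ 0
    slack = ℕₚ.+-cancelʳ-≤ (sum f) _ _ (ℕₚ.≤-trans
      (ℕₚ.≤-reflexive (trans (sym (sum-+ (λ i → g i ∸ f i) f)) (sum-cong (λ i → ℕₚ.m∸n+n≡m (f≤g i))))) Σg≤Σf)

  sum-allFin : ∀ n (f : Fin n → ℕ) → ListAction.sum (List.map f (allFin n)) ≡ sum f
  sum-allFin n f = trans (cong ListAction.sum (map-tabulate (λ i → i) f)) (go n f)
    where
    go : ∀ n (f : Fin n → ℕ) → ListAction.sum (List.tabulate f) ≡ sum f
    go zero    f = sym (sum-zero f)
    go (suc n) f = trans (cong (f zero ℕ.+_) (go n (f ∘ suc))) (sym (sum-suc f))

  degreeIn-sum : ∀ {n} (E : Fin n → Fin n → Bool) v → degreeIn E v ≡ sum (λ u → 𝟙 (E v u))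
  degreeIn-sum {n} E v = trans (sum-allFin n (λ u → if E v u then 1 else 0)) (sum-cong (λ u → if≡𝟙 (E v u)))
    where
    if≡𝟙 : ∀ b → (if b then 1 else 0) ≡ 𝟙 b
    if≡𝟙 true  = refl
    if≡𝟙 false = refl

  -- (r / q) x is a fractional flow that fills the capacity r at every non-isolated vertex, so no
  -- cut is smaller than its value. An integral flow of that value must fill all capacities too, and
  -- its edges form the r-regular subgraph.
  module RFactor {n} (G : Graph n) (side : Fin n → Bool) (x : Fin n → Fin n → Bool)
    (x-side : ∀ u v → x u v ≡ true → side u ≡ true × side v ≡ false)
    (x⊆G : ∀ u v → x u v ≡ true → adj G u v ≡ true)
    (q r : ℕ) (0<q : 0 ℕ.< q) (r≤q : r ℕ.≤ q)
    (x-regular : ∀ v → sum (λ u → 𝟙 (x v u)) ℕ.+ sum (λ u → 𝟙 (x u v)) ≡ 0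
                     ⊎ sum (λ u → 𝟙 (x v u)) ℕ.+ sum (λ u → 𝟙 (x u v)) ≡ q)
    (x-edge : ∃[ u ] ∃[ v ] x u v ≡ true) where

    private
      row col : Fin n → ℕ
      row v = sum (λ u → 𝟙 (x v u))
      col v = sum (λ u → 𝟙 (x u v))
      vs : Fin n → Bool
      vs v = not (row v ℕ.+ col v ℕ.≡ᵇ 0)

      degree-vs : ∀ v → row v ℕ.+ col v ≡ 𝟙 (vs v) ℕ.* q
      degree-vs v = case (row v ℕ.+ col v) (x-regular v)
        where
        case : ∀ d → d ≡ 0 ⊎ d ≡ q → d ≡ 𝟙 (not (d ℕ.≡ᵇ 0)) ℕ.* q
        case zero    _           = refl
        case (suc d) (inj₂ refl) = sym (ℕₚ.*-identityˡ (suc d))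

      vs-intro : ∀ v → 1 ℕ.≤ row v ℕ.+ col v → vs v ≡ true
      vs-intro v = case (row v ℕ.+ col v)
        where
        case : ∀ d → 1 ℕ.≤ d → not (d ℕ.≡ᵇ 0) ≡ true
        case (suc d) _ = refl

      x≤ : ∀ u v → x u v ≡ true → 1 ℕ.≤ row u × 1 ℕ.≤ col v
      x≤ u v xuv = subst (λ b → 𝟙 b ℕ.≤ row u) xuv (term≤sum (λ v → 𝟙 (x u v)) v)
                 , subst (λ b → 𝟙 b ℕ.≤ col v) xuv (term≤sum (λ u → 𝟙 (x u v)) u)

      off : ∀ {b} → (b ≡ true → ⊥) → 𝟙 b ≡ 0
      off {false} h = refl
      off {true}  h = ⊥-elim (h refl)
      true≢false : ∀ {b} → b ≡ true → b ≡ false → ⊥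
      true≢false refl ()

      cr cc : ℕ → Fin n → ℕ
      cr m v = 𝟙 (side v ∧ vs v) ℕ.* m
      cc m v = 𝟙 (not (side v) ∧ vs v) ℕ.* m

      row≡ : ∀ v → row v ≡ cr q v
      row≡ v = case (side v) refl
        where
        case : ∀ b → side v ≡ b → row v ≡ 𝟙 (b ∧ vs v) ℕ.* q
        case true  sv = trans (sym (ℕₚ.+-identityʳ (row v))) (trans (cong (row v ℕ.+_) (sym (sum-0 (λ u → off (λ xuv → true≢false sv (proj₂ (x-side u v xuv))))))) (degree-vs v))
        case false sv = sum-0 (λ u → off (λ xvu → true≢false (proj₁ (x-side v u xvu)) sv))

      col≡ : ∀ v → col v ≡ cc q v
      col≡ v = case (side v) refl
        where
        case : ∀ b → side v ≡ b → col v ≡ 𝟙 (not b ∧ vs v) ℕ.* q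
        case false sv = trans (cong (ℕ._+ col v) (sym (sum-0 (λ u → off (λ xvu → true≢false (proj₁ (x-side v u xvu)) sv))))) (degree-vs v)
        case true  sv = sum-0 (λ u → off (λ xuv → true≢false sv (proj₂ (x-side u v xuv))))

      #A #B : ℕ
      #A = sum (λ v → 𝟙 (side v ∧ vs v))
      #B = sum (λ v → 𝟙 (not (side v) ∧ vs v))

      total-cr : ∀ m → sum (cr m) ≡ m ℕ.* #A
      total-cr m = trans (sum-cong (λ v → ℕₚ.*-comm (𝟙 (side v ∧ vs v)) m)) (sym (sum-* m (λ v → 𝟙 (side v ∧ vs v))))
      total-cc : ∀ m → sum (cc m) ≡ m ℕ.* #B
      total-cc m = trans (sum-cong (λ v → ℕₚ.*-comm (𝟙 (not (side v) ∧ vs v)) m)) (sym (sum-* m (λ v → 𝟙 (not (side v) ∧ vs v))))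

      edges≡A : edges x ≡ q ℕ.* #A
      edges≡A = trans (sum-cong row≡) (total-cr q)
      edges≡B : edges x ≡ q ℕ.* #B
      edges≡B = trans (sum-swap (λ u v → 𝟙 (x u v))) (trans (sum-cong col≡) (total-cc q))
      -- Counting edges from either side; hence a flow that fills one side also fills the other.
      #A≡#B : #A ≡ #B
      #A≡#B = ℕₚ.*-cancelˡ-≡ #A #B q {{ℕ.>-nonZero 0<q}} (trans (sym edges≡A) edges≡B)

      X : Fin n → Fin n → ℚ
      X u v = ι (𝟙 (x u v))

      scale : ∀ a → ι r * ι (𝟙 a ℕ.* q) ≡ ι q * ι (𝟙 a ℕ.* r)
      scale a = trans (cong (ι r *_) (ι-* (𝟙 a) q)) (trans (rearr (ι r) (ι (𝟙 a)) (ι q)) (cong (ι q *_) (sym (ι-* (𝟙 a) r))))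
        where
        rearr : ∀ r a q → r * (a * q) ≡ q * (a * r)
        rearr = solve-∀ ℚ-ring

      cut≥ : ∀ Z → sum (cr r) ℕ.≤ cut x (cr r) (cc r) Z
      cut≥ Z = ℕₚ.*-cancelˡ-≤ q {{ℕ.>-nonZero 0<q}} (ι-cancel-≤ (begin
        ι (q ℕ.* sum (cr r))                ≡⟨ cong ι (trans (cong (q ℕ.*_) (total-cr r)) (trans (sym (ℕₚ.*-assoc q r #A)) (trans (cong (ℕ._* #A) (ℕₚ.*-comm q r)) (trans (ℕₚ.*-assoc r q #A) (cong (r ℕ.*_) (sym edges≡A)))))) ⟩
        ι (r ℕ.* edges x)                   ≡⟨ ι-* r (edges x) ⟩
        ι r * ι (edges x)                   ≡⟨ cong (ι r *_) (trans (ι-sum (λ u → sum (λ v → 𝟙 (x u v)))) (∑-cong (λ u → ι-sum (λ v → 𝟙 (x u v))))) ⟩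
        ι r * ∑ (λ u → ∑ (X u))             ≤⟨ weak-duality x (cr r) (cc r) (ι r) (ι q) X (0≤ι r) (0≤ι q) (λ u v → 0≤ι _)
                                                 (λ u v → subst (λ t → ι r * X u v ≤ ι q * t) (ι𝟙≡χ (x u v)) (*-monoˡ (0≤ι _) (ι-mono r≤q)))
                                                 (λ u → ≤-reflexive (trans (cong (ι r *_) (trans (sym (ι-sum (λ v → 𝟙 (x u v)))) (cong ι (row≡ u)))) (scale (side u ∧ vs u))))
                                                 (λ v → ≤-reflexive (trans (cong (ι r *_) (trans (sym (ι-sum (λ u → 𝟙 (x u v)))) (cong ι (col≡ v)))) (scale (not (side v) ∧ vs v)))) Z ⟩
        ι q * ι (cut x (cr r) (cc r) Z)     ≡⟨ ι-* q (cut x (cr r) (cc r) Z) ⟨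
        ι (q ℕ.* cut x (cr r) (cc r) Z)     ∎))
        where open ≤-Reasoning

      flow : Flow x (cr r) (cc r) (sum (cr r))
      flow = max-flow (edges x) x (cr r) (cc r) (sum (cr r)) side ℕₚ.≤-refl x-side
        (λ v sv → cong (λ b → 𝟙 (b ∧ vs v) ℕ.* r) sv) (λ v sv → cong (λ b → 𝟙 (not b ∧ vs v) ℕ.* r) sv) cut≥

      y : Fin n → Fin n → Bool
      y = proj₁ flow
      y⊆x : ∀ u v → y u v ≡ true → x u v ≡ true
      y⊆x = proj₁ (proj₂ flow)
      y-row : ∀ u → sum (λ v → 𝟙 (y u v)) ≡ cr r u
      y-row = sum-tight _ (cr r) (proj₁ (proj₂ (proj₂ flow))) (proj₂ (proj₂ (proj₂ (proj₂ flow))))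
      y-col : ∀ v → sum (λ u → 𝟙 (y u v)) ≡ cc r v
      y-col = sum-tight _ (cc r) (proj₁ (proj₂ (proj₂ (proj₂ flow))))
        (ℕₚ.≤-trans (ℕₚ.≤-reflexive (trans (total-cc r) (trans (cong (r ℕ.*_) (sym #A≡#B)) (sym (total-cr r)))))
          (ℕₚ.≤-trans (proj₂ (proj₂ (proj₂ (proj₂ flow)))) (ℕₚ.≤-reflexive (sum-swap (λ u v → 𝟙 (y u v))))))

      es : Fin n → Fin n → Bool
      es u v = y u v ∨ y v u

    regular-subgraph : RegularSubgraph G r
    regular-subgraph = record
      { vs = vs
      ; es = es
      ; es-sym = λ u v → Boolₚ.∨-comm (y u v) (y v u)
      ; es⊆adj = λ u v → ∨-elim (y u v) (λ yuv → x⊆G u v (y⊆x u v yuv)) (λ yvu → trans (Graph.sym G u v) (x⊆G v u (y⊆x v u yvu)))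
      ; es-vs = λ u v → ∨-elim (y u v)
          (λ yuv → vs-intro u (ℕₚ.≤-trans (proj₁ (x≤ u v (y⊆x u v yuv))) (ℕₚ.m≤m+n (row u) (col u))))
          (λ yvu → vs-intro u (ℕₚ.≤-trans (proj₂ (x≤ v u (y⊆x v u yvu))) (ℕₚ.m≤n+m (col u) (row u))))
      ; nonempty = proj₁ x-edge , vs-intro _ (ℕₚ.≤-trans (proj₁ (x≤ _ _ (proj₂ (proj₂ x-edge)))) (ℕₚ.m≤m+n _ _))
      ; regular = λ v vsv → trans (degreeIn-sum es v) (trans (sum-cong (λ u → split v u))
          (trans (sum-+ (λ u → 𝟙 (y v u)) (λ u → 𝟙 (y u v))) (trans (cong₂ ℕ._+_ (y-row v) (y-col v)) (both v vsv))))
      }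
      where
      ∨-elim : ∀ a {b} {C : Set} → (a ≡ true → C) → (b ≡ true → C) → a ∨ b ≡ true → C
      ∨-elim true  f g eq = f refl
      ∨-elim false f g eq = g eq
      split : ∀ v u → 𝟙 (y v u ∨ y u v) ≡ 𝟙 (y v u) ℕ.+ 𝟙 (y u v)
      split v u = case (y v u) (y u v) (λ yvu yuv → true≢false (proj₁ (x-side v u (y⊆x v u yvu))) (proj₂ (x-side u v (y⊆x u v yuv))))
        where
        case : ∀ a b → (a ≡ true → b ≡ true → ⊥) → 𝟙 (a ∨ b) ≡ 𝟙 a ℕ.+ 𝟙 b
        case false b h = refl
        case true false h = refl
        case true true  h = ⊥-elim (h refl refl)
      both : ∀ v → vs v ≡ true → cr r v ℕ.+ cc r v ≡ r
      both v vsv = case (side v) (vs v) vsv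
        where
        case : ∀ a b → b ≡ true → 𝟙 (a ∧ b) ℕ.* r ℕ.+ 𝟙 (not a ∧ b) ℕ.* r ≡ r
        case true  true _ = trans (ℕₚ.+-identityʳ (r ℕ.+ 0)) (ℕₚ.+-identityʳ r)
        case false true _ = ℕₚ.+-identityʳ r

  -- Rounding a near-regular weighting

  crossing : ∀ {n} → Graph n → (Fin n → Bool) → Fin n → Fin n → Bool
  crossing G side u v = adj G u v ∧ (side u xor side v)

  ∧-true : ∀ a {b} → a ∧ b ≡ true → a ≡ true × b ≡ true
  ∧-true true eq = refl , eq

  -- With D = 2 q - 1, the weights times D / M form a fractional flow with vertex capacities D:
  -- `small` keeps them at most 1, and `dense` makes the total exceed (q - 1) per live vertex. The
  -- integral flow obtained from it meets both conditions of `regular-or-isolated`.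
  module _ {n} (G : Graph n) (side : Fin n → Bool) {W M H : ℚ} (near : NearRegular (crossing G side) W M H)
    (k r : ℕ) (0<M : 0ℚ < M) (r≤q : r ℕ.≤ 2 ^ k)
    (small : ι (2 ^ k ℕ.+ (2 ^ k ∸ 1)) * W ≤ M) (dense : ι (2 ^ k ℕ.+ (2 ^ k ∸ 1)) * H < M) where

    open NearRegular near
    open Weighting weighting

    private
      q D : ℕ
      q = 2 ^ k
      D = q ℕ.+ (q ∸ 1)
      0≤M = <⇒≤ 0<M
      0<q : 0 ℕ.< q
      0<q = ℕₚ.m^n>0 2 k

      out : Fin n → Bool
      out v = side v ∧ l v
      inn : Fin n → Bool
      inn v = not (side v) ∧ l v
      f : Fin n → Fin n → Bool
      f u v = (adj G u v ∧ out u) ∧ inn v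
      cr cc : Fin n → ℕ
      cr v = D ℕ.* 𝟙 (out v)
      cc v = D ℕ.* 𝟙 (inn v)
      X : Fin n → Fin n → ℚ
      X u v = χ (side u ∧ not (side v)) * w u v

      f-parts : ∀ u v → f u v ≡ true → adj G u v ≡ true × out u ≡ true × inn v ≡ true
      f-parts u v fuv with ∧-true (adj G u v ∧ out u) fuv
      ... | p , i with ∧-true (adj G u v) p
      ...   | a , o = a , o , i
      f-side : ∀ u v → f u v ≡ true → side u ≡ true × side v ≡ false
      f-side u v fuv with f-parts u v fuv
      ... | _ , o , i = proj₁ (∧-true (side u) o) , not-true (side v) (proj₁ (∧-true (not (side v)) i))
        where
        not-true : ∀ b → not b ≡ true → b ≡ false
        not-true false _ = refl

      0≤X : ∀ u v → 0ℚ ≤ X u v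
      0≤X u v = 0≤* (0≤χ (side u ∧ not (side v))) (nonneg u v)
      X≤w : ∀ u v → X u v ≤ w u v
      X≤w u v = χ*≤ (side u ∧ not (side v)) (nonneg u v)

      X≤f : ∀ u v → ι D * X u v ≤ M * χ (f u v)
      X≤f u v = case (adj G u v) (side u) (side v) (l u) (l v) (λ a → supported u v (subst (λ a → a ∧ (side u xor side v) ≡ false) (sym a) refl))
                  (inside u v) (λ lv → trans (symmetric u v) (inside v u lv))
        where
        open ≤-Reasoning
        vanish : ∀ t {y} c → y ≡ 0ℚ → ι D * (t * y) ≤ M * χ c
        vanish t c y≡0 = ≤-trans (≤-reflexive (trans (cong (λ y → ι D * (t * y)) y≡0) (zeros (ι D) t))) (0≤* 0≤M (0≤χ c))
          where
          zeros : ∀ d t → d * (t * 0ℚ) ≡ 0ℚ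
          zeros = solve-∀ ℚ-ring
        none : ∀ y c → ι D * (0ℚ * y) ≤ M * χ c
        none y c = ≤-trans (≤-reflexive (zeros (ι D) y)) (0≤* 0≤M (0≤χ c))
          where
          zeros : ∀ d y → d * (0ℚ * y) ≡ 0ℚ
          zeros = solve-∀ ℚ-ring
        full : ι D * (1ℚ * w u v) ≤ M * 1ℚ
        full = ≤-trans (*-monoʳ (0≤ι D) (≤-trans (≤-reflexive (*-identityˡ (w u v))) (bounded u v)))
                 (≤-trans small (≤-reflexive (sym (*-identityʳ M))))
        case : ∀ a s t x y → (a ≡ false → w u v ≡ 0ℚ) → (x ≡ false → w u v ≡ 0ℚ) → (y ≡ false → w u v ≡ 0ℚ) →
          ι D * (χ (s ∧ not t) * w u v) ≤ M * χ ((a ∧ (s ∧ x)) ∧ (not t ∧ y))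
        case a     false t     x     y     ha hx hy = none (w u v) ((a ∧ false) ∧ (not t ∧ y))
        case a     true  true  x     y     ha hx hy = none (w u v) ((a ∧ x) ∧ false)
        case false true  false x     y     ha hx hy = vanish 1ℚ false (ha refl)
        case true  true  false false y     ha hx hy = vanish 1ℚ false (hx refl)
        case true  true  false true  false ha hx hy = vanish 1ℚ false (hy refl)
        case true  true  false true  true  ha hx hy = full

      capacity : ∀ b {y} → y ≤ M → (b ≡ false → y ≡ 0ℚ) → ι D * y ≤ M * ι (D ℕ.* 𝟙 b)
      capacity true  {y} y≤M h = ≤-trans (*-monoʳ (0≤ι D) y≤M) (≤-reflexive (trans (*-comm (ι D) M) (cong (λ d → M * ι d) (sym (ℕₚ.*-identityʳ D)))))
      capacity false {y} y≤M h = ≤-trans (≤-reflexive (trans (cong (ι D *_) (h refl)) (*-zeroʳ (ι D)))) (0≤* 0≤M (0≤ι (D ℕ.* 0)))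

      row : ∀ u → ι D * ∑ (X u) ≤ M * ι (cr u)
      row u = capacity (out u) (≤-trans (∑-mono (X≤w u)) (row≤ u)) (λ o → ∑-0 (λ v → case (side u) (l u) (side v) (inside u v) o))
        where
        case : ∀ s x t {y} → (x ≡ false → y ≡ 0ℚ) → s ∧ x ≡ false → χ (s ∧ not t) * y ≡ 0ℚ
        case false x     t {y} h _ = *-zeroˡ y
        case true  false t h _ = trans (cong (χ (not t) *_) (h refl)) (*-zeroʳ (χ (not t)))

      col : ∀ v → ι D * ∑ (λ u → X u v) ≤ M * ι (cc v)
      col v = capacity (inn v) (≤-trans (∑-mono (λ u → ≤-trans (X≤w u v) (≤-reflexive (symmetric u v)))) (row≤ v))
                (λ i → ∑-0 (λ u → case (side u) (side v) (l v) (λ lv → trans (symmetric u v) (inside v u lv)) i))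
        where
        case : ∀ s t x {y} → (x ≡ false → y ≡ 0ℚ) → not t ∧ x ≡ false → χ (s ∧ not t) * y ≡ 0ℚ
        case false t     x     {y} h _ = *-zeroˡ y
        case true  true  x     {y} h _ = *-zeroˡ y
        case true  false false h _ = trans (cong (1ℚ *_) (h refl)) (*-zeroʳ 1ℚ)

      #live : ℕ
      #live = sum (λ v → 𝟙 (l v))
      count≡ : count l ≡ ι #live
      count≡ = sym (trans (ι-sum (λ v → 𝟙 (l v))) (∑-cong (λ v → ι𝟙≡χ (l v))))

      total : dbl (∑ (λ u → ∑ (X u))) ≡ M * count l - ∑ (gap M l w)
      total = begin
        ∑ (λ u → ∑ (X u)) + ∑ (λ u → ∑ (X u))               ≡⟨ cong (∑ (λ u → ∑ (X u)) +_) (∑-swap X) ⟩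
        ∑ (λ u → ∑ (X u)) + ∑ (λ u → ∑ (λ v → X v u))       ≡⟨ ∑-+ (λ u → ∑ (X u)) (λ u → ∑ (λ v → X v u)) ⟨
        ∑ (λ u → ∑ (X u) + ∑ (λ v → X v u))                 ≡⟨ ∑-cong (λ u → trans (sym (∑-+ (X u) (λ v → X v u))) (∑-cong (both u))) ⟩
        ∑ (λ u → ∑ (w u))                                   ≡⟨ ∑-cong (λ u → row-sum u (l u) refl) ⟩
        ∑ (λ u → M * χ (l u) - gap M l w u)                 ≡⟨ ∑-- (λ u → M * χ (l u)) (gap M l w) ⟩
        ∑ (λ u → M * χ (l u)) - ∑ (gap M l w)               ≡⟨ cong (_- ∑ (gap M l w)) (∑-* M (λ u → χ (l u))) ⟨
        M * count l - ∑ (gap M l w)                         ∎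
        where
        open ≡-Reasoning
        both : ∀ u v → X u v + X v u ≡ w u v
        both u v = trans (cong (λ y → X u v + χ (side v ∧ not (side u)) * y) (symmetric v u))
          (case (side u) (side v) (λ e → supported u v (trans (cong (adj G u v ∧_) e) (Boolₚ.∧-zeroʳ (adj G u v)))))
          where
          sum₁ : ∀ y → 1ℚ * y + 0ℚ * y ≡ y
          sum₁ = solve-∀ ℚ-ring
          sum₂ : ∀ y → 0ℚ * y + 1ℚ * y ≡ y
          sum₂ = solve-∀ ℚ-ring
          sum₀ : ∀ y → y ≡ 0ℚ → 0ℚ * y + 0ℚ * y ≡ y
          sum₀ y refl = refl
          case : ∀ s t → (s xor t ≡ false → w u v ≡ 0ℚ) → χ (s ∧ not t) * w u v + χ (t ∧ not s) * w u v ≡ w u v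
          case true  true  h = sum₀ (w u v) (h refl)
          case true  false h = sum₁ (w u v)
          case false true  h = sum₂ (w u v)
          case false false h = sum₀ (w u v) (h refl)
        row-sum : ∀ u b → l u ≡ b → ∑ (w u) ≡ M * χ b - χ b * (M - ∑ (w u))
        row-sum u true  lu = rearr M (∑ (w u))
          where
          rearr : ∀ M d → d ≡ M * 1ℚ - 1ℚ * (M - d)
          rearr = solve-∀ ℚ-ring
        row-sum u false lu = trans (∑-0 (λ v → inside u v lu)) (rearr M (M - ∑ (w u)))
          where
          rearr : ∀ M y → 0ℚ ≡ M * 0ℚ - 0ℚ * y
          rearr = solve-∀ ℚ-ring

      p : ℕ
      p = q ∸ 1
      ιD≡ : ι D ≡ 1ℚ + dbl (ι p)
      ιD≡ = trans (cong ι (cong (ℕ._+ p) (sym (ℕₚ.m+[n∸m]≡n 0<q)))) (trans (ι-suc (p ℕ.+ p)) (cong (1ℚ +_) (ι-+ p p)))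

      -- Twice the right side is D (M · count l - ∑ gap), and D · ∑ gap is less than M · count l by
      -- `dense`. What remains is more than (D - 1) M · count l, where D - 1 is exactly 2 (q - 1).
      many : ι p * (M * count l) < ι D * ∑ (λ u → ∑ (X u))
      many = *-cancel-< (<⇒≤ (0<dbl 0<1)) (<-from
        ((M - ι D * H) * count l + ι D * (H * count l - ∑ (gap M l w)))
        (0<+ (0<* (p<q⇒0<q-p dense) nonempty) (0≤* (0≤ι D) (p≤q⇒0≤q-p deficit)))
        (trans (cong (_- dbl 1ℚ * (ι p * (M * count l))) (trans (rearr₀ (ι D) (∑ (λ u → ∑ (X u)))) (cong (ι D *_) total)))
          (expand (ι D) ιD≡)))
        where
        rearr₀ : ∀ d s → (1ℚ + 1ℚ) * (d * s) ≡ d * (s + s)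
        rearr₀ = solve-∀ ℚ-ring
        expand : ∀ d → d ≡ 1ℚ + dbl (ι p) →
          d * (M * count l - ∑ (gap M l w)) - dbl 1ℚ * (ι p * (M * count l))
            ≡ (M - d * H) * count l + d * (H * count l - ∑ (gap M l w))
        expand _ refl = ring (ι p) M (count l) (∑ (gap M l w)) H
          where
          ring : ∀ p M c g H → (1ℚ + (p + p)) * (M * c - g) - (1ℚ + 1ℚ) * (p * (M * c))
            ≡ (M - (1ℚ + (p + p)) * H) * c + (1ℚ + (p + p)) * (H * c - g)
          ring = solve-∀ ℚ-ring

      cut> : ∀ Z → suc (#live ℕ.* p) ℕ.≤ cut f cr cc Z
      cut> Z = ι-cancel-< (*-cancel-< 0≤M (begin-strict
        M * ι (#live ℕ.* p)                 ≡⟨ cong (M *_) (trans (ι-* #live p) (cong (_* ι p) (sym count≡))) ⟩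
        M * (count l * ι p)                 ≡⟨ rearr M (count l) (ι p) ⟩
        ι p * (M * count l)                 <⟨ many ⟩
        ι D * ∑ (λ u → ∑ (X u))             ≤⟨ weak-duality f cr cc (ι D) M X (0≤ι D) 0≤M 0≤X X≤f row col Z ⟩
        M * ι (cut f cr cc Z)               ∎))
        where
        open ≤-Reasoning
        rearr : ∀ M c p → M * (c * p) ≡ p * (M * c)
        rearr = solve-∀ ℚ-ring

      flow : Flow f cr cc (suc (#live ℕ.* p))
      flow = max-flow (edges f) f cr cc (suc (#live ℕ.* p)) side ℕₚ.≤-refl f-side
        (λ v sv → trans (cong (λ b → D ℕ.* 𝟙 (b ∧ l v)) sv) (ℕₚ.*-zeroʳ D))
        (λ v sv → trans (cong (λ b → D ℕ.* 𝟙 (not b ∧ l v)) sv) (ℕₚ.*-zeroʳ D)) cut>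

      y : Fin n → Fin n → Bool
      y = proj₁ flow
      y⊆f : ∀ u v → y u v ≡ true → f u v ≡ true
      y⊆f = proj₁ (proj₂ flow)
      y-side : ∀ u v → y u v ≡ true → side u ≡ true × side v ≡ false
      y-side u v yuv = f-side u v (y⊆f u v yuv)
      y-live : ∀ u v → y u v ≡ true → l u ≡ true × l v ≡ true
      y-live u v yuv = proj₂ (∧-true (side u) (proj₁ (proj₂ (f-parts u v (y⊆f u v yuv)))))
                     , proj₂ (∧-true (not (side v)) (proj₂ (proj₂ (f-parts u v (y⊆f u v yuv)))))

      small-degree : ∀ v → incident side l y y-side y-live y v ℕ.< q ℕ.+ q
      small-degree v = ℕₚ.≤-trans (ℕ.s≤s (ℕₚ.≤-trans
        (ℕₚ.+-mono-≤ (proj₁ (proj₂ (proj₂ flow)) v) (proj₁ (proj₂ (proj₂ (proj₂ flow))) v))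
        (case (side v) (l v)))) (ℕₚ.≤-reflexive (trans (sym (ℕₚ.+-suc q p)) (cong (q ℕ.+_) (ℕₚ.m+[n∸m]≡n 0<q))))
        where
        case : ∀ s x → D ℕ.* 𝟙 (s ∧ x) ℕ.+ D ℕ.* 𝟙 (not s ∧ x) ℕ.≤ D
        case true  true  = ℕₚ.≤-reflexive (trans (cong₂ ℕ._+_ (ℕₚ.*-identityʳ D) (ℕₚ.*-zeroʳ D)) (ℕₚ.+-identityʳ D))
        case false true  = ℕₚ.≤-reflexive (trans (cong (ℕ._+ D ℕ.* 1) (ℕₚ.*-zeroʳ D)) (ℕₚ.*-identityʳ D))
        case true  false = ℕₚ.≤-trans (ℕₚ.≤-reflexive (cong₂ ℕ._+_ (ℕₚ.*-zeroʳ D) (ℕₚ.*-zeroʳ D))) ℕ.z≤n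
        case false false = ℕₚ.≤-trans (ℕₚ.≤-reflexive (cong₂ ℕ._+_ (ℕₚ.*-zeroʳ D) (ℕₚ.*-zeroʳ D))) ℕ.z≤n

      found = regular-or-isolated side l y y-side y-live k small-degree (proj₂ (proj₂ (proj₂ (proj₂ flow))))
      x⊆y = proj₁ (proj₂ found)

    rounded : RegularSubgraph G r
    rounded = RFactor.regular-subgraph G side (proj₁ found) (λ u v xuv → y-side u v (x⊆y u v xuv))
      (λ u v xuv → proj₁ (f-parts u v (y⊆f u v (x⊆y u v xuv)))) q r 0<q r≤q
      (proj₂ (proj₂ (proj₂ found))) (proj₁ (proj₂ (proj₂ found)))

  -- Bipartite subgraphs and minimum degree

  large-cut : ∀ {n} (a : Fin n → Fin n → ℚ) → (∀ v → a v v ≡ 0ℚ) →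
    ∃[ x ] ∑ (λ v → ∑ (a v)) ≤ quad (∑ (λ v → ∑ (λ u → χ (x v) * (1ℚ - χ (x u)) * a v u)))
  large-cut {n} a a-irrefl = x , ≤-trans (≤-reflexive (sym expected)) (neg-cancel (dbl-mono (dbl-mono (proj₂ attained))))
    where
    p : Fin n → ℚ
    p _ = ½
    -- Summed over `v` this is minus the weight of the cut, since `E-attained` bounds an outcome
    -- from above. For uniform bits an ordered pair goes from the set to its complement with
    -- probability 1/4.
    f : Fin n → (Fin n → Bool) → ℚ
    f v x = χ (x v) * affine (- ∑ (a v)) (a v) x
    attained = E-attained p (λ x → ∑ (λ v → f v x)) (λ _ → *≤* (ℤ.+≤+ ℕ.z≤n)) (λ _ → *≤* (ℤ.+≤+ (ℕ.s≤s ℕ.z≤n)))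
    x = proj₁ attained
    2½ : ½ + ½ ≡ 1ℚ
    2½ = refl
    expected : - quad (E p (λ x → ∑ (λ v → f v x))) ≡ ∑ (λ v → ∑ (a v))
    expected = trans (cong (λ s → - quad s) (trans (E-∑ p f) (∑-cong (λ v → trans (E-χ-affine p (- ∑ (a v)) (a v) v (a-irrefl v))
        (cong (λ s → ½ * (- ∑ (a v) + s)) (sym (∑-*ʳ ½ (a v))))))))
      (trans (cong (λ s → - quad s) (trans (∑-cong (λ v → rearr ½ (∑ (a v)))) (sym (∑-* (½ * (½ - 1ℚ)) (λ v → ∑ (a v))))))
        (quarter (∑ (λ v → ∑ (a v)))))
      where
      rearr : ∀ h s → h * (- s + s * h) ≡ h * (h - 1ℚ) * s
      rearr = solve-∀ ℚ-ring
      quarter : ∀ s → - quad (½ * (½ - 1ℚ) * s) ≡ s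
      quarter s = trans (ring ½ s) (trans (cong (λ t → t * (1ℚ + 1ℚ - t) * s) 2½) (ring′ s))
        where
        ring : ∀ h s → - ((h * (h - 1ℚ) * s + h * (h - 1ℚ) * s) + (h * (h - 1ℚ) * s + h * (h - 1ℚ) * s)) ≡ (h + h) * (1ℚ + 1ℚ - (h + h)) * s
        ring = solve-∀ ℚ-ring
        ring′ : ∀ s → 1ℚ * (1ℚ + 1ℚ - 1ℚ) * s ≡ s
        ring′ = solve-∀ ℚ-ring
    value : ∑ (λ v → f v x) ≡ - ∑ (λ v → ∑ (λ u → χ (x v) * (1ℚ - χ (x u)) * a v u))
    value = trans (∑-cong inner) (∑-neg (λ v → ∑ (λ u → χ (x v) * (1ℚ - χ (x u)) * a v u)))
      where
      inner : ∀ v → f v x ≡ - ∑ (λ u → χ (x v) * (1ℚ - χ (x u)) * a v u)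
      inner v = trans (cong (χ (x v) *_) (trans (+-comm (- ∑ (a v)) (∑ (λ u → a v u * χ (x u)))) (sym (∑-- (λ u → a v u * χ (x u)) (a v)))))
        (trans (∑-* (χ (x v)) (λ u → a v u * χ (x u) - a v u)) (trans (∑-cong (λ u → rearr (χ (x v)) (χ (x u)) (a v u))) (∑-neg (λ u → χ (x v) * (1ℚ - χ (x u)) * a v u))))
        where
        rearr : ∀ s t a → s * (a * t - a) ≡ - (s * (1ℚ - t) * a)
        rearr = solve-∀ ℚ-ring
    neg-cancel : quad (∑ (λ v → f v x)) ≤ quad (E p (λ x → ∑ (λ v → f v x))) →
      - quad (E p (λ x → ∑ (λ v → f v x))) ≤ quad (∑ (λ v → ∑ (λ u → χ (x v) * (1ℚ - χ (x u)) * a v u)))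
    neg-cancel le = ≤-trans (neg-antimono-≤ le) (≤-reflexive (trans (cong (λ s → - quad s) value) (rearr (∑ (λ v → ∑ (λ u → χ (x v) * (1ℚ - χ (x u)) * a v u))))))
      where
      rearr : ∀ s → - ((- s + - s) + (- s + - s)) ≡ (s + s) + (s + s)
      rearr = solve-∀ ℚ-ring

  module MinDegree {n} (w : Fin n → Fin n → ℚ) (w-sym : ∀ u v → w u v ≡ w v u) (0≤w : ∀ u v → 0ℚ ≤ w u v)
    (τ : ℚ) (0≤τ : 0ℚ ≤ τ) where

    restrict : (Fin n → Bool) → Fin n → Fin n → ℚ
    restrict S u v = χ (S u) * χ (S v) * w u v

    private
      restrict-sym : ∀ S u v → restrict S u v ≡ restrict S v u
      restrict-sym S u v = cong₂ _*_ (*-comm (χ (S u)) (χ (S v))) (w-sym u v)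

    -- Deleting a vertex of weighted degree at most `τ` lowers the total over ordered pairs by at
    -- most 2 τ and the threshold by exactly 2 τ, so strict density persists. It fails for the empty
    -- set, so the deletions stop before.
    min-degree : ∀ m S → sum (λ v → 𝟙 (S v)) ℕ.≤ m → dbl (τ * count S) < ∑ (λ u → ∑ (restrict S u)) →
      ∃[ S′ ] (∃[ v ] S′ v ≡ true) × (∀ v → S′ v ≡ true → τ ≤ ∑ (restrict S′ v))
    min-degree m S size dense with any? (λ v → (S v ∧ (∑ (restrict S v) ≤𝔹 τ)) Boolₚ.≟ true)
    ... | no none with any? (λ v → S v Boolₚ.≟ true)
    ...   | yes some = S , some , λ v Sv → ≤𝔹-false (case (S v) (∑ (restrict S v) ≤𝔹 τ) Sv (λ eq → none (v , eq)))
      where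
      case : ∀ a b → a ≡ true → (a ∧ b ≡ true → ⊥) → b ≡ false
      case true true  _ h = ⊥-elim (h refl)
      case true false _ h = refl
    ...   | no empty = ⊥-elim (<-irrefl refl (<-≤-trans dense (≤-trans (≤-reflexive (∑-0 (λ u → ∑-0 (λ v → trans (cong (λ b → χ b * χ (S v) * w u v) (off u)) (zeros (χ (S v)) (w u v))))))
                       (0≤dbl (0≤* 0≤τ (0≤count S))))))
      where
      off : ∀ u → S u ≡ false
      off u = Boolₚ.¬-not (λ eq → empty (u , eq))
      zeros : ∀ s t → 0ℚ * s * t ≡ 0ℚ
      zeros = solve-∀ ℚ-ring
    min-degree zero S size dense | yes (v , eq) = ⊥-elim (ℕₚ.<-irrefl refl (ℕₚ.<-≤-trans (subst (λ b → 0 ℕ.< 𝟙 b) (sym (∧ˡ (S v) eq)) (ℕ.s≤s ℕ.z≤n)) (ℕₚ.≤-trans (term≤sum (λ v → 𝟙 (S v)) v) size)))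
      where
      ∧ˡ : ∀ a {b} → a ∧ b ≡ true → a ≡ true
      ∧ˡ true _ = refl
    min-degree (suc m) S size dense | yes (v , eq) = min-degree m S⁻ size⁻ dense⁻
      where
      ∧ˡ : ∀ a {b} → a ∧ b ≡ true → a ≡ true
      ∧ˡ true _ = refl
      ∧ʳ : ∀ a {b} → a ∧ b ≡ true → b ≡ true
      ∧ʳ true eq = eq
      Sv : S v ≡ true
      Sv = ∧ˡ (S v) eq
      low : ∑ (restrict S v) ≤ τ
      low = ≤𝔹-true (∧ʳ (S v) eq)
      S⁻ : Fin n → Bool
      S⁻ u = S u ∧ not (δ u v)
      size⁻ : sum (λ u → 𝟙 (S⁻ u)) ℕ.≤ m
      size⁻ = ℕₚ.+-cancelʳ-≤ 1 _ _ (ℕₚ.≤-trans (ℕₚ.≤-reflexive (trans (cong (λ b → sum (λ u → 𝟙 (S⁻ u)) ℕ.+ 𝟙 b) (sym Sv))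
        (trans (cong (sum (λ u → 𝟙 (S⁻ u)) ℕ.+_) (sym (sum-δ (λ u → 𝟙 (S u)) v))) (trans (sym (sum-+ (λ u → 𝟙 (S⁻ u)) (λ u → 𝟙 (δ u v) ℕ.* 𝟙 (S u))))
          (sum-cong (λ u → split (S u) (δ u v))))))) (ℕₚ.≤-trans size (ℕₚ.≤-reflexive (ℕₚ.+-comm 1 m))))
        where
        split : ∀ a d → 𝟙 (a ∧ not d) ℕ.+ 𝟙 d ℕ.* 𝟙 a ≡ 𝟙 a
        split true  true  = refl
        split true  false = refl
        split false true  = refl
        split false false = refl
      χ-split : ∀ a d → χ (a ∧ not d) + χ d * χ a ≡ χ a
      χ-split true  true  = refl
      χ-split true  false = refl
      χ-split false true  = refl
      χ-split false false = refl
      count⁻ : count S⁻ + 1ℚ ≡ count S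
      count⁻ = trans (cong (count S⁻ +_) (trans (cong χ (sym Sv)) (sym (∑-δ (λ u → χ (S u)) v))))
        (trans (sym (∑-+ (λ u → χ (S⁻ u)) (λ u → χ (δ u v) * χ (S u)))) (∑-cong (λ u → χ-split (S u) (δ u v))))
      total⁻ : ∑ (λ u → ∑ (restrict S u)) ≤ ∑ (λ u → ∑ (restrict S⁻ u)) + dbl τ
      total⁻ = begin
        ∑ (λ a → ∑ (restrict S a))
          ≤⟨ ∑-mono (λ a → ∑-mono (λ b → pointwise a b)) ⟩
        ∑ (λ a → ∑ (λ b → restrict S⁻ a b + (χ (δ a v) * restrict S a b + χ (δ b v) * restrict S a b)))
          ≡⟨ ∑-cong (λ a → trans (∑-+ (restrict S⁻ a) _) (cong (∑ (restrict S⁻ a) +_) (trans (∑-+ (λ b → χ (δ a v) * restrict S a b) _)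
               (cong₂ _+_ (sym (∑-* (χ (δ a v)) (restrict S a))) (∑-δ (restrict S a) v))))) ⟩
        ∑ (λ a → ∑ (restrict S⁻ a) + (χ (δ a v) * ∑ (restrict S a) + restrict S a v))
          ≡⟨ trans (∑-+ (λ a → ∑ (restrict S⁻ a)) _) (cong (∑ (λ a → ∑ (restrict S⁻ a)) +_) (∑-+ (λ a → χ (δ a v) * ∑ (restrict S a)) (λ a → restrict S a v))) ⟩
        ∑ (λ a → ∑ (restrict S⁻ a)) + (∑ (λ a → χ (δ a v) * ∑ (restrict S a)) + ∑ (λ a → restrict S a v))
          ≡⟨ cong (∑ (λ a → ∑ (restrict S⁻ a)) +_) (cong₂ _+_ (∑-δ (λ a → ∑ (restrict S a)) v) (∑-cong (λ a → restrict-sym S a v))) ⟩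
        ∑ (λ a → ∑ (restrict S⁻ a)) + dbl (∑ (restrict S v))
          ≤⟨ +-monoʳ-≤ (∑ (λ a → ∑ (restrict S⁻ a))) (dbl-mono low) ⟩
        ∑ (λ a → ∑ (restrict S⁻ a)) + dbl τ ∎
        where
        open ≤-Reasoning
        pointwise : ∀ a b → restrict S a b ≤ restrict S⁻ a b + (χ (δ a v) * restrict S a b + χ (δ b v) * restrict S a b)
        pointwise a b = ≤-from (χ (S a) * χ (S b) * w a b * (χ (δ a v) * χ (δ b v)))
          (0≤* (0≤* (0≤* (0≤χ (S a)) (0≤χ (S b))) (0≤w a b)) (0≤* (0≤χ (δ a v)) (0≤χ (δ b v))))
          (trans (cong₂ (λ s t → s * t * w a b + (χ (δ a v) * restrict S a b + χ (δ b v) * restrict S a b) - restrict S a b) (χ-∧-not (S a) (δ a v)) (χ-∧-not (S b) (δ b v)))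
            (ring (χ (S a)) (χ (S b)) (χ (δ a v)) (χ (δ b v)) (w a b)))
          where
          χ-∧-not : ∀ a d → χ (a ∧ not d) ≡ χ a * (1ℚ - χ d)
          χ-∧-not true  true  = refl
          χ-∧-not true  false = refl
          χ-∧-not false true  = refl
          χ-∧-not false false = refl
          ring : ∀ s t d d′ w → s * (1ℚ - d) * (t * (1ℚ - d′)) * w + (d * (s * t * w) + d′ * (s * t * w)) - s * t * w ≡ s * t * w * (d * d′)
          ring = solve-∀ ℚ-ring
      dense⁻ : dbl (τ * count S⁻) < ∑ (λ u → ∑ (restrict S⁻ u))
      dense⁻ = <-from ((∑ (λ u → ∑ (restrict S u)) - dbl (τ * count S)) + (∑ (λ u → ∑ (restrict S⁻ u)) + dbl τ - ∑ (λ u → ∑ (restrict S u))))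
        (0<+ (p<q⇒0<q-p dense) (p≤q⇒0≤q-p total⁻))
        (trans (ring τ (count S⁻) (∑ (λ u → ∑ (restrict S u))) (∑ (λ u → ∑ (restrict S⁻ u))))
          (cong (λ c → (∑ (λ u → ∑ (restrict S u)) - dbl (τ * c)) + (∑ (λ u → ∑ (restrict S⁻ u)) + dbl τ - ∑ (λ u → ∑ (restrict S u)))) count⁻))
        where
        ring : ∀ τ c s t → t - (τ * c + τ * c) ≡ (s - (τ * (c + 1ℚ) + τ * (c + 1ℚ))) + (t + (τ + τ) - s)
        ring = solve-∀ ℚ-ring

  -- The constants and the assembly

  2^-between : ∀ r → 1 ℕ.≤ r → ∃[ k ] (r ℕ.≤ 2 ^ k) × (2 ^ k ℕ.< r ℕ.+ r)
  2^-between (suc zero) _ = 0 , ℕ.s≤s ℕ.z≤n , ℕ.s≤s (ℕ.s≤s ℕ.z≤n)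
  2^-between (suc (suc r)) _ with 2^-between (suc r) (ℕ.s≤s ℕ.z≤n)
  ... | k , r≤q , q<2r with suc (suc r) ℕ.≤? 2 ^ k
  ...   | yes r<q = k , r<q , ℕₚ.≤-trans q<2r (ℕₚ.+-mono-≤ (ℕₚ.n≤1+n (suc r)) (ℕₚ.n≤1+n (suc r)))
  -- Here `2 ^ k` equals `suc r`, so a single doubling reaches the next bound.
  ...   | no  r≮q = suc k , subst (suc (suc r) ℕ.≤_) (sym 2q≡) (ℕₚ.≤-trans (ℕ.s≤s (ℕ.s≤s (ℕₚ.m≤m+n r r))) (ℕₚ.≤-reflexive (cong suc (sym (ℕₚ.+-suc r r)))))
                          , subst (ℕ._< suc (suc r) ℕ.+ suc (suc r)) (sym 2q≡) (ℕₚ.+-mono-<-≤ {suc r} {suc (suc r)} ℕₚ.≤-refl (ℕₚ.n≤1+n (suc r)))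
    where
    2q≡ : 2 ^ suc k ≡ suc r ℕ.+ suc r
    2q≡ = trans (cong (2 ^ k ℕ.+_) (ℕₚ.+-identityʳ (2 ^ k))) (cong₂ ℕ._+_ q≡ q≡)
      where
      q≡ : 2 ^ k ≡ suc r
      q≡ = ℕₚ.≤-antisym (ℕₚ.≤-pred (ℕₚ.≰⇒> r≮q)) r≤q

  term≤max : ∀ n (f : Fin n → ℕ) i → f i ℕ.≤ foldr ℕ._⊔_ 0 (List.map f (allFin n))
  term≤max n f i = subst (λ xs → f i ℕ.≤ foldr ℕ._⊔_ 0 xs) (sym (map-tabulate (λ i → i) f)) (go n f i)
    where
    go : ∀ n (f : Fin n → ℕ) i → f i ℕ.≤ foldr ℕ._⊔_ 0 (List.tabulate f)
    go (suc n) f zero    = ℕₚ.m≤m⊔n (f zero) _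
    go (suc n) f (suc i) = ℕₚ.≤-trans (go n (f ∘ suc) i) (ℕₚ.m≤n⊔m (f zero) _)

  module Constant (lam : ℚ) (1≤lam : 1ℚ ≤ lam) where
    β B : ℚ
    β = ι 8 * lam
    B = β * (β * β * 1ℚ)

    1≤8 : 1ℚ ≤ ι 8
    1≤8 = 1≤ι {8} (ℕ.s≤s ℕ.z≤n)
    1≤* : ∀ {a b} → 1ℚ ≤ a → 1ℚ ≤ b → 1ℚ ≤ a * b
    1≤* {a} {b} 1≤a 1≤b = ≤-trans (≤-reflexive (sym (*-identityˡ 1ℚ))) (*-mono 0≤1 (≤-trans 0≤1 1≤b) 1≤a 1≤b)
    1≤β : 1ℚ ≤ β
    1≤β = 1≤* 1≤8 1≤lam
    1≤V : 1ℚ ≤ β * β * 1ℚ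
    1≤V = 1≤* (1≤* 1≤β 1≤β) ≤-refl
    1≤B : 1ℚ ≤ B
    1≤B = 1≤* 1≤β 1≤V
    0<B : 0ℚ < B
    0<B = <-≤-trans 0<1 1≤B
    -- 20000 exceeds the constants 16384 of near-regular, and 16 and 4 · 4224 of the rounding.
    0<K : 0ℚ < ι 20000 * B
    0<K = 0<* (<-≤-trans 0<1 (1≤ι {20000} (ℕ.s≤s ℕ.z≤n))) 0<B
    inverse = reciprocal 0<K
    c : ℚ
    c = proj₁ inverse
    0<c : 0ℚ < c
    0<c = proj₁ (proj₂ inverse)

  module Fixed (lam : ℚ) (1≤lam : 1ℚ ≤ lam) (n : ℕ) (G : Graph (suc n))
    (maxDegree≤ : toℚ (maxDegree G) ≤ lam * avgDegree G)
    (r : ℕ) (1≤r : 1 ℕ.≤ r) (r≤cd : toℚ r ≤ Constant.c lam 1≤lam * avgDegree G) where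

    open Constant lam 1≤lam

    d M : ℚ
    d = avgDegree G
    M = lam * d

    Kr≤d : ι 20000 * B * ι r ≤ d
    Kr≤d = ≤-trans (*-monoʳ (<⇒≤ 0<K) (subst (_≤ c * d) (sym (ι≡toℚ r)) r≤cd)) (≤-reflexive
      (trans (rearr (ι 20000 * B) c d) (trans (cong (_* d) (proj₂ (proj₂ inverse))) (*-identityˡ d))))
      where
      rearr : ∀ k c d → k * (c * d) ≡ c * k * d
      rearr = solve-∀ ℚ-ring
    1≤ιr : 1ℚ ≤ ι r
    1≤ιr = 1≤ι 1≤r
    0<d : 0ℚ < d
    0<d = <-≤-trans (0<* 0<K (<-≤-trans 0<1 1≤ιr)) Kr≤d
    d≤M : d ≤ M
    d≤M = ≤-trans (≤-reflexive (sym (*-identityˡ d))) (*-monoˡ (<⇒≤ 0<d) 1≤lam)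
    0<M : 0ℚ < M
    0<M = <-≤-trans 0<d d≤M

    a : Fin (suc n) → Fin (suc n) → ℚ
    a u v = χ (adj G u v)

    degree≤M : ∀ v → ∑ (a v) ≤ M
    degree≤M v = begin
      ∑ (a v)                                   ≡⟨ ∑-cong (λ u → sym (ι𝟙≡χ (adj G v u))) ⟩
      ∑ (λ u → ι (𝟙 (adj G v u)))               ≡⟨ ι-sum (λ u → 𝟙 (adj G v u)) ⟨
      ι (sum (λ u → 𝟙 (adj G v u)))             ≡⟨ cong ι (degreeIn-sum (adj G) v) ⟨
      ι (degree G v)                            ≤⟨ ι-mono (term≤max (suc n) (degree G) v) ⟩
      ι (maxDegree G)                           ≡⟨ ι≡toℚ (maxDegree G) ⟩
      toℚ (maxDegree G)                         ≤⟨ maxDegree≤ ⟩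
      M ∎
      where open ≤-Reasoning

    total : ∑ (λ v → ∑ (a v)) ≡ d * ι (suc n)
    total = begin
      ∑ (λ v → ∑ (a v))                         ≡⟨ ∑-cong (λ v → trans (∑-cong (λ u → sym (ι𝟙≡χ (adj G v u)))) (sym (ι-sum (λ u → 𝟙 (adj G v u))))) ⟩
      ∑ (λ v → ι (sum (λ u → 𝟙 (adj G v u))))   ≡⟨ ι-sum _ ⟨
      ι (sum (λ v → sum (λ u → 𝟙 (adj G v u)))) ≡⟨ cong ι (trans (sum-cong (λ v → sym (degreeIn-sum (adj G) v))) (sym (sum-allFin (suc n) (degree G)))) ⟩
      ι (degreeSum G)                           ≡⟨ ι≡toℚ (degreeSum G) ⟩
      toℚ (degreeSum G)                         ≡⟨ /-*-cancel (ℤ.+ degreeSum G) n ⟨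
      d * ι (suc n) ∎
      where open ≡-Reasoning

    bipartition = large-cut a (λ v → cong χ (Graph.irrefl G v))
    side : Fin (suc n) → Bool
    side = proj₁ bipartition
    e : Fin (suc n) → Fin (suc n) → Bool
    e = crossing G side

    w : Fin (suc n) → Fin (suc n) → ℚ
    w u v = χ (e u v)
    w-sym : ∀ u v → w u v ≡ w v u
    w-sym u v = cong χ (cong₂ _∧_ (Graph.sym G u v) (Boolₚ.xor-comm (side u) (side v)))

    cross-total : d * ι (suc n) ≤ dbl (∑ (λ u → ∑ (w u)))
    cross-total = begin
      d * ι (suc n)                              ≡⟨ total ⟨
      ∑ (λ v → ∑ (a v))                          ≤⟨ proj₂ bipartition ⟩
      quad S                                     ≡⟨⟩
      dbl (S + S)                                ≡⟨ cong (λ t → dbl (S + t)) (∑-swap s) ⟩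
      dbl (S + ∑ (λ u → ∑ (λ v → s v u)))        ≡⟨ cong dbl (sym (∑-+ (λ u → ∑ (s u)) (λ u → ∑ (λ v → s v u)))) ⟩
      dbl (∑ (λ u → ∑ (s u) + ∑ (λ v → s v u)))  ≡⟨ cong dbl (∑-cong (λ u → trans (sym (∑-+ (s u) (λ v → s v u))) (∑-cong (both u)))) ⟩
      dbl (∑ (λ u → ∑ (w u))) ∎
      where
      open ≤-Reasoning
      s : Fin (suc n) → Fin (suc n) → ℚ
      s u v = χ (side u) * (1ℚ - χ (side v)) * a u v
      S = ∑ (λ u → ∑ (s u))
      both : ∀ u v → s u v + s v u ≡ w u v
      both u v = trans (cong (λ b → s u v + χ (side v) * (1ℚ - χ (side u)) * χ b) (Graph.sym G v u)) (case (side u) (side v) (adj G u v))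
        where
        case : ∀ s t b → χ s * (1ℚ - χ t) * χ b + χ t * (1ℚ - χ s) * χ b ≡ χ (b ∧ (s xor t))
        case true  true  true  = refl
        case true  true  false = refl
        case true  false true  = refl
        case true  false false = refl
        case false true  true  = refl
        case false true  false = refl
        case false false true  = refl
        case false false false = refl

    eighth = reciprocal (<-≤-trans 0<1 1≤8)
    -- The crossing edges still give average degree at least d / 2, and 2 τ = d / 4 is strictly
    -- below it, as `min-degree` requires. Since M = λ d, this is the origin of β = 8 λ.
    τ : ℚ
    τ = d * proj₁ eighth
    0<τ : 0ℚ < τ
    0<τ = 0<* 0<d (proj₁ (proj₂ eighth))
    8τ≡d : ι 8 * τ ≡ d
    8τ≡d = trans (rearr (ι 8) d (proj₁ eighth)) (trans (cong (d *_) (proj₂ (proj₂ eighth))) (*-identityʳ d))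
      where
      rearr : ∀ c d i → c * (d * i) ≡ d * (i * c)
      rearr = solve-∀ ℚ-ring

    open MinDegree w w-sym (λ u v → 0≤χ (e u v)) τ (<⇒≤ 0<τ)

    everything : Fin (suc n) → Bool
    everything _ = true

    count-everything : count everything ≡ ι (suc n)
    count-everything = trans (∑-cong {f = λ _ → 1ℚ} (λ _ → sym ι-1)) (trans (sym (ι-sum {suc n} (λ _ → 1))) (cong ι (ones (suc n))))
      where
      ones : ∀ m → sum {m} (λ _ → 1) ≡ m
      ones zero    = sum-zero _
      ones (suc m) = trans (sum-suc {m} (λ _ → 1)) (cong suc (ones m))

    0<n : 0ℚ < ι (suc n)
    0<n = <-≤-trans 0<1 (1≤ι {suc n} (ℕ.s≤s ℕ.z≤n))

    dense : dbl (τ * count everything) < ∑ (λ u → ∑ (restrict everything u))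
    dense = subst₂ _<_ (cong (λ t → dbl (τ * t)) (sym count-everything)) (∑-cong (λ u → ∑-cong (λ v → ones (w u v))))
      (<-≤-trans strict half)
      where
      ones : ∀ s → s ≡ 1ℚ * 1ℚ * s
      ones = solve-∀ ℚ-ring
      X = τ * ι (suc n)
      T = ∑ (λ u → ∑ (w u))
      strict : dbl X < quad X
      strict = <-from (dbl X) (0<dbl (0<* 0<τ 0<n)) (rearr X)
        where
        rearr : ∀ x → (x + x) + (x + x) - (x + x) ≡ x + x
        rearr = solve-∀ ℚ-ring
      half : quad X ≤ T
      half = *-cancel (0<dbl 0<1) (begin
        dbl 1ℚ * quad X          ≡⟨ double (quad X) ⟩
        dbl (quad X)             ≡⟨ trans (dbl≡ι2* (quad X)) (trans (cong (ι 2 *_) (quad≡ι4* X)) (trans (sym (*-assoc (ι 2) (ι 4) X)) (cong (_* X) (sym (ι-* 2 4))))) ⟩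
        ι 8 * X                  ≡⟨ trans (sym (*-assoc (ι 8) τ (ι (suc n)))) (cong (_* ι (suc n)) 8τ≡d) ⟩
        d * ι (suc n)            ≤⟨ cross-total ⟩
        dbl T                    ≡⟨ double T ⟨
        dbl 1ℚ * T               ∎)
        where
        open ≤-Reasoning
        double : ∀ x → (1ℚ + 1ℚ) * x ≡ x + x
        double = solve-∀ ℚ-ring

    pruned = min-degree (sum (λ v → 𝟙 (everything v))) everything ℕₚ.≤-refl dense
    l₀ : Fin (suc n) → Bool
    l₀ = proj₁ pruned
    w₀ : Fin (suc n) → Fin (suc n) → ℚ
    w₀ = restrict l₀

    weighting₀ : Weighting e 1ℚ M w₀
    weighting₀ = record
      { symmetric = λ u v → cong₂ _*_ (*-comm (χ (l₀ u)) (χ (l₀ v))) (w-sym u v)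
      ; nonneg = λ u v → 0≤* (0≤* (0≤χ (l₀ u)) (0≤χ (l₀ v))) (0≤χ (e u v))
      ; bounded = λ u v → ≤-trans (w₀≤w u v) (χ≤1 (e u v))
      ; supported = λ u v euv → trans (cong (λ b → χ (l₀ u) * χ (l₀ v) * χ b) euv) (*-zeroʳ (χ (l₀ u) * χ (l₀ v)))
      ; row≤ = λ v → ≤-trans (∑-mono (λ u → ≤-trans (w₀≤w v u) (χ-∧ (adj G v u) _))) (degree≤M v)
      }
      where
      w₀≤w : ∀ u v → w₀ u v ≤ w u v
      w₀≤w u v = ≤-trans (≤-reflexive (*-assoc (χ (l₀ u)) (χ (l₀ v)) (w u v))) (≤-trans (χ*≤ (l₀ u) (0≤* (0≤χ (l₀ v)) (0≤χ (e u v)))) (χ*≤ (l₀ v) (0≤χ (e u v))))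

    e-irrefl : ∀ v → e v v ≡ false
    e-irrefl v = cong (_∧ (side v xor side v)) (Graph.irrefl G v)

    low : ∀ v → l₀ v ≡ true → M ≤ β * ∑ (w₀ v)
    low v lv = ≤-trans (≤-reflexive (trans (cong (lam *_) (sym 8τ≡d)) (rearr lam (ι 8) τ))) (*-monoʳ (≤-trans 0≤1 1≤β) (proj₂ (proj₂ pruned) v lv))
      where
      rearr : ∀ l c t → l * (c * t) ≡ c * l * t
      rearr = solve-∀ ℚ-ring

    off : ∀ u v → l₀ u ≡ false → w₀ u v ≡ 0ℚ
    off u v lu = trans (cong (λ b → χ b * χ (l₀ v) * w u v) lu) (zeros (χ (l₀ v)) (w u v))
      where
      zeros : ∀ s t → 0ℚ * s * t ≡ 0ℚ
      zeros = solve-∀ ℚ-ring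

    some : 0ℚ < count l₀
    some = <-≤-trans 0<1 (≤-trans (≤-reflexive (trans (cong χ (sym lv)) (sym (∑-δ (λ u → χ (l₀ u)) v)))) (∑-mono (λ u → χ*≤ (δ u v) (0≤χ (l₀ u)))))
      where
      v = proj₁ (proj₁ (proj₂ pruned))
      lv : l₀ v ≡ true
      lv = proj₂ (proj₁ (proj₂ pruned))

    ≤d : ∀ {m} → m ℕ.≤ 20000 → ∀ {b} → 0ℚ ≤ b → b ≤ B → ι m * b * ι r ≤ M
    ≤d {m} m≤ {b} 0≤b b≤B = ≤-trans (≤-trans (*-monoˡ (0≤ι r) (*-mono (0≤ι m) (<⇒≤ 0<B) (ι-mono {m} {20000} m≤) b≤B)) Kr≤d) d≤M

    near : NearRegular e (quad (β * β * 1ℚ)) M (ι 4224 * B)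
    near = FirstRound.near-regular l₀ e-irrefl 0<M 1≤β weighting₀ low off some
      (≤-trans (≤-trans (≤-reflexive (sym (*-identityʳ (ι 16384 * B)))) (*-monoʳ (0≤* (0≤ι 16384) (<⇒≤ 0<B)) 1≤ιr)) (≤d (ℕₚ.≤ᵇ⇒≤ 16384 20000 _) (<⇒≤ 0<B) ≤-refl))

    power = 2^-between r 1≤r
    k : ℕ
    k = proj₁ power
    D : ℕ
    D = 2 ^ k ℕ.+ (2 ^ k ∸ 1)

    D≤4r : ι D ≤ ι 4 * ι r
    D≤4r = ≤-trans (ι-mono {D} {4 ℕ.* r} (ℕₚ.≤-trans (ℕₚ.+-mono-≤ q≤ (ℕₚ.≤-trans (ℕₚ.m∸n≤m (2 ^ k) 1) q≤)) (ℕₚ.≤-reflexive (four r)))) (≤-reflexive (ι-* 4 r))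
      where
      q≤ = ℕₚ.<⇒≤ (proj₂ (proj₂ power))
      four : ∀ r → (r ℕ.+ r) ℕ.+ (r ℕ.+ r) ≡ 4 ℕ.* r
      four r = trans (ℕₚ.+-assoc r r (r ℕ.+ r)) (cong (λ t → r ℕ.+ (r ℕ.+ (r ℕ.+ t))) (sym (ℕₚ.+-identityʳ r)))

    scaled : ∀ m b → 0ℚ ≤ b → ι D * (ι m * b) ≤ ι (4 ℕ.* m) * b * ι r
    scaled m b 0≤b = ≤-trans (*-monoˡ (0≤* (0≤ι m) 0≤b) D≤4r) (≤-reflexive (trans (rearr (ι 4) (ι r) (ι m) b) (cong (λ t → t * b * ι r) (sym (ι-* 4 m)))))
      where
      rearr : ∀ c r m b → c * r * (m * b) ≡ c * m * b * r
      rearr = solve-∀ ℚ-ring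

    small-weight : ι D * quad (β * β * 1ℚ) ≤ M
    small-weight = ≤-trans (≤-trans (≤-reflexive (cong (ι D *_) (quad≡ι4* (β * β * 1ℚ)))) (scaled 4 (β * β * 1ℚ) 0≤V))
      (≤d (ℕₚ.≤ᵇ⇒≤ 16 20000 _) 0≤V (≤-trans (≤-reflexive (sym (*-identityˡ (β * β * 1ℚ)))) (*-monoˡ 0≤V 1≤β)))
      where
      0≤V : 0ℚ ≤ β * β * 1ℚ
      0≤V = ≤-trans 0≤1 1≤V

    small-deficit : ι D * (ι 4224 * B) < M
    small-deficit = ≤-<-trans (scaled 4224 B (<⇒≤ 0<B)) (<-≤-trans
      -- 16896 = 4 · 4224, as D ≤ 4 r; the remaining 3104 of the 20000 makes the inequality strict.
      (<-from (ι 3104 * B * ι r) (0<* (0<* (<-≤-trans 0<1 (1≤ι {3104} (ℕ.s≤s ℕ.z≤n))) 0<B) (<-≤-trans 0<1 1≤ιr))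
        (trans (cong (λ t → t * B * ι r - ι 16896 * B * ι r) (ι-+ 16896 3104)) (rearr (ι 16896) (ι 3104) B (ι r))))
      (≤-trans Kr≤d d≤M))
      where
      rearr : ∀ c d B r → (c + d) * B * r - c * B * r ≡ d * B * r
      rearr = solve-∀ ℚ-ring

    result : RegularSubgraph G r
    result = rounded G side near k r 0<M (proj₁ (proj₂ power)) small-weight small-deficit

open import Defs
open import Data.Nat using (ℕ; suc; _≤_)
open import Data.Rational using (ℚ; 0ℚ; 1ℚ; _*_) renaming (_≤_ to _≤ℚ_; _<_ to _<ℚ_)
open import Data.Product using (∃-syntax; _×_; _,_)

theorem1p13 : ∀ (lam : ℚ) → 1ℚ ≤ℚ lam →
    ∃[ c ] ((0ℚ <ℚ c) ×
    (∀ (n : ℕ) (G : Graph (suc n)) →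
    toℚ (maxDegree G) ≤ℚ lam * avgDegree G →
    ∀ (r : ℕ) → 1 ≤ r → toℚ r ≤ℚ c * avgDegree G →
    RegularSubgraph G r))
theorem1p13 lam 1≤lam = Weighted.Constant.c lam 1≤lam , Weighted.Constant.0<c lam 1≤lam , Weighted.Fixed.result lam 1≤lam
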